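{- For every sequence number $s$, if $B_0\underline{s} =_{\omega} B_1\underline{s}$, then the subtree $T(s)$ of $T$ rooted at $s$ is well founded.
   Context: Untyped $\lambda$-calculus; $[N/x]U$ is capture-avoiding substitution; $\underline{k}$ is the $k$-th Church numeral; $\mathbf{\Omega} \equiv (\lambda x.xx)(\lambda x.xx)$; $\mathbf{K^*} \equiv \lambda ab.b$; a closed term is unsolvable if no application of it to closed terms $\beta$-converts to $\lambda x.x$. The relation $=_{\omega}$ on closed terms is the least relation containing $M=_\omega M$, $(\lambda x.U)N =_{\omega} [N/x]U$ and its symmetric version for closed $(\lambda x.U)N$, $M=_\omega\mathbf{\Omega}$ and $\mathbf{\Omega}=_\omega M$ for closed unsolvable $M$, closed under the Leibniz rule (from $[M/z]X =_{\omega} [M/z]Y$ and $M =_{\omega} N$, with $X,Y$ having at most $z$ free, infer $[N/z]X =_{\omega} [N/z]Y$) and the $\omega$-rule (from $PM=_\omega QM$ for all closed $M$ infer $P=_\omega Q$). Fix an effective coding of finite sequences of natural numbers by natural numbers ("sequence numbers"); $s' < s$ means $s'$ is a proper initial subsequence of $s$; $\bar f(m)$ is the code of $\langle f(0),\dots,f(m-1)\rangle$. Fix a $\mathbf{\Pi^1_1}$ predicate $P(n) \Leftrightarrow \forall f\,\exists m\, R(\bar f(m), n)$ with $R$ recursive, and fix $n$. $s$ is $n$-unsecured if there is no $s'<s$ with $R(s',n)$; $T$ is the (recursive) tree of $n$-unsecured sequence numbers; $T(s)$ is the set of elements of $T$ extending $s$ (empty if $s\notin T$); a tree is well founded if it has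 no infinite strictly increasing chain. Let $*$ be a closed term (written infix) representing concatenation of sequence numbers such that $\underline{s}*z$ has a $\beta\mathbf{\Omega}$-normal form beginning with $z$, and let $x^{+}$ denote a closed successor term applied to $x$. Let $D$ be a closed term such that: for every numeral $\underline{m}$, $Dx\underline{m}$ has a $\beta\mathbf{\Omega}$-normal form beginning with $x$ and containing $\underline{m}$; $D\underline{s} =_\omega \mathbf{K^*}$ if $s\in T$ and $D\underline{s}=_\omega \mathbf{\Omega}$ otherwise; and if $s\in T$ then $D\underline{s}$ reduces to $\mathbf{K^*}$ by head $\beta$-reductions whose redexes are closed. Write $[A,B] \equiv \lambda z.zAB$. Define $\mathbf{\Theta} \equiv (\lambda ab.b(aab))(\lambda ab.b(aab))$, and for $i=0,1$: $F_i \equiv \lambda wxy.\, Dx\underline{i}(\lambda ab.b(aab))(\lambda ab.b(aab))(\lambda axf.[fx,\ x(\lambda u.u\mathbf{\Omega})y(a(x^{+})f)])\underline{0}(\lambda z.w(x*z))$ and $B_i \equiv \mathbf{\Theta}F_i$. -}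

module Defs where

open import Data.Nat using (ℕ; zero; suc)
open import Data.Fin using (Fin; zero; suc)
open import Data.List using (List; []; _∷_; _++_)
open import Data.Bool using (Bool; true; false)
open import Data.Product using (Σ; ∃; _×_; _,_)
open import Data.Empty using (⊥)
open import Relation.Nullary using (¬_)
open import Relation.Binary.PropositionalEquality using (_≡_)
open import Function.Definitions using (Injective)

infixl 7 _·_
infix 8 _[_]
infix 4 _→β_ _=β_ _→βΩ_ _↠βΩ_ _≺_ _⪯_

data Term (k : ℕ) : Set where
  var : Fin k → Term k
  ƛ   : Term (suc k) → Term k
  _·_ : Term k → Term k → Term k

ext : ∀ {k l} → (Fin k → Fin l) → Fin (suc k) → Fin (suc l)
ext ρ zero    = zero
ext ρ (suc i) = suc (ρ i)

rename : ∀ {k l} → (Fin k → Fin l) → Term k → Term l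
rename ρ (var i) = var (ρ i)
rename ρ (ƛ M)   = ƛ (rename (ext ρ) M)
rename ρ (M · N) = rename ρ M · rename ρ N

exts : ∀ {k l} → (Fin k → Term l) → Fin (suc k) → Term (suc l)
exts σ zero    = var zero
exts σ (suc i) = rename suc (σ i)

subst : ∀ {k l} → (Fin k → Term l) → Term k → Term l
subst σ (var i) = σ i
subst σ (ƛ M)   = ƛ (subst (exts σ) M)
subst σ (M · N) = subst σ M · subst σ N

single : ∀ {k} → Term k → Fin (suc k) → Term k
single N zero    = N
single N (suc i) = var i

_[_] : ∀ {k} → Term (suc k) → Term k → Term k
U [ N ] = subst (single N) U

noVar : ∀ {k} → Fin 0 → Fin k
noVar ()

wk0 : ∀ {k} → Term 0 → Term k
wk0 = rename noVar

apps : ∀ {k} → Term k → List (Term k) → Term k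
apps M []       = M
apps M (N ∷ Ns) = apps (M · N) Ns

lams : (k : ℕ) → Term k → Term 0
lams zero    M = M
lams (suc k) M = lams k (ƛ M)

I : Term 0
I = ƛ (var zero)

Ω : Term 0
Ω = ω · ω
  where ω = ƛ (var zero · var zero)

K* : Term 0
K* = ƛ (ƛ (var zero))

iterF : ℕ → Term 2
iterF zero    = var zero
iterF (suc m) = var (suc zero) · iterF m

⌜_⌝ : ℕ → Term 0
⌜ m ⌝ = ƛ (ƛ (iterF m))

data _→β_ {k : ℕ} : Term k → Term k → Set where
  β    : ∀ (U : Term (suc k)) N → (ƛ U) · N →β U [ N ]
  appL : ∀ {M M'} N → M →β M' → M · N →β M' · N
  appR : ∀ M {N N'} → N →β N' → M · N →β M · N'
  lam  : ∀ {M M'} → M →β M' → ƛ M →β ƛ M'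

data _=β_ {k : ℕ} : Term k → Term k → Set where
  step  : ∀ {M N} → M →β N → M =β N
  refl  : ∀ {M} → M =β M
  sym   : ∀ {M N} → M =β N → N =β M
  trans : ∀ {M N P} → M =β N → N =β P → M =β P

Unsolvable : Term 0 → Set
Unsolvable M = ¬ (Σ (List (Term 0)) λ Ns → apps M Ns =β I)

UnsolvableO : ∀ {k} → Term k → Set
UnsolvableO {k} M = Unsolvable (lams k M)

infix 4 _=ω_

data _=ω_ : Term 0 → Term 0 → Set where
  ω-refl    : ∀ M → M =ω M
  ω-β       : ∀ (U : Term 1) (N : Term 0) → (ƛ U) · N =ω U [ N ]
  ω-βsym    : ∀ (U : Term 1) (N : Term 0) → U [ N ] =ω (ƛ U) · N
  ω-unsol   : ∀ M → Unsolvable M → M =ω Ω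
  ω-unsolsym : ∀ M → Unsolvable M → Ω =ω M
  ω-leibniz : ∀ (X Y : Term 1) (M N : Term 0) →
              X [ M ] =ω Y [ M ] → M =ω N → X [ N ] =ω Y [ N ]
  ω-rule    : ∀ (P Q : Term 0) → (∀ (M : Term 0) → P · M =ω Q · M) → P =ω Q

data _→βΩ_ {k : ℕ} : Term k → Term k → Set where
  β    : ∀ (U : Term (suc k)) N → (ƛ U) · N →βΩ U [ N ]
  Ωr   : ∀ M → UnsolvableO M → ¬ (M ≡ wk0 Ω) → M →βΩ wk0 Ω
  appL : ∀ {M M'} N → M →βΩ M' → M · N →βΩ M' · N
  appR : ∀ M {N N'} → N →βΩ N' → M · N →βΩ M · N'
  lam  : ∀ {M M'} → M →βΩ M' → ƛ M →βΩ ƛ M'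

data _↠βΩ_ {k : ℕ} : Term k → Term k → Set where
  done : ∀ {M} → M ↠βΩ M
  _∷_  : ∀ {M N P} → M →βΩ N → N ↠βΩ P → M ↠βΩ P

-- βΩ-normal: every βΩ-step leads back to the same term
-- (the only possible step being Ω →β Ω on occurrences of Ω)
βΩ-NF : ∀ {k} → Term k → Set
βΩ-NF M = ∀ M' → M →βΩ M' → M' ≡ M

data Occurs (c : Term 0) : ∀ {k} → Term k → Set where
  here : ∀ {k} → Occurs c (wk0 {k} c)
  inL  : ∀ {k} {M N : Term k} → Occurs c M → Occurs c (M · N)
  inR  : ∀ {k} {M N : Term k} → Occurs c N → Occurs c (M · N)
  inƛ  : ∀ {k} {M : Term (suc k)} → Occurs c M → Occurs c (ƛ M)

NFBeginsWith : ∀ {k} → Term k → Fin k → Set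
NFBeginsWith M x = Σ _ λ N → Σ _ λ Ns →
  (M ↠βΩ N) × βΩ-NF N × (N ≡ apps (var x) Ns)

NFBeginsWithContaining : ∀ {k} → Term k → Fin k → Term 0 → Set
NFBeginsWithContaining M x c = Σ _ λ N → Σ _ λ Ns →
  (M ↠βΩ N) × βΩ-NF N × (N ≡ apps (var x) Ns) × Occurs c N

data HeadClosed {k : ℕ} : Term k → Term k → Set where
  hβ   : ∀ (U : Term 1) (N : Term 0) → HeadClosed (wk0 ((ƛ U) · N)) (wk0 (U [ N ]))
  happ : ∀ {M P M'} V → HeadClosed (M · P) M' → HeadClosed ((M · P) · V) (M' · V)
  hlam : ∀ {M M'} → HeadClosed M M' → HeadClosed (ƛ M) (ƛ M')

data HeadClosed* {k : ℕ} : Term k → Term k → Set where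
  done : ∀ {M} → HeadClosed* M M
  _∷_  : ∀ {M N P} → HeadClosed M N → HeadClosed* N P → HeadClosed* M P

-- Sequences, the tree T and well-foundedness.
-- A coding is an injective map  code : List ℕ → ℕ ; the sequence
-- numbers are the values  code σ.

_≺_ : List ℕ → List ℕ → Set
σ' ≺ σ = Σ ℕ λ a → Σ (List ℕ) λ τ → σ' ++ (a ∷ τ) ≡ σ

_⪯_ : List ℕ → List ℕ → Set
σ ⪯ τ = Σ (List ℕ) λ ρ → σ ++ ρ ≡ τ

-- code σ is n-unsecured, i.e. code σ ∈ T
Unsecured : (List ℕ → ℕ) → (ℕ → ℕ → Bool) → ℕ → List ℕ → Set
Unsecured code R n σ = ∀ σ' → σ' ≺ σ → R (code σ') n ≡ false

InSubtree : (List ℕ → ℕ) → (ℕ → ℕ → Bool) → ℕ → List ℕ → List ℕ → Set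
InSubtree code R n σ τ = Unsecured code R n τ × σ ⪯ τ

WellFoundedSubtree : (List ℕ → ℕ) → (ℕ → ℕ → Bool) → ℕ → List ℕ → Set
WellFoundedSubtree code R n σ =
  ¬ (Σ (ℕ → List ℕ) λ g → ∀ i → InSubtree code R n σ (g i) × (g i ≺ g (suc i)))

IsConcat : (List ℕ → ℕ) → Term 0 → Set
IsConcat code star =
  (∀ σ τ → star · ⌜ code σ ⌝ · ⌜ code τ ⌝ =β ⌜ code (σ ++ τ) ⌝) ×
  (∀ σ → NFBeginsWith {1} (wk0 star · wk0 ⌜ code σ ⌝ · var zero) zero)

IsSucc : Term 0 → Set
IsSucc sc = ∀ m → sc · ⌜ m ⌝ =β ⌜ suc m ⌝

IsD : (List ℕ → ℕ) → (ℕ → ℕ → Bool) → ℕ → Term 0 → Set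
IsD code R n D =
  (∀ m → NFBeginsWithContaining {1} (wk0 D · var zero · wk0 ⌜ m ⌝) zero ⌜ m ⌝) ×
  (∀ σ → Unsecured code R n σ → D · ⌜ code σ ⌝ =ω K*) ×
  (∀ σ → ¬ Unsecured code R n σ → D · ⌜ code σ ⌝ =ω Ω) ×
  (∀ σ → Unsecured code R n σ → HeadClosed* (D · ⌜ code σ ⌝) K*)

Tθ : Term 0
Tθ = ƛ (ƛ (var zero · (var (suc zero) · var (suc zero) · var zero)))

Θ : Term 0
Θ = Tθ · Tθ

-- F_i ≡ λwxy. D x i̲ (λab.b(aab)) (λab.b(aab))
--        (λaxf.[fx, x(λu.uΩ)y(a(x⁺)f)]) 0̲ (λz.w(x*z))
-- (de Bruijn indices written out; in the inner λaxf the x is a new binder)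
F : (star sc D : Term 0) → ℕ → Term 0
F star sc D i = ƛ (ƛ (ƛ body))
  where
  -- context: y = 0, x = 1, w = 2
  G : Term 3
  -- λa.λx'.λf.  λz. z (f x') (x' (λu.uΩ) y (a (succ x') f))
  -- inside λz: z = 0, f = 1, x' = 2, a = 3, y = 4
  G = ƛ (ƛ (ƛ (ƛ
        (var zero
          · (var (suc zero) · var (suc (suc zero)))
          · (var (suc (suc zero))
               · ƛ (var zero · wk0 Ω)
               · var (suc (suc (suc (suc zero))))
               · (var (suc (suc (suc zero)))
                    · (wk0 sc · var (suc (suc zero)))
                    · var (suc zero)))))))
  -- λz.w(x*z) ; inside λz: z = 0, y = 1, x = 2, w = 3
  H : Term 3
  H = ƛ (var (suc (suc (suc zero))) · (wk0 star · var (suc (suc zero)) · var zero))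
  body : Term 3
  body = wk0 D · var (suc zero) · wk0 ⌜ i ⌝ · wk0 Tθ · wk0 Tθ · G · wk0 ⌜ 0 ⌝ · H

B : (star sc D : Term 0) → ℕ → Term 0
B star sc D i = Θ · F star sc D i

{-# OPTIONS --safe #-}
module Submission where

-- If T(s) has an infinite chain then s is unsecured and D s reduces to K*.
-- Since s * ⟨⟩ = s, the term B_e s is then one of its own components, and a
-- fixed block of closed arguments extracts it: B_e s followed by the block
-- head-reduces to (λz. B_e (s * z)) ⟨⟩.  Thus B_0 s and B_1 s have the same Böhm
-- tree, and the label e has to be read off the reduction itself.
--
-- Write ≅ for observational equivalence with respect to solvability.  Call X
-- good if, against the periodic stream of blocks, X head-reduces to a state
-- h m A⃗ with h ≅ λz. B_0 (s * z), m ≅ ⟨⟩ and A⃗ ≅ the rest of the stream.  Goodness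
-- is invariant under =ω.  For the Leibniz rule and the ω-rule this is a context
-- lemma: the runs of C[P] and C[Q] agree until P reaches the head position, and
-- then P has a closed argument.  For β-steps one needs that every state is
-- followed by another one.  This holds because permutators of large arity are
-- generic for ≅: a term h with h z v ≅ D (s * z) 0 ... must head-reduce to an
-- application of z, the last argument of which is ≅ λy. B_0 ((s * z) * y).
--
-- B_0 s is good.  B_1 s is not: the hypotheses on D force D x to head-reduce
-- to an application of x, so λz. B_1 (s * z) and B_1 are not ≅ λz. B_0 (s * z),
-- and all other terms of the run are excluded by comparing their arguments with
-- those of the stream.

open import Defs
open import Data.Nat using (ℕ; zero; suc; _+_; _*_; _∸_; _⊔_; _≤_; _<_; s≤s; z≤n)
open import Data.Nat.Properties using (≤-refl; ≤-trans; ≤-antisym; ≤-reflexive; +-suc; +-comm; +-identityʳ; +-assoc; +-monoˡ-≤; +-cancelʳ-≡; *-suc; m≤m+n; m≤n+m; n≤1+n; 1+n≰n; m≤m⊔n; m≤n⊔m; m+[n∸m]≡n; m∸n+n≡m; suc-injective; <-cmp; ≰⇒>; _≤?_)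
open import Data.Nat.Tactic.RingSolver using (solve-∀)
open import Data.Fin using (Fin; zero; suc)
import Data.Fin.Properties as Fin
open import Data.List using (List; []; _∷_; _++_; map; length; replicate; tabulate; lookup)
open import Data.List.Properties using (length-++; length-replicate; length-map; map-tabulate; tabulate-lookup; map-++; map-∘; map-cong; map-id; ++-assoc; ++-identityʳ; ∷-injectiveˡ; ∷-injectiveʳ; ∷ʳ-injectiveʳ)
open import Data.Product using (∃; _×_; _,_; proj₁; proj₂)
open import Data.Sum using (_⊎_; inj₁; inj₂)
open import Data.Bool using (Bool)
open import Data.Empty using (⊥; ⊥-elim)
open import Data.Unit using (⊤; tt)
open import Data.Maybe using (Maybe; just; nothing)
open import Relation.Nullary using (¬_; Dec; yes; no)
open import Relation.Binary using (tri<; tri≈; tri>)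
open import Relation.Binary.PropositionalEquality as ≡ using (_≡_; refl; cong; cong₂)
open import Function using (_∘_; id)
open import Function.Definitions using (Injective)

-- Substitution calculus

-- The label e is an argument that D s, being K*, throws away. It survives only in λz. B_e (s * z)
-- as a function: for an indeterminate z the term D (s * z) is stuck on z, and e stands among the
-- arguments of z, sixth from the end. So a state keeps the function h apart from its argument m,
-- and h is compared at permutators, where arguments can be read back. Components are known only up
-- to ≅, since =ω may rewrite any subterm. This relation is a congruence, extensional and identifies
-- all unsolvable terms, so it absorbs every such rewriting, yet it still separates the labels. The
-- shape of the block comes from a, the code of ⟨⟩: the term unfolds into nested pairs with
-- components λz. B_e (s * z) applied to 0, 1, 2, ..., each tail being wrapped in V, and component a
-- is reached by a tail selections. V and the padding are tuned so that no term of the run of B_1 s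
-- passes for a state by accident: inside a block, unless an abstraction meets the stream, the run
-- has a last argument of its own that a solvability test tells from the stream element consumed
-- last.

ext-cong : ∀ {k l} {ρ ρ' : Fin k → Fin l} → (∀ i → ρ i ≡ ρ' i) → ∀ i → ext ρ i ≡ ext ρ' i
ext-cong e zero    = refl
ext-cong e (suc i) = cong suc (e i)

rename-cong : ∀ {k l} {ρ ρ' : Fin k → Fin l} → (∀ i → ρ i ≡ ρ' i) → ∀ M → rename ρ M ≡ rename ρ' M
rename-cong e (var i) = cong var (e i)
rename-cong e (ƛ M)   = cong ƛ (rename-cong (ext-cong e) M)
rename-cong e (M · N) = cong₂ _·_ (rename-cong e M) (rename-cong e N)

exts-cong : ∀ {k l} {σ τ : Fin k → Term l} → (∀ i → σ i ≡ τ i) → ∀ i → exts σ i ≡ exts τ i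
exts-cong e zero    = refl
exts-cong e (suc i) = cong (rename suc) (e i)

subst-cong : ∀ {k l} {σ τ : Fin k → Term l} → (∀ i → σ i ≡ τ i) → ∀ M → subst σ M ≡ subst τ M
subst-cong e (var i) = e i
subst-cong e (ƛ M)   = cong ƛ (subst-cong (exts-cong e) M)
subst-cong e (M · N) = cong₂ _·_ (subst-cong e M) (subst-cong e N)

subst-rename : ∀ {k l n} (σ : Fin l → Term n) (ρ : Fin k → Fin l) M →
               subst σ (rename ρ M) ≡ subst (σ ∘ ρ) M
subst-rename σ ρ (var i) = refl
subst-rename σ ρ (ƛ M)   = cong ƛ (≡.trans (subst-rename (exts σ) (ext ρ) M) (subst-cong lift M))
  where
  lift : ∀ i → exts σ (ext ρ i) ≡ exts (σ ∘ ρ) i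
  lift zero    = refl
  lift (suc i) = refl
subst-rename σ ρ (M · N) = cong₂ _·_ (subst-rename σ ρ M) (subst-rename σ ρ N)

rename-rename : ∀ {k l n} (ρ : Fin l → Fin n) (ρ' : Fin k → Fin l) M →
                rename ρ (rename ρ' M) ≡ rename (ρ ∘ ρ') M
rename-rename ρ ρ' (var i) = refl
rename-rename ρ ρ' (ƛ M)   = cong ƛ (≡.trans (rename-rename (ext ρ) (ext ρ') M) (rename-cong lift M))
  where
  lift : ∀ i → ext ρ (ext ρ' i) ≡ ext (ρ ∘ ρ') i
  lift zero    = refl
  lift (suc i) = refl
rename-rename ρ ρ' (M · N) = cong₂ _·_ (rename-rename ρ ρ' M) (rename-rename ρ ρ' N)

rename-subst : ∀ {k l n} (ρ : Fin l → Fin n) (σ : Fin k → Term l) M →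
               rename ρ (subst σ M) ≡ subst (rename ρ ∘ σ) M
rename-subst ρ σ (var i) = refl
rename-subst ρ σ (ƛ M)   = cong ƛ (≡.trans (rename-subst (ext ρ) (exts σ) M) (subst-cong lift M))
  where
  lift : ∀ i → rename (ext ρ) (exts σ i) ≡ exts (rename ρ ∘ σ) i
  lift zero    = refl
  lift (suc i) = ≡.trans (rename-rename (ext ρ) suc (σ i)) (≡.sym (rename-rename suc ρ (σ i)))
rename-subst ρ σ (M · N) = cong₂ _·_ (rename-subst ρ σ M) (rename-subst ρ σ N)

subst-subst : ∀ {k l n} (τ : Fin l → Term n) (σ : Fin k → Term l) M →
              subst τ (subst σ M) ≡ subst (subst τ ∘ σ) M
subst-subst τ σ (var i) = refl
subst-subst τ σ (ƛ M)   = cong ƛ (≡.trans (subst-subst (exts τ) (exts σ) M) (subst-cong lift M))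
  where
  lift : ∀ i → subst (exts τ) (exts σ i) ≡ exts (subst τ ∘ σ) i
  lift zero    = refl
  lift (suc i) = ≡.trans (subst-rename (exts τ) suc (σ i)) (≡.sym (rename-subst suc τ (σ i)))
subst-subst τ σ (M · N) = cong₂ _·_ (subst-subst τ σ M) (subst-subst τ σ N)

subst-var : ∀ {k} (σ : Fin k → Term k) → (∀ i → σ i ≡ var i) → ∀ M → subst σ M ≡ M
subst-var σ e (var i) = e i
subst-var σ e (ƛ M)   = cong ƛ (subst-var (exts σ) lift M)
  where
  lift : ∀ i → exts σ i ≡ var i
  lift zero    = refl
  lift (suc i) = cong (rename suc) (e i)
subst-var σ e (M · N) = cong₂ _·_ (subst-var σ e M) (subst-var σ e N)

rename-var : ∀ {k l} (ρ : Fin k → Fin l) M → rename ρ M ≡ subst (var ∘ ρ) M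
rename-var ρ (var i) = refl
rename-var ρ (ƛ M)   = cong ƛ (≡.trans (rename-var (ext ρ) M) (subst-cong lift M))
  where
  lift : ∀ i → var (ext ρ i) ≡ exts (var ∘ ρ) i
  lift zero    = refl
  lift (suc i) = refl
rename-var ρ (M · N) = cong₂ _·_ (rename-var ρ M) (rename-var ρ N)

subst-wk0 : ∀ {k l} (σ : Fin k → Term l) M → subst σ (wk0 M) ≡ wk0 M
subst-wk0 σ M = ≡.trans (subst-rename σ noVar M)
  (≡.trans (subst-cong (λ ()) M) (≡.sym (rename-var noVar M)))

rename-wk0 : ∀ {k l} (ρ : Fin k → Fin l) M → rename ρ (wk0 M) ≡ wk0 M
rename-wk0 ρ M = ≡.trans (rename-rename ρ noVar M) (rename-cong (λ ()) M)

wk0-closed : ∀ M → wk0 {0} M ≡ M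
wk0-closed M = ≡.trans (rename-var noVar M) (subst-var _ (λ ()) M)

subst-wk0-closed : ∀ {k} (σ : Fin k → Term 0) M → subst σ (wk0 M) ≡ M
subst-wk0-closed σ M = ≡.trans (subst-wk0 σ M) (wk0-closed M)

infixr 6 _•_
_•_ : ∀ {k l} → Term l → (Fin k → Term l) → Fin (suc k) → Term l
(N • σ) zero    = N
(N • σ) (suc i) = σ i

[]-rename-suc : ∀ {k} (M : Term k) N → rename suc M [ N ] ≡ M
[]-rename-suc M N = ≡.trans (subst-rename (single N) suc M) (subst-var _ (λ i → refl) M)

exts-[] : ∀ {k l} (σ : Fin k → Term l) U N → subst (exts σ) U [ N ] ≡ subst (N • σ) U
exts-[] σ U N = ≡.trans (subst-subst (single N) (exts σ) U) (subst-cong lift U)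
  where
  lift : ∀ i → subst (single N) (exts σ i) ≡ (N • σ) i
  lift zero    = refl
  lift (suc i) = []-rename-suc (σ i) N

subst-[] : ∀ {k l} (σ : Fin k → Term l) U N → subst σ (U [ N ]) ≡ subst (exts σ) U [ subst σ N ]
subst-[] σ U N = ≡.trans (subst-subst σ (single N) U)
  (≡.trans (subst-cong lift U) (≡.sym (exts-[] σ U (subst σ N))))
  where
  lift : ∀ i → subst σ (single N i) ≡ (subst σ N • σ) i
  lift zero    = refl
  lift (suc i) = refl

rename-[] : ∀ {k l} (ρ : Fin k → Fin l) U N → rename ρ (U [ N ]) ≡ rename (ext ρ) U [ rename ρ N ]
rename-[] ρ U N = ≡.trans (rename-subst ρ (single N) U)
  (≡.trans (subst-cong lift U) (≡.sym (subst-rename (single (rename ρ N)) (ext ρ) U)))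
  where
  lift : ∀ i → rename ρ (single N i) ≡ single (rename ρ N) (ext ρ i)
  lift zero    = refl
  lift (suc i) = refl

subst-apps : ∀ {k l} (σ : Fin k → Term l) M Ns → subst σ (apps M Ns) ≡ apps (subst σ M) (map (subst σ) Ns)
subst-apps σ M []       = refl
subst-apps σ M (N ∷ Ns) = subst-apps σ (M · N) Ns

apps-++ : ∀ {k} (M : Term k) Ns Ps → apps M (Ns ++ Ps) ≡ apps (apps M Ns) Ps
apps-++ M []       Ps = refl
apps-++ M (N ∷ Ns) Ps = apps-++ (M · N) Ns Ps

-- Weak head reduction

infix 4 _→h_ _⟶[_]_ _↠h_

data _→h_ {k} : Term k → Term k → Set where
  hβ   : ∀ U N → ƛ U · N →h U [ N ]
  happ : ∀ {M M'} N → M →h M' → M · N →h M' · N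

data _⟶[_]_ {k} : Term k → ℕ → Term k → Set where
  []  : ∀ {M} → M ⟶[ 0 ] M
  _∷_ : ∀ {M N P t} → M →h N → N ⟶[ t ] P → M ⟶[ suc t ] P

_↠h_ : ∀ {k} → Term k → Term k → Set
M ↠h N = ∃ λ t → M ⟶[ t ] N

ε : ∀ {k} {M : Term k} → M ↠h M
ε = 0 , []

infixr 5 _◅_ _◅◅_
_◅_ : ∀ {k} {M N P : Term k} → M →h N → N ↠h P → M ↠h P
s ◅ (t , r) = suc t , s ∷ r

_◅◅_ : ∀ {k} {M N P : Term k} → M ↠h N → N ↠h P → M ↠h P
(zero  , [])     ◅◅ r = r
(suc t , s ∷ r') ◅◅ r = s ◅ ((t , r') ◅◅ r)

→h-det : ∀ {k} {M N P : Term k} → M →h N → M →h P → N ≡ P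
→h-det (hβ U N)         (hβ .U .N)        = refl
→h-det (happ N (hβ _ _)) (happ .N (hβ _ _)) = refl
→h-det (happ N s@(happ _ _)) (happ .N s'@(happ _ _)) = cong (_· N) (→h-det s s')

→h-apps : ∀ {k} {M N : Term k} Ps → M →h N → apps M Ps →h apps N Ps
→h-apps []       s = s
→h-apps (P ∷ Ps) s = →h-apps Ps (happ P s)

⟶-apps : ∀ {k t} {M N : Term k} Ps → M ⟶[ t ] N → apps M Ps ⟶[ t ] apps N Ps
⟶-apps Ps []      = []
⟶-apps Ps (s ∷ r) = →h-apps Ps s ∷ ⟶-apps Ps r

↠h-apps : ∀ {k} {M N : Term k} Ps → M ↠h N → apps M Ps ↠h apps N Ps
↠h-apps Ps (t , r) = t , ⟶-apps Ps r

→h-subst : ∀ {k l} (σ : Fin k → Term l) {M N} → M →h N → subst σ M →h subst σ N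
→h-subst σ (hβ U N)   = ≡.subst (ƛ (subst (exts σ) U) · subst σ N →h_) (≡.sym (subst-[] σ U N)) (hβ _ _)
→h-subst σ (happ N s) = happ _ (→h-subst σ s)

⟶-subst : ∀ {k l t} (σ : Fin k → Term l) {M N} → M ⟶[ t ] N → subst σ M ⟶[ t ] subst σ N
⟶-subst σ []      = []
⟶-subst σ (s ∷ r) = →h-subst σ s ∷ ⟶-subst σ r

↠h-subst : ∀ {k l} (σ : Fin k → Term l) {M N} → M ↠h N → subst σ M ↠h subst σ N
↠h-subst σ (t , r) = t , ⟶-subst σ r

data HeadView {k} : Term k → Set where
  is-var  : ∀ i Ns → HeadView (apps (var i) Ns)
  is-lam  : ∀ U → HeadView (ƛ U)
  is-step : ∀ {M N} → M →h N → HeadView M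

headView : ∀ {k} (M : Term k) → HeadView M
headView (var i) = is-var i []
headView (ƛ U)   = is-lam U
headView (M · N) with headView M
... | is-var i Ns  = ≡.subst HeadView (apps-++ (var i) Ns (N ∷ [])) (is-var i (Ns ++ N ∷ []))
... | is-lam U     = is-step (hβ U N)
... | is-step s    = is-step (happ N s)

headVar : ∀ {k} → Term k → Maybe (Fin k)
headVar (var i) = just i
headVar (ƛ U)   = nothing
headVar (M · N) = headVar M

headVar-apps : ∀ {k} (M : Term k) Ns → headVar (apps M Ns) ≡ headVar M
headVar-apps M []       = refl
headVar-apps M (N ∷ Ns) = headVar-apps (M · N) Ns

headVar-wk0 : ∀ {k} M → headVar (wk0 {k} M) ≡ nothing
headVar-wk0 (ƛ M)   = refl
headVar-wk0 (M · N) = headVar-wk0 M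

-- Parallel replacement of closed subterms

data Par (R : Term 0 → Term 0 → Set) {k} : Term k → Term k → Set where
  root : ∀ {P Q} → R P Q → Par R (wk0 P) (wk0 Q)
  var  : ∀ i → Par R (var i) (var i)
  ƛ    : ∀ {U U'} → Par R U U' → Par R (ƛ U) (ƛ U')
  _·_  : ∀ {M M' N N'} → Par R M M' → Par R N N' → Par R (M · N) (M' · N')

module _ {R : Term 0 → Term 0 → Set} where

  Par-refl : ∀ {k} (M : Term k) → Par R M M
  Par-refl (var i) = var i
  Par-refl (ƛ M)   = ƛ (Par-refl M)
  Par-refl (M · N) = Par-refl M · Par-refl N

  Par-closed : ∀ {P Q} → R P Q → Par R P Q
  Par-closed {P} {Q} r = ≡.subst₂ (Par R) (wk0-closed P) (wk0-closed Q) (root r)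

  Par-rename : ∀ {k l} (ρ : Fin k → Fin l) {M N} → Par R M N → Par R (rename ρ M) (rename ρ N)
  Par-rename ρ (root {P} {Q} r) = ≡.subst₂ (Par R) (≡.sym (rename-wk0 ρ P)) (≡.sym (rename-wk0 ρ Q)) (root r)
  Par-rename ρ (var i) = var (ρ i)
  Par-rename ρ (ƛ p)   = ƛ (Par-rename (ext ρ) p)
  Par-rename ρ (p · q) = Par-rename ρ p · Par-rename ρ q

  Par-subst : ∀ {k l} {σ τ : Fin k → Term l} → (∀ i → Par R (σ i) (τ i)) →
              ∀ {M N} → Par R M N → Par R (subst σ M) (subst τ N)
  Par-subst {σ = σ} {τ} e (root {P} {Q} r) = ≡.subst₂ (Par R) (≡.sym (subst-wk0 σ P)) (≡.sym (subst-wk0 τ Q)) (root r)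
  Par-subst e (var i) = e i
  Par-subst e (ƛ p)   = ƛ (Par-subst lift p)
    where
    lift : ∀ i → Par R (exts _ i) (exts _ i)
    lift zero    = var zero
    lift (suc i) = Par-rename suc (e i)
  Par-subst e (p · q) = Par-subst e p · Par-subst e q

  Par-[] : ∀ {k} {U U' : Term (suc k)} {N N'} → Par R U U' → Par R N N' → Par R (U [ N ]) (U' [ N' ])
  Par-[] p q = Par-subst (λ { zero → q ; (suc i) → var i }) p

data Pars (R : Term 0 → Term 0 → Set) {k} : List (Term k) → List (Term k) → Set where
  []  : Pars R [] []
  _∷_ : ∀ {M N Ms Ns} → Par R M N → Pars R Ms Ns → Pars R (M ∷ Ms) (N ∷ Ns)

Pars-refl : ∀ {R k} (Ms : List (Term k)) → Pars R Ms Ms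
Pars-refl []       = []
Pars-refl (M ∷ Ms) = Par-refl M ∷ Pars-refl Ms

Par-apps : ∀ {R k} {M N : Term k} {Ms Ns} → Par R M N → Pars R Ms Ns → Par R (apps M Ms) (apps N Ns)
Par-apps p []       = p
Par-apps p (q ∷ qs) = Par-apps (p · q) qs

-- Par without replacement at any prefix of the spine.
data SPar (R : Term 0 → Term 0 → Set) : Term 0 → Term 0 → Set where
  ƛ   : ∀ {U U'} → Par R U U' → SPar R (ƛ U) (ƛ U')
  _·_ : ∀ {M M' N N'} → SPar R M M' → Par R N N' → SPar R (M · N) (M' · N')

SPar⇒Par : ∀ {R M N} → SPar R M N → Par R M N
SPar⇒Par (ƛ p)   = ƛ p
SPar⇒Par (p · q) = SPar⇒Par p · q

SPar-refl : ∀ {R} M → SPar R M M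
SPar-refl (ƛ M)   = ƛ (Par-refl M)
SPar-refl (M · N) = SPar-refl M · Par-refl N

SPar-step : ∀ {R M M' N} → SPar R M M' → M →h N → ∃ λ N' → M' →h N' × Par R N N'
SPar-step (ƛ p · q) (hβ U N)   = _ , hβ _ _ , Par-[] p q
SPar-step (p · q)   (happ N s) with SPar-step p s
... | _ , s' , p' = _ , happ _ s' , p' · q

-- Induction on the run of Z. Replacements at a prefix of the spine are first undone, which `resp`
-- makes harmless; the remaining ones sit in arguments or under abstractions, so both sides make the
-- same head step and stay related.
module ContextLemma
  (R : Term 0 → Term 0 → Set) (Obs St : Term 0 → Set)
  (expand : ∀ {M N} → M →h N → Obs N → Obs M)
  (resp   : ∀ {P Q} → R P Q → ∀ Ns → Obs (apps P Ns) → Obs (apps Q Ns))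
  (stop   : ∀ {Z Z'} → St Z → SPar R Z Z' → Obs Z') where

  -- The replacements along the spine can be undone one at a time by resp.
  unroot : ∀ {M M'} → Par R M M' → ∀ Ns → ∃ λ M'' → SPar R M M'' × (Obs (apps M'' Ns) → Obs (apps M' Ns))
  unroot (root {P} {Q} r) Ns rewrite wk0-closed P | wk0-closed Q = P , SPar-refl P , resp r Ns
  unroot (ƛ p)   Ns = _ , ƛ p , λ o → o
  unroot (_·_ {N' = N'} p q) Ns with unroot p (N' ∷ Ns)
  ... | M'' , s , f = M'' · N' , s · q , f

  simulate : ∀ {Z Z' Zt t} → Z ⟶[ t ] Zt → St Zt → Par R Z Z' → Obs Z'
  simulate []      st p with unroot p []
  ... | _ , s , f = f (stop st s)
  simulate (h ∷ r) st p with unroot p []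
  ... | _ , s , f with SPar-step s h
  ... | _ , h' , p' = f (expand h' (simulate r st p'))

-- Observational equivalence of closed terms

module Observation
  (Obs St : Term 0 → Set)
  (expand : ∀ {M N} → M →h N → Obs N → Obs M)
  (reduce : ∀ {M N} → M →h N → Obs M → Obs N)
  (run    : ∀ {M} → Obs M → ∃ λ Ns → ∃ λ t → ∃ λ Z → apps M Ns ⟶[ t ] Z × St Z × (∀ N → Obs (apps N Ns) → Obs N))
  (stop   : ∀ {R Z Z'} → St Z → SPar R Z Z' → Obs Z')
  (ƛ-obs  : ∀ U U' → (∀ V → Obs (ƛ U · V) → Obs (ƛ U' · V)) → Obs (ƛ U) → Obs (ƛ U')) where

  infix 4 _≈_
  _≈_ : Term 0 → Term 0 → Set
  M ≈ N = ∀ Ns → (Obs (apps M Ns) → Obs (apps N Ns)) × (Obs (apps N Ns) → Obs (apps M Ns))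

  ≈-refl : ∀ {M} → M ≈ M
  ≈-refl Ns = id , id

  ≈-reflexive : ∀ {M N} → M ≡ N → M ≈ N
  ≈-reflexive refl = ≈-refl

  ≈-sym : ∀ {M N} → M ≈ N → N ≈ M
  ≈-sym e Ns = proj₂ (e Ns) , proj₁ (e Ns)

  ≈-trans : ∀ {M N P} → M ≈ N → N ≈ P → M ≈ P
  ≈-trans e f Ns = proj₁ (f Ns) ∘ proj₁ (e Ns) , proj₂ (e Ns) ∘ proj₂ (f Ns)

  →h⇒≈ : ∀ {M N} → M →h N → M ≈ N
  →h⇒≈ s Ns = reduce (→h-apps Ns s) , expand (→h-apps Ns s)

  ⟶⇒≈ : ∀ {M N t} → M ⟶[ t ] N → M ≈ N
  ⟶⇒≈ []      = ≈-refl
  ⟶⇒≈ (s ∷ r) = ≈-trans (→h⇒≈ s) (⟶⇒≈ r)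

  ↠h⇒≈ : ∀ {M N} → M ↠h N → M ≈ N
  ↠h⇒≈ (t , r) = ⟶⇒≈ r

  Par-obs : ∀ {M N} → Par _≈_ M N → Obs M → Obs N
  Par-obs {M} {N} p o with run o
  ... | Ns , t , Z , r , st , back =
    back N (ContextLemma.simulate _≈_ Obs St expand (λ e Ps → proj₁ (e Ps)) stop r st (Par-apps p (Pars-refl Ns)))

  Par-sym : ∀ {k} {M N : Term k} → Par _≈_ M N → Par _≈_ N M
  Par-sym (root e) = root (≈-sym e)
  Par-sym (var i)  = var i
  Par-sym (ƛ p)    = ƛ (Par-sym p)
  Par-sym (p · q)  = Par-sym p · Par-sym q

  Par⇒≈ : ∀ {M N} → Par _≈_ M N → M ≈ N
  Par⇒≈ p Ns = Par-obs (Par-apps p (Pars-refl Ns)) , Par-obs (Par-apps (Par-sym p) (Pars-refl Ns))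

  ·-cong : ∀ {M M' N N'} → M ≈ M' → N ≈ N' → M · N ≈ M' · N'
  ·-cong e f = Par⇒≈ (Par-closed e · Par-closed f)

  ƛ-ext : ∀ {U U'} → (∀ V → ƛ U · V ≈ ƛ U' · V) → ƛ U ≈ ƛ U'
  ƛ-ext {U} {U'} e []       = ƛ-obs U U' (λ V → proj₁ (e V [])) , ƛ-obs U' U (λ V → proj₂ (e V []))
  ƛ-ext         e (N ∷ Ns) = e N Ns

  ƛ-ext-subst : ∀ {k} (σ : Fin k → Term 0) {U U'} → (∀ V → subst (V • σ) U ≈ subst (V • σ) U') →
                subst σ (ƛ U) ≈ subst σ (ƛ U')
  ƛ-ext-subst σ {U} {U'} e = ƛ-ext λ V → ≈-trans (→h⇒≈ (hβ _ V)) (≈-trans (≈-reflexive (exts-[] σ U V))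
    (≈-trans (e V) (≈-trans (≈-reflexive (≡.sym (exts-[] σ U' V))) (≈-sym (→h⇒≈ (hβ _ V))))))

  →β⇒≈ : ∀ {k} (σ : Fin k → Term 0) {M N} → M →β N → subst σ M ≈ subst σ N
  →β⇒≈ σ (β U N)    = →h⇒≈ (→h-subst σ (hβ U N))
  →β⇒≈ σ (appL N s) = ·-cong (→β⇒≈ σ s) ≈-refl
  →β⇒≈ σ (appR M s) = ·-cong ≈-refl (→β⇒≈ σ s)
  →β⇒≈ σ (lam {M} {M'} s) = ƛ-ext-subst σ {M} {M'} (λ V → →β⇒≈ (V • σ) s)

  =β⇒≈-subst : ∀ {k} (σ : Fin k → Term 0) {M N} → M =β N → subst σ M ≈ subst σ N
  =β⇒≈-subst σ (step s)    = →β⇒≈ σ s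
  =β⇒≈-subst σ refl        = ≈-refl
  =β⇒≈-subst σ (sym e)     = ≈-sym (=β⇒≈-subst σ e)
  =β⇒≈-subst σ (trans e f) = ≈-trans (=β⇒≈-subst σ e) (=β⇒≈-subst σ f)

  =β⇒≈ : ∀ {M N} → M =β N → M ≈ N
  =β⇒≈ {M} {N} e = ≡.subst₂ _≈_ (subst-var var (λ ()) M) (subst-var var (λ ()) N) (=β⇒≈-subst var e)

  data _≈*_ : List (Term 0) → List (Term 0) → Set where
    []  : [] ≈* []
    _∷_ : ∀ {M N Ms Ns} → M ≈ N → Ms ≈* Ns → (M ∷ Ms) ≈* (N ∷ Ns)

  infix 4 _≈*_

  ≈*-refl : ∀ Ms → Ms ≈* Ms
  ≈*-refl []       = []
  ≈*-refl (M ∷ Ms) = ≈-refl ∷ ≈*-refl Ms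

  ≈*-sym : ∀ {Ms Ns} → Ms ≈* Ns → Ns ≈* Ms
  ≈*-sym []       = []
  ≈*-sym (e ∷ es) = ≈-sym e ∷ ≈*-sym es

  ≈*-trans : ∀ {Ms Ns Ps} → Ms ≈* Ns → Ns ≈* Ps → Ms ≈* Ps
  ≈*-trans []       []       = []
  ≈*-trans (e ∷ es) (f ∷ fs) = ≈-trans e f ∷ ≈*-trans es fs

  ≈*-++ : ∀ {Ms Ns Ps Qs} → Ms ≈* Ns → Ps ≈* Qs → (Ms ++ Ps) ≈* (Ns ++ Qs)
  ≈*-++ []       fs = fs
  ≈*-++ (e ∷ es) fs = e ∷ ≈*-++ es fs

  apps-cong : ∀ {M N Ms Ns} → M ≈ N → Ms ≈* Ns → apps M Ms ≈ apps N Ns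
  apps-cong e []       = e
  apps-cong e (f ∷ fs) = apps-cong (·-cong e f) fs

-- Solvability, by weak head reduction

I-stuck : ∀ {N : Term 0} → ¬ (I →h N)
I-stuck ()

ƛ-stuck : ∀ {k} {U : Term (suc k)} {N} → ¬ (ƛ U →h N)
ƛ-stuck ()

Solv : Term 0 → Set
Solv M = ∃ λ Ns → ∃ λ t → apps M Ns ⟶[ t ] I

Conv : Term 0 → Set
Conv M = ∃ λ t → ∃ λ U → M ⟶[ t ] ƛ U

Solv-apps : ∀ M Ns → Solv (apps M Ns) → Solv M
Solv-apps M Ns (Ps , t , r) = Ns ++ Ps , t , ≡.subst (_⟶[ t ] I) (≡.sym (apps-++ M Ns Ps)) r

Solv-I : Solv I
Solv-I = [] , 0 , []

Solv-↠I : ∀ {M} → M ↠h I → Solv M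
Solv-↠I (t , r) = [] , t , r

step-drop : ∀ {k} {M N P : Term k} {t} → M →h N → M ⟶[ suc t ] P → N ⟶[ t ] P
step-drop s (s' ∷ r) with refl ← →h-det s s' = r

⟶-I-step : ∀ {M N : Term 0} {t} → M →h N → M ⟶[ t ] I → ∃ λ t' → N ⟶[ t' ] I
⟶-I-step s []          = ⊥-elim (I-stuck s)
⟶-I-step s r@(_ ∷ _) = _ , step-drop s r

private
  Solv-expand : ∀ {M N} → M →h N → Solv N → Solv M
  Solv-expand s (Ns , t , r) = Ns , suc t , →h-apps Ns s ∷ r

  Solv-reduce : ∀ {M N} → M →h N → Solv M → Solv N
  Solv-reduce s (Ns , t , r) = Ns , ⟶-I-step (→h-apps Ns s) r

  Par-var0 : ∀ {R U'} → Par R {1} (var zero) U' → U' ≡ var zero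
  Par-var0 p = go refl p
    where
    go : ∀ {R} {M U' : Term 1} → M ≡ var zero → Par R M U' → U' ≡ var zero
    go e (root {P} {Q} r) with P
    go () (root r) | ƛ _
    go () (root r) | _ · _
    go e (var zero) = refl

  I-stop : ∀ {R Z Z'} → Z ≡ I → SPar R Z Z' → Solv Z'
  I-stop refl (ƛ p) rewrite Par-var0 p = Solv-I

Solv-ƛ : ∀ U → Solv (ƛ U) → ∃ λ V → Solv (ƛ U · V)
Solv-ƛ U (V ∷ Ns , t , r) = V , Ns , t , r
Solv-ƛ U ([] , .0 , [])   = I , [] , 1 , hβ _ _ ∷ []

private
  Solv-unfold : ∀ {M} → Solv M → ∃ λ Ns → ∃ λ t → ∃ λ Z → apps M Ns ⟶[ t ] Z × Z ≡ I × (∀ N → Solv (apps N Ns) → Solv N)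
  Solv-unfold (Ns , t , r) = Ns , t , I , r , refl , λ N → Solv-apps N Ns

  Solv-ƛ-mono : ∀ U U' → (∀ V → Solv (ƛ U · V) → Solv (ƛ U' · V)) → Solv (ƛ U) → Solv (ƛ U')
  Solv-ƛ-mono U U' f o = let V , o' = Solv-ƛ U o in Solv-apps (ƛ U') (V ∷ []) (f V o')

module Solvable = Observation Solv (_≡ I) Solv-expand Solv-reduce Solv-unfold I-stop Solv-ƛ-mono

open Solvable public using ([]; _∷_; ·-cong; ƛ-ext-subst; apps-cong) renaming (_≈_ to _≅_; _≈*_ to _≅*_; ≈-refl to ≅-refl; ≈-reflexive to ≅-reflexive;
  ≈-sym to ≅-sym; ≈-trans to ≅-trans; →h⇒≈ to →h⇒≅; ↠h⇒≈ to ↠h⇒≅; Par⇒≈ to Par⇒≅; =β⇒≈ to =β⇒≅;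
  ≈*-refl to ≅*-refl; ≈*-sym to ≅*-sym; ≈*-trans to ≅*-trans; ≈*-++ to ≅*-++)

private
  Conv-expand : ∀ {M N} → M →h N → Conv N → Conv M
  Conv-expand s (t , U , r) = suc t , U , s ∷ r

  Conv-reduce : ∀ {M N} → M →h N → Conv M → Conv N
  Conv-reduce s (_ , U , [])      = ⊥-elim (ƛ-stuck s)
  Conv-reduce s (_ , U , r@(_ ∷ _)) = _ , U , step-drop s r

  ƛ-stop : ∀ {R Z Z'} → (∃ λ U → Z ≡ ƛ U) → SPar R Z Z' → Conv Z'
  ƛ-stop (_ , refl) (ƛ p) = 0 , _ , []

-- A second observation, needed because `≅` is extensional and so blind to η: it cannot count the
-- arguments of a head variable. Convergence can: `konst l Ω` applied to a list converges exactly
-- when the list is shorter than l.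
module Convergent = Observation Conv (λ Z → ∃ λ U → Z ≡ ƛ U) Conv-expand Conv-reduce
  (λ {M} (t , U , r) → [] , t , ƛ U , r , (U , refl) , λ N o → o)
  ƛ-stop
  (λ U U' f o → 0 , U' , [])

Solv-≅ : ∀ {M N} → M ≅ N → Solv M → Solv N
Solv-≅ e = proj₁ (e [])

-- The ω-rule for `≅`. Only the empty list of arguments needs thought: if P itself runs to I, so
-- does P · I.
≅-ext : ∀ {P Q} → (∀ V → P · V ≅ Q · V) → P ≅ Q
≅-ext {P} {Q} e (N ∷ Ns) = e N Ns
≅-ext {P} {Q} e []       = half (λ V → proj₁ (e V [])) , half (λ V → proj₂ (e V []))
  where
  half : ∀ {P Q} → (∀ V → Solv (P · V) → Solv (Q · V)) → Solv P → Solv Q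
  half {P} {Q} f (V ∷ Ns , t , r) = Solv-apps Q (V ∷ []) (f V (Ns , t , r))
  half {P} {Q} f ([] , t , r)     = Solv-apps Q (I ∷ []) (f I (Solv-↠I ((↠h-apps (I ∷ []) (t , r)) ◅◅ (hβ _ _ ◅ ε))))

¬Solv⇒≅ : ∀ {M N} → ¬ Solv M → ¬ Solv N → M ≅ N
¬Solv⇒≅ {M} {N} m n Ns = (λ o → ⊥-elim (m (Solv-apps M Ns o))) , (λ o → ⊥-elim (n (Solv-apps N Ns o)))

→h⇒=β : ∀ {k} {M N : Term k} → M →h N → M =β N
→h⇒=β s = step (go s)
  where
  go : ∀ {M N} → M →h N → M →β N
  go (hβ U N)   = β U N
  go (happ N s) = appL N (go s)

⟶⇒=β : ∀ {k t} {M N : Term k} → M ⟶[ t ] N → M =β N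
⟶⇒=β []      = refl
⟶⇒=β (s ∷ r) = trans (→h⇒=β s) (⟶⇒=β r)

Unsolvable⇒¬Solv : ∀ {M} → Unsolvable M → ¬ Solv M
Unsolvable⇒¬Solv u (Ns , t , r) = u (Ns , ⟶⇒=β r)

¬Solv⇒Unsolvable : ∀ {M} → ¬ Solv M → Unsolvable M
¬Solv⇒Unsolvable {M} u (Ns , e) = u (Solv-apps M Ns (proj₂ (=β⇒≅ e []) Solv-I))

Ω-step : Ω →h Ω
Ω-step = hβ _ _

apps-·-≢ƛ : ∀ {k} {M N : Term k} {U} Ns → ¬ (apps (M · N) Ns ≡ ƛ U)
apps-·-≢ƛ []       ()
apps-·-≢ƛ (P ∷ Ns) e = apps-·-≢ƛ Ns e

Ω-diverges : ∀ {t U} Ns → ¬ (apps Ω Ns ⟶[ t ] ƛ U)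
Ω-diverges {zero} {U} Ns r = apps-·-≢ƛ Ns (stuck r)
  where
  stuck : ∀ {M N : Term 0} → M ⟶[ 0 ] N → M ≡ N
  stuck [] = refl
Ω-diverges {suc t} Ns r = Ω-diverges {t} Ns (step-drop (→h-apps Ns Ω-step) r)

¬Solv-Ω : ¬ Solv Ω
¬Solv-Ω (Ns , t , r) = Ω-diverges Ns r

¬Conv-Ω : ∀ Ns → ¬ Conv (apps Ω Ns)
¬Conv-Ω Ns (t , U , r) = Ω-diverges Ns r

¬Solv-apps : ∀ {M} → ¬ Solv M → ∀ Ns → ¬ Solv (apps M Ns)
¬Solv-apps {M} u Ns o = u (Solv-apps M Ns o)

-- Quantifying over closed instances makes stability under renaming and substitution immediate, as
-- the parallel reduction below requires; it agrees with the closure by `lams`.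
Unsolvable* : ∀ {k} → Term k → Set
Unsolvable* M = ∀ σ → ¬ Solv (subst σ M)

Solv-lams : ∀ k (M : Term k) σ → Solv (subst σ M) → Solv (lams k M)
Solv-lams zero    M σ o = ≡.subst Solv (subst-var σ (λ ()) M) o
Solv-lams (suc k) M σ o = Solv-lams k (ƛ M) (σ ∘ suc) (Solv-apps _ (σ zero ∷ [])
  (Solv-≅ (≅-sym (→h⇒≅ (hβ _ _))) (≡.subst Solv (≡.sym (≡.trans (exts-[] (σ ∘ suc) M (σ zero)) (subst-cong (λ { zero → refl ; (suc i) → refl }) M))) o)))

lams-Solv : ∀ k (M : Term k) → Solv (lams k M) → ∃ λ σ → Solv (subst σ M)
lams-Solv zero    M o = (λ ()) , ≡.subst Solv (≡.sym (subst-var _ (λ ()) M)) o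
lams-Solv (suc k) M o with lams-Solv k (ƛ M) o
... | σ , o' with Solv-ƛ _ o'
... | V , o'' = V • σ , ≡.subst Solv (exts-[] σ M V) (Solv-≅ (→h⇒≅ (hβ _ V)) o'')

UnsolvableO⇒* : ∀ {k} {M : Term k} → UnsolvableO M → Unsolvable* M
UnsolvableO⇒* {k} {M} u σ o = Unsolvable⇒¬Solv u (Solv-lams k M σ o)

*⇒UnsolvableO : ∀ {k} {M : Term k} → Unsolvable* M → UnsolvableO M
*⇒UnsolvableO {k} {M} u = ¬Solv⇒Unsolvable λ o → let σ , o' = lams-Solv k M o in u σ o'

Unsolvable*-Ω : ∀ {k} → Unsolvable* (wk0 {k} Ω)
Unsolvable*-Ω σ o = ¬Solv-Ω (≡.subst Solv (subst-wk0-closed σ Ω) o)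

→βΩ⇒≅ : ∀ {k} (σ : Fin k → Term 0) {M N} → M →βΩ N → subst σ M ≅ subst σ N
→βΩ⇒≅ σ (β U N)    = →h⇒≅ (→h-subst σ (hβ U N))
→βΩ⇒≅ σ (Ωr M u _) = ¬Solv⇒≅ (UnsolvableO⇒* u σ) (Unsolvable*-Ω σ)
→βΩ⇒≅ σ (appL N s) = ·-cong (→βΩ⇒≅ σ s) ≅-refl
→βΩ⇒≅ σ (appR M s) = ·-cong ≅-refl (→βΩ⇒≅ σ s)
→βΩ⇒≅ σ (lam {M} {M'} s) = ƛ-ext-subst σ {M} {M'} (λ V → →βΩ⇒≅ (V • σ) s)

↠βΩ⇒≅ : ∀ {k} (σ : Fin k → Term 0) {M N} → M ↠βΩ N → subst σ M ≅ subst σ N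
↠βΩ⇒≅ σ done    = ≅-refl
↠βΩ⇒≅ σ (s ∷ r) = ≅-trans (→βΩ⇒≅ σ s) (↠βΩ⇒≅ σ r)

-- Permutators

konst : ∀ {k} → ℕ → Term k → Term k
konst zero    M = M
konst (suc n) M = ƛ (konst n (rename suc M))

subst-konst : ∀ {k l} (σ : Fin k → Term l) n M → subst σ (konst n M) ≡ konst n (subst σ M)
subst-konst σ zero    M = refl
subst-konst σ (suc n) M = cong ƛ (≡.trans (subst-konst (exts σ) n (rename suc M))
  (cong (konst n) (≡.trans (subst-rename (exts σ) suc M) (≡.sym (rename-subst suc σ M)))))

konst-run : ∀ {k} n (M : Term k) Ns → apps (konst (length Ns + n) M) Ns ↠h konst n M
konst-run n M []       = ε
konst-run n M (N ∷ Ns) = →h-apps Ns (hβ _ N) ◅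
  ≡.subst (λ K → apps K Ns ↠h konst n M)
    (≡.sym (≡.trans (subst-konst (single N) (length Ns + n) (rename suc M)) (cong (konst (length Ns + n)) ([]-rename-suc M N))))
    (konst-run n M Ns)

konst-full : ∀ {k} (M : Term k) n Ns → length Ns ≡ n → apps (konst n M) Ns ↠h M
konst-full M _ Ns refl = ≡.subst (λ n → apps (konst n M) Ns ↠h M) (+-comm (length Ns) 0) (konst-run 0 M Ns)

take-run : ∀ {k} n (M : Term k) Ns → apps (ƛ (konst (length Ns + n) (var zero))) (M ∷ Ns) ↠h konst n M
take-run n M Ns = →h-apps Ns (hβ _ M) ◅
  ≡.subst (λ K → apps K Ns ↠h konst n M) (≡.sym (subst-konst (single M) (length Ns + n) (var zero))) (konst-run n M Ns)

take-full : ∀ {k} (M : Term k) Ns → apps (ƛ (konst (length Ns) (var zero))) (M ∷ Ns) ↠h M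
take-full M Ns = ≡.subst (λ n → apps (ƛ (konst n (var zero))) (M ∷ Ns) ↠h M) (+-comm (length Ns) 0) (take-run 0 M Ns)

infixl 6 _▹_
_▹_ : ∀ {k} → Term k → Term k → Term k
K ▹ N = ƛ (rename suc K · var zero · rename suc N)

▹-run : ∀ {k} (K N Z : Term k) → (K ▹ N) · Z →h K · Z · N
▹-run K N Z = ≡.subst ((K ▹ N) · Z →h_) (cong₂ (λ A B → A · Z · B) ([]-rename-suc K Z) ([]-rename-suc N Z)) (hβ _ Z)

_▹*_ : ∀ {k} → Term k → List (Term k) → Term k
K ▹* []       = K
K ▹* (N ∷ Ns) = (K ▹ N) ▹* Ns

▹*-run : ∀ {k} (K : Term k) Ns Z → (K ▹* Ns) · Z ↠h apps (K · Z) Ns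
▹*-run K []       Z = ε
▹*-run K (N ∷ Ns) Z = ▹*-run (K ▹ N) Ns Z ◅◅ ↠h-apps Ns (▹-run K N Z ◅ ε)

-- tup n K collects n arguments Ns and becomes K ▹* Ns.
tup : ∀ {k} → ℕ → Term k → Term k
tup zero    K = K
tup (suc n) K = ƛ (tup n (ƛ (rename (λ i → suc (suc i)) K · var zero · var (suc zero))))

subst-tup : ∀ {k l} (σ : Fin k → Term l) n K → subst σ (tup n K) ≡ tup n (subst σ K)
subst-tup σ zero    K = refl
subst-tup σ (suc n) K = cong ƛ (≡.trans (subst-tup (exts σ) n _)
  (cong (λ A → tup n (ƛ (A · var zero · var (suc zero)))) lift))
  where
  ss : ∀ {l} → Fin l → Fin (suc (suc l))
  ss i = suc (suc i)
  lift : subst (exts (exts σ)) (rename ss K) ≡ rename ss (subst σ K)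
  lift = ≡.trans (subst-rename (exts (exts σ)) ss K)
    (≡.trans (subst-cong (λ i → rename-rename suc suc (σ i)) K) (≡.sym (rename-subst ss σ K)))

tup-step : ∀ {k} n (K N : Term k) → tup (suc n) K · N →h tup n (K ▹ N)
tup-step n K N = ≡.subst (tup (suc n) K · N →h_)
  (≡.trans (subst-tup (single N) n _) (cong (λ A → tup n (ƛ (A · var zero · rename suc N))) lift))
  (hβ _ N)
  where
  lift : subst (exts (single N)) (rename (λ i → suc (suc i)) K) ≡ rename suc K
  lift = ≡.trans (subst-rename (exts (single N)) (λ i → suc (suc i)) K) (≡.sym (rename-var suc K))

tup-run : ∀ {k} n (K : Term k) Ns → apps (tup (length Ns + n) K) Ns ↠h tup n (K ▹* Ns)
tup-run n K []       = ε
tup-run n K (N ∷ Ns) = →h-apps Ns (tup-step (length Ns + n) K N) ◅ tup-run n (K ▹ N) Ns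

-- `perm r` behaves as λx₁...x_r z. z I x₁...x_r. Wrapping the arguments one by one makes a partial
-- application again a `tup`.
permK : Term 0
permK = ƛ (var zero · ƛ (var zero))

perm : ℕ → Term 0
perm r = tup r permK

perm-run : ∀ r Ns Z → length Ns ≡ r → apps (perm r) Ns · Z ↠h apps (Z · I) Ns
perm-run r Ns Z eq =
  ↠h-apps (Z ∷ []) (≡.subst (λ n → apps (tup n permK) Ns ↠h permK ▹* Ns) (≡.trans (+-comm (length Ns) 0) eq) (tup-run 0 permK Ns))
  ◅◅ (▹*-run permK Ns Z ◅◅ ↠h-apps Ns (hβ _ Z ◅ ε))

pad : ℕ → List (Term 0)
pad n = replicate n Ω

perm-Solv : ∀ r Ns → length Ns ≤ r → Solv (apps (perm r) Ns)
perm-Solv r Ns le = Solv-apps (apps (perm r) Ns) (pad n ++ konst (suc r) I ∷ [])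
  (≡.subst Solv (≡.trans (cong (_· konst (suc r) I) (apps-++ (perm r) Ns (pad n))) (≡.sym (apps-++ _ (pad n) _)))
    (Solv-↠I (perm-run r (Ns ++ pad n) (konst (suc r) I) len ◅◅ konst-full I (suc r) (I ∷ Ns ++ pad n) (cong suc len))))
  where
  n = r ∸ length Ns
  len : length (Ns ++ pad n) ≡ r
  len = ≡.trans (length-++ Ns) (≡.trans (cong (length Ns +_) (length-replicate n)) (m+[n∸m]≡n le))

-- If Ps is shorter, pad so that only the right-hand side receives all its
-- arguments; feeding it a constant function to Ω then separates.
perm-length : ∀ r Ps Qs → length Ps < length Qs → length Qs ≤ r → ¬ (apps (perm r) Ps ≅ apps (perm r) Qs)
perm-length r Ps Qs lt le e = ¬Solv-Ω (Solv-≅ (↠h⇒≅ right) (≡.subst Solv (≡.trans (apps-++ _ (pad n) _) (cong (_· Z) (≡.sym (apps-++ (perm r) Qs (pad n)))))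
   (proj₁ (e (pad n ++ Z ∷ [])) (≡.subst Solv (apps-++ (perm r) Ps _) (perm-Solv r (Ps ++ pad n ++ Z ∷ []) short)))))
  where
  n = r ∸ length Qs
  Z = konst (suc r) Ω
  len : length (Qs ++ pad n) ≡ r
  len = ≡.trans (length-++ Qs) (≡.trans (cong (length Qs +_) (length-replicate n)) (m+[n∸m]≡n le))
  right : apps (perm r) (Qs ++ pad n) · Z ↠h Ω
  right = perm-run r (Qs ++ pad n) Z len ◅◅ konst-full Ω (suc r) (I ∷ Qs ++ pad n) (cong suc len)
  len' : length (Ps ++ pad n ++ Z ∷ []) ≡ suc (length Ps) + n
  len' = ≡.trans (length-++ Ps) (≡.trans (cong (length Ps +_) (≡.trans (length-++ (pad n)) (≡.trans (cong (_+ 1) (length-replicate n)) (+-comm n 1)))) (+-suc (length Ps) n))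
  short : length (Ps ++ pad n ++ Z ∷ []) ≤ r
  short = ≡.subst (_≤ r) (≡.sym len') (≡.subst (suc (length Ps) + n ≤_) (m+[n∸m]≡n le) (+-monoˡ-≤ n lt))

-- A Z that returns its first argument compares the heads of the lists; a Z that drops it reduces to
-- the tails.
select : ∀ Ps Qs → length Ps ≡ length Qs → (∀ Z → apps Z Ps ≅ apps Z Qs) → Ps ≅* Qs
select []       []       _ f = []
select (P ∷ Ps) (Q ∷ Qs) l f =
  ≅-trans (≅-sym (↠h⇒≅ (take-full P Ps))) (≅-trans (f Z) (≅-trans (≅-reflexive (cong (λ n → apps (ƛ (konst n (var zero))) (Q ∷ Qs)) (suc-injective l))) (↠h⇒≅ (take-full Q Qs))))
  ∷ select Ps Qs (suc-injective l) λ Y → ≅-trans (≅-sym (skip Y P Ps)) (≅-trans (f (konst 1 Y)) (skip Y Q Qs))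
  where
  Z = ƛ (konst (length Ps) (var zero))
  skip : ∀ Y P Ps → apps (konst 1 Y) (P ∷ Ps) ≅ apps Y Ps
  skip Y P Ps = ↠h⇒≅ (↠h-apps Ps (konst-run 0 Y (P ∷ [])))

≅*-tail : ∀ {P Q Ps Qs} → (P ∷ Ps) ≅* (Q ∷ Qs) → Ps ≅* Qs
≅*-tail (_ ∷ es) = es

≅*-prefix : ∀ Ps Qs {Rs Ss} → length Ps ≡ length Qs → (Ps ++ Rs) ≅* (Qs ++ Ss) → Ps ≅* Qs
≅*-prefix []       []       _ es       = []
≅*-prefix (P ∷ Ps) (Q ∷ Qs) l (e ∷ es) = e ∷ ≅*-prefix Ps Qs (suc-injective l) es

-- Once the lengths agree, padding to exactly r arguments makes the permutator hand all of them to
-- an arbitrary Z, which can select any one.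
perm-inj : ∀ r Ps Qs → length Ps ≤ r → length Qs ≤ r → apps (perm r) Ps ≅ apps (perm r) Qs → Ps ≅* Qs
perm-inj r Ps Qs lp lq e with <-cmp (length Ps) (length Qs)
... | tri< lt _ _ = ⊥-elim (perm-length r Ps Qs lt lq e)
... | tri> _ _ gt = ⊥-elim (perm-length r Qs Ps gt lp (≅-sym e))
... | tri≈ _ eq _ = ≅*-prefix Ps Qs eq (≅*-tail (select (I ∷ Ps ++ pad n) (I ∷ Qs ++ pad n)
    (cong suc (≡.trans lenP (≡.sym lenQ))) λ Z →
    ≅-trans (≅-sym (full Ps lenP Z)) (≅-trans (apps-cong e (≅*-refl (pad n ++ Z ∷ []))) (full Qs lenQ Z))))
  where
  n = r ∸ length Ps
  lenP : length (Ps ++ pad n) ≡ r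
  lenP = ≡.trans (length-++ Ps) (≡.trans (cong (length Ps +_) (length-replicate n)) (m+[n∸m]≡n lp))
  lenQ : length (Qs ++ pad n) ≡ r
  lenQ = ≡.trans (length-++ Qs) (≡.trans (cong (_+ length (pad n)) (≡.sym eq)) (≡.trans (≡.sym (length-++ Ps)) lenP))
  full : ∀ Ps → length (Ps ++ pad n) ≡ r → ∀ Z → apps (apps (perm r) Ps) (pad n ++ Z ∷ []) ≅ apps Z (I ∷ Ps ++ pad n)
  full Ps len Z = ≅-trans
    (≅-reflexive (≡.trans (apps-++ _ (pad n) _) (cong (_· Z) (≡.sym (apps-++ (perm r) Ps (pad n))))))
    (↠h⇒≅ (perm-run r (Ps ++ pad n) Z len))

-- Head reduction of open terms

-- An instance of M repeats the head steps of M until a variable reaches the head, and an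
-- abstraction can only come from an abstraction before that.
inert : ∀ {k t U} (σ : Fin k → Term 0) M → subst σ M ⟶[ t ] ƛ U →
        ∃ λ N → M ↠h N × ((∃ λ i → ∃ λ Ns → N ≡ apps (var i) Ns) ⊎ (∃ λ V → N ≡ ƛ V × subst σ (ƛ V) ≡ ƛ U))
inert σ M r with headView M
inert σ M r | is-var i Ns = _ , ε , inj₁ (i , Ns , refl)
inert σ M [] | is-lam V = _ , ε , inj₂ (V , refl , refl)
inert {t = zero} σ M r | is-step s = ⊥-elim (stuck (→h-subst σ s) r)
  where
  stuck : ∀ {M N U} → M →h N → ¬ (M ⟶[ 0 ] ƛ U)
  stuck () []
inert {t = suc t} σ M r | is-step s with inert σ _ (step-drop (→h-subst σ s) r)
... | N , r' , c = N , s ◅ r' , c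

exts-var0 : ∀ {k} (σ : Fin k → Term 0) U → subst (exts σ) U ≡ var zero → U ≡ var zero
exts-var0 σ (var zero)    e = refl
exts-var0 σ (var (suc i)) e with σ i
exts-var0 σ (var (suc i)) () | ƛ _
exts-var0 σ (var (suc i)) () | _ · _

ƛ-inj : ∀ {k} {U V : Term (suc k)} → ƛ U ≡ ƛ V → U ≡ V
ƛ-inj refl = refl

ƛ-⟶ : ∀ {k t} {U V : Term (suc k)} → ƛ U ⟶[ t ] ƛ V → ƛ U ≡ ƛ V
ƛ-⟶ [] = refl

subst≡I : ∀ {k} (σ : Fin k → Term 0) U → subst σ (ƛ U) ≡ I → U ≡ var zero
subst≡I σ U e = exts-var0 σ U (ƛ-inj e)

spread : ∀ {j} → Term 1 → Term (suc j)
spread M = rename (λ _ → zero) M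

vars : ∀ j → List (Term (suc j))
vars j = tabulate (λ i → var (suc i))

spread-subst : ∀ {j} (c : Term 0) (u : Fin j → Term 0) M → subst (c • u) (spread M) ≡ M [ c ]
spread-subst c u M = ≡.trans (subst-rename (c • u) (λ _ → zero) M) (subst-cong (λ { zero → refl }) M)

spread-apps : ∀ {j} (c : Term 0) (u : Fin j → Term 0) M →
              subst (c • u) (apps (spread M) (vars j)) ≡ apps (M [ c ]) (tabulate u)
spread-apps {j} c u M = ≡.trans (subst-apps (c • u) (spread M) (vars j))
  (cong₂ apps (spread-subst c u M) (map-tabulate (λ i → var (suc i)) (subst (c • u))))

-- Variable zero is the hole; the j others are fresh arguments, since M may expose the hole only
-- after receiving further arguments.
HeadRun : Term 1 → ∀ j → List (Term (suc j)) → Set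
HeadRun M j Ys = apps (spread M) (vars j) ↠h apps (var zero) Ys

HeadRun-inst : ∀ M {j} Ys → HeadRun M j Ys → ∀ c u → apps (M [ c ]) (tabulate u) ↠h apps c (map (subst (c • u)) Ys)
HeadRun-inst M Ys r c u = ≡.subst₂ _↠h_ (spread-apps c u M) (subst-apps (c • u) (var zero) Ys) (↠h-subst (c • u) r)

-- Follow a run that solves `M [ c₀ ]`, with the hole left open and fresh variables for the solving
-- arguments. If the hole does not come to the head, the run ends in I or at a fresh variable, for
-- which a constant function to I can be substituted; either way c is irrelevant.
Solv-head : ∀ M c₀ → Solv (M [ c₀ ]) → (∀ c → Solv (M [ c ])) ⊎ (∃ λ j → ∃ λ Ys → HeadRun M j Ys)
Solv-head M c₀ (Ps , t , r) with inert (c₀ • lookup Ps) (apps (spread M) (vars (length Ps)))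
    (≡.subst (_⟶[ t ] I) (≡.sym (≡.trans (spread-apps c₀ (lookup Ps) M) (cong (apps (M [ c₀ ])) (tabulate-lookup Ps)))) r)
... | _ , r' , inj₁ (zero , Ys , refl) = inj₂ (length Ps , Ys , r')
... | _ , r' , inj₁ (suc i , Ys , refl) = inj₁ λ c → Solv-apps (M [ c ]) (tabulate u) (Solv-↠I
      (≡.subst₂ _↠h_ (spread-apps c u M) (subst-apps (c • u) (var (suc i)) Ys) (↠h-subst (c • u) r')
        ◅◅ konst-full I (length Ys) (map (subst (c • u)) Ys) (length-map (subst (c • u)) Ys)))
  where
  u : Fin (length Ps) → Term 0
  u _ = konst (length Ys) I
... | _ , r' , inj₂ (V , refl , e) with refl ← subst≡I (c₀ • lookup Ps) V e = inj₁ λ c →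
    Solv-apps (M [ c ]) (tabulate (lookup Ps)) (Solv-↠I
      (≡.subst (_↠h I) (spread-apps c (lookup Ps) M) (↠h-subst (c • lookup Ps) r')))

-- Permutators of large arity are generic: an equivalence that holds for all of
-- them holds for every closed term.

[]-wk0 : ∀ (c : Term 0) B → wk0 B [ c ] ≡ B
[]-wk0 c B = subst-wk0-closed (single c) B

map-[]-wk0 : ∀ c Ns → map (_[ c ]) (map wk0 Ns) ≡ Ns
map-[]-wk0 c Ns = ≡.trans (≡.sym (map-∘ Ns)) (≡.trans (map-cong ([]-wk0 c) Ns) (map-id Ns))

apps-[] : ∀ c (M : Term 1) Ns → apps M Ns [ c ] ≡ apps (M [ c ]) (map (_[ c ]) Ns)
apps-[] c M Ns = subst-apps (single c) M Ns

apps-wk0-[] : ∀ c (M : Term 1) Ns → apps M (map wk0 Ns) [ c ] ≡ apps (M [ c ]) Ns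
apps-wk0-[] c M Ns = ≡.trans (apps-[] c M (map wk0 Ns)) (cong (apps (M [ c ])) (map-[]-wk0 c Ns))

apps-wk0-head : ∀ c B (Ns : List (Term 1)) → apps (wk0 B) Ns [ c ] ≡ apps B (map (_[ c ]) Ns)
apps-wk0-head c B Ns = ≡.trans (apps-[] c (wk0 B) Ns) (cong (λ A → apps A (map (_[ c ]) Ns)) ([]-wk0 c B))

fix : ∀ {j} → (Fin j → Term 0) → Term (suc j) → Term 1
fix u = subst (var zero • (wk0 ∘ u))

fix-[] : ∀ {j} c (u : Fin j → Term 0) M → fix u M [ c ] ≡ subst (c • u) M
fix-[] c u M = ≡.trans (subst-subst (single c) _ M)
  (subst-cong (λ { zero → refl ; (suc i) → []-wk0 c (u i) }) M)

map-fix-[] : ∀ {j} c (u : Fin j → Term 0) Ms → map (_[ c ]) (map (fix u) Ms) ≡ map (subst (c • u)) Ms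
map-fix-[] c u Ms = ≡.trans (≡.sym (map-∘ Ms)) (map-cong (fix-[] c u) Ms)

Is : ∀ {j} → Fin j → Term 0
Is _ = I

AllI : List (Term 0) → Set
AllI Ns = Ns ≡ replicate (length Ns) I

apps-Is : ∀ Ns → AllI Ns → apps I Ns ↠h I
apps-Is []       _ = ε
apps-Is (N ∷ Ns) e with refl ← ∷-injectiveˡ e = →h-apps Ns (hβ _ N) ◅ apps-Is Ns (∷-injectiveʳ e)

AllI-++ : ∀ Ms Ns → AllI Ms → AllI Ns → AllI (Ms ++ Ns)
AllI-++ []       Ns p q = q
AllI-++ (M ∷ Ms) Ns p q with refl ← ∷-injectiveˡ p = cong (I ∷_) (AllI-++ Ms Ns (∷-injectiveʳ p) q)

AllI-Is : ∀ j → AllI (tabulate {n = j} Is)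
AllI-Is zero    = refl
AllI-Is (suc j) = cong (I ∷_) (AllI-Is j)

-- If M' exposed the hole, I would be ≅ to a permutator with fewer than r arguments. One further
-- argument Ω refutes this: I · Ω is unsolvable, the permutator still solvable.
generic-I : ∀ B Js M' r₀ → AllI Js → (∀ r → r₀ ≤ r → apps I Js ≅ M' [ perm r ]) → Solv (M' [ B ])
generic-I B Js M' r₀ js e with Solv-head M' (perm r₀) (Solv-≅ (≅-trans (≅-sym (↠h⇒≅ (apps-Is Js js))) (e r₀ ≤-refl)) Solv-I)
... | inj₁ f = f B
... | inj₂ (j , Ys , run') = ⊥-elim (¬Solv-Ω (Solv-≅ (→h⇒≅ (hβ _ Ω)) (Solv-≅ (·-cong (≅-sym I≅) ≅-refl)
    (≡.subst Solv (apps-++ (perm r) Ys' (Ω ∷ [])) (perm-Solv r (Ys' ++ Ω ∷ []) len)))))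
  where
  Ks = tabulate {n = j} Is
  r = r₀ ⊔ suc (length Ys)
  Ys' = map (subst (perm r • Is)) Ys
  len : length (Ys' ++ Ω ∷ []) ≤ r
  len = ≡.subst (_≤ r) (≡.sym (≡.trans (length-++ Ys') (≡.trans (+-comm (length Ys') 1) (cong suc (length-map _ Ys))))) (m≤n⊔m r₀ _)
  I≅ : I ≅ apps (perm r) Ys'
  I≅ = ≅-trans (≅-sym (↠h⇒≅ (apps-Is (Js ++ Ks) (AllI-++ Js Ks js (AllI-Is j)))))
    (≅-trans (≅-reflexive (apps-++ I Js Ks))
      (≅-trans (apps-cong (e r (m≤m⊔n r₀ _)) (≅*-refl Ks)) (↠h⇒≅ (HeadRun-inst M' Ys run' (perm r) Is))))

-- The trailing Js absorb η-expansions on the side of M'.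
generic-run : ∀ t B M Js M' r₀ → M [ B ] ⟶[ t ] I → AllI Js →
              (∀ r → r₀ ≤ r → apps (M [ perm r ]) Js ≅ M' [ perm r ]) → Solv (M' [ B ])
generic-run-closed : ∀ t B M Js M' r₀ → headVar M ≡ nothing → M [ B ] ⟶[ t ] I → AllI Js →
              (∀ r → r₀ ≤ r → apps (M [ perm r ]) Js ≅ M' [ perm r ]) → Solv (M' [ B ])

generic-run t B M Js M' r₀ run js e with headView M
... | is-lam U  = generic-run-closed t B (ƛ U) Js M' r₀ refl run js e
... | is-step s = generic-run-closed t B M Js M' r₀ (no-var s) run js e
  where
  no-var : ∀ {M N : Term 1} → M →h N → headVar M ≡ nothing
  no-var (hβ U N)   = refl
  no-var (happ N s) = no-var s
... | is-var zero Xs = generic-run-var (Solv-head M' (perm r₁) (Solv-≅ (e r₁ (m≤m⊔n r₀ len)) solv))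
  where
  len = length Xs + length Js
  r₁ = r₀ ⊔ len
  solv : Solv (apps (apps (var zero) Xs [ perm r₁ ]) Js)
  solv = ≡.subst Solv (≡.trans (apps-++ (perm r₁) (map (_[ perm r₁ ]) Xs) Js) (cong (λ A → apps A Js) (≡.sym (apps-[] (perm r₁) (var zero) Xs))))
    (perm-Solv r₁ (map (_[ perm r₁ ]) Xs ++ Js)
      (≡.subst (_≤ r₁) (≡.sym (≡.trans (length-++ (map (_[ perm r₁ ]) Xs)) (cong (_+ length Js) (length-map _ Xs)))) (m≤n⊔m r₀ len)))
  generic-run-var : (∀ c → Solv (M' [ c ])) ⊎ (∃ λ j → ∃ λ Ys → HeadRun M' j Ys) → Solv (M' [ B ])
  generic-run-var (inj₁ f) = f B
  -- Both sides have the hole at the head, and permutators show their arguments to be ≅. B now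
  -- replaces the hole at the head only. The run keeps its length t, but its head is closed, so the
  -- next call consumes a step.
  generic-run-var (inj₂ (j , Ys , run')) = Solv-apps (M' [ B ]) Ks (Solv-≅ (≅-sym (↠h⇒≅ (HeadRun-inst M' Ys run' B Is)))
      (≡.subst Solv (≡.trans (apps-wk0-head B B (map (fix Is) Ys)) (cong (apps B) (map-fix-[] B Is Ys)))
        (generic-run-closed t B (apps (wk0 B) Xs) (Js ++ Ks) (apps (wk0 B) (map (fix Is) Ys)) r₂
          (≡.trans (headVar-apps (wk0 B) Xs) (headVar-wk0 B))
          (≡.subst (_⟶[ t ] I) (≡.trans (apps-[] B (var zero) Xs) (≡.sym (apps-wk0-head B B Xs))) run)
          (AllI-++ Js Ks js (AllI-Is j)) e')))
    where
    Ks = tabulate {n = j} Is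
    r₂ = r₀ ⊔ (length Xs + length (Js ++ Ks) ⊔ length Ys)
    e' : ∀ r → r₂ ≤ r → apps (apps (wk0 B) Xs [ perm r ]) (Js ++ Ks) ≅ apps (wk0 B) (map (fix Is) Ys) [ perm r ]
    e' r le = ≅-trans (≅-reflexive (≡.trans (cong (λ A → apps A (Js ++ Ks)) (apps-wk0-head (perm r) B Xs)) (≡.sym (apps-++ B (map (_[ perm r ]) Xs) (Js ++ Ks)))))
      (≅-trans (apps-cong ≅-refl args)
        (≅-reflexive (≡.sym (≡.trans (apps-wk0-head (perm r) B (map (fix Is) Ys)) (cong (apps B) (map-fix-[] (perm r) Is Ys))))))
      where
      Xs' = map (_[ perm r ]) Xs
      Ys' = map (subst (perm r • Is)) Ys
      args : (Xs' ++ Js ++ Ks) ≅* Ys'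
      args = perm-inj r _ _
        (≡.subst (_≤ r) (≡.sym (≡.trans (length-++ Xs') (cong (_+ length (Js ++ Ks)) (length-map _ Xs))))
          (≤-trans (m≤m⊔n _ _) (≤-trans (m≤n⊔m r₀ _) le)))
        (≡.subst (_≤ r) (≡.sym (length-map _ Ys)) (≤-trans (m≤n⊔m (length Xs + length (Js ++ Ks)) _) (≤-trans (m≤n⊔m r₀ _) le)))
        (≅-trans (≅-reflexive (≡.trans (≡.sym (cong (apps (perm r)) (++-assoc Xs' Js Ks)))
            (≡.trans (apps-++ (perm r) (Xs' ++ Js) Ks) (cong (λ A → apps A Ks) (≡.trans (apps-++ (perm r) Xs' Js)
              (cong (λ A → apps A Js) (≡.sym (apps-[] (perm r) (var zero) Xs))))))))
          (≅-trans (apps-cong (e r (≤-trans (m≤m⊔n r₀ _) le)) (≅*-refl Ks)) (↠h⇒≅ (HeadRun-inst M' Ys run' (perm r) Is))))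

generic-run-closed t B M Js M' r₀ nv run js e with headView M
... | is-var i Ns with () ← ≡.trans (≡.sym nv) (headVar-apps (var i) Ns)
generic-run-closed zero B M Js M' r₀ nv run js e | is-step s = ⊥-elim (stuck (→h-subst (single B) s) run)
  where
  stuck : ∀ {M N : Term 0} → M →h N → ¬ (M ⟶[ 0 ] I)
  stuck () []
generic-run-closed (suc t) B M Js M' r₀ nv run js e | is-step {N = N} s =
  generic-run t B N Js M' r₀ (step-drop (→h-subst (single B) s) run) js
    (λ r le → ≅-trans (apps-cong (≅-sym (→h⇒≅ (→h-subst (single (perm r)) s))) (≅*-refl Js)) (e r le))
generic-run-closed t B M Js M' r₀ nv run js e | is-lam U with refl ← subst≡I (single B) U (ƛ-⟶ run) = generic-I B Js M' r₀ js e

generic-half : ∀ r₀ T T' → (∀ r → r₀ ≤ r → T [ perm r ] ≅ T' [ perm r ]) → ∀ B Ns →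
               Solv (apps (T [ B ]) Ns) → Solv (apps (T' [ B ]) Ns)
generic-half r₀ T T' e B Ns (Ps , t , run) = Solv-apps _ Ps
  (≡.subst Solv (≡.trans (apps-wk0-[] B T' (Ns ++ Ps)) (apps-++ _ Ns Ps))
    (generic-run t B (apps T (map wk0 (Ns ++ Ps))) [] (apps T' (map wk0 (Ns ++ Ps))) r₀
      (≡.subst (_⟶[ t ] I) (≡.sym (≡.trans (apps-wk0-[] B T (Ns ++ Ps)) (apps-++ _ Ns Ps))) run) refl
      (λ r le → ≅-trans (≅-reflexive (apps-wk0-[] (perm r) T (Ns ++ Ps)))
        (≅-trans (apps-cong (e r le) (≅*-refl (Ns ++ Ps))) (≅-reflexive (≡.sym (apps-wk0-[] (perm r) T' (Ns ++ Ps))))))))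

generic : ∀ r₀ T T' → (∀ r → r₀ ≤ r → T [ perm r ] ≅ T' [ perm r ]) → ∀ B → T [ B ] ≅ T' [ B ]
generic r₀ T T' e B Ns = generic-half r₀ T T' e B Ns , generic-half r₀ T' T (λ r le → ≅-sym (e r le)) B Ns

generic* : ∀ r₀ Ts Ts' → (∀ r → r₀ ≤ r → map (_[ perm r ]) Ts ≅* map (_[ perm r ]) Ts') →
           ∀ B → map (_[ B ]) Ts ≅* map (_[ B ]) Ts'
generic* r₀ []       []         e B = []
generic* r₀ []       (T' ∷ Ts') e B with () ← e r₀ ≤-refl
generic* r₀ (T ∷ Ts) []         e B with () ← e r₀ ≤-refl
generic* r₀ (T ∷ Ts) (T' ∷ Ts') e B =
  generic r₀ T T' (λ r le → hd (e r le)) B ∷ generic* r₀ Ts Ts' (λ r le → ≅*-tail (e r le)) B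
  where
  hd : ∀ {P Q Ps Qs} → (P ∷ Ps) ≅* (Q ∷ Qs) → P ≅ Q
  hd (e ∷ _) = e

-- The instance c = Ω is unsolvable, so M must expose the hole. Permutators then identify the
-- arguments, and genericity carries this identification from permutators to every c.
head-inversion : ∀ M Rs → (∀ c → M [ c ] ≅ apps c (map (_[ c ]) Rs)) →
  ∃ λ j → ∃ λ Ys → HeadRun M j Ys × (∀ c (u : Fin j → Term 0) → map (subst (c • u)) Ys ≅* (map (_[ c ]) Rs ++ tabulate u))
head-inversion M Rs e = analyse (Solv-head M (perm (length Rs)) (Solv-≅ (≅-sym (e _))
    (perm-Solv _ (map (_[ perm (length Rs) ]) Rs) (≡.subst (_≤ length Rs) (≡.sym (length-map _ Rs)) ≤-refl))))
  where
  split : ∀ {j} c (u : Fin j → Term 0) → map (_[ c ]) (Rs ++ map wk0 (tabulate u)) ≡ map (_[ c ]) Rs ++ tabulate u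
  split c u = ≡.trans (map-++ _ Rs _) (cong (map (_[ c ]) Rs ++_) (map-[]-wk0 c (tabulate u)))

  args : ∀ {j Ys} → HeadRun M j Ys → ∀ (u : Fin j → Term 0) r → (length Rs + length (tabulate u)) ⊔ length Ys ≤ r →
         map (_[ perm r ]) (map (fix u) Ys) ≅* map (_[ perm r ]) (Rs ++ map wk0 (tabulate u))
  args {j} {Ys} run u r le = ≡.subst₂ _≅*_ (≡.sym (map-fix-[] (perm r) u Ys)) (≡.sym (split (perm r) u))
    (perm-inj r (map (subst (perm r • u)) Ys) (map (_[ perm r ]) Rs ++ tabulate u) (≡.subst (_≤ r) (≡.sym (length-map _ Ys)) (≤-trans (m≤n⊔m (length Rs + length (tabulate u)) _) le))
      (≡.subst (_≤ r) (≡.sym (≡.trans (length-++ (map (_[ perm r ]) Rs)) (cong (_+ length (tabulate u)) (length-map _ Rs))))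
        (≤-trans (m≤m⊔n _ _) le))
      (≅-trans (≅-sym (↠h⇒≅ (HeadRun-inst M Ys run (perm r) u)))
        (≅-trans (apps-cong (e (perm r)) (≅*-refl (tabulate u))) (≅-reflexive (≡.sym (apps-++ (perm r) (map (_[ perm r ]) Rs) (tabulate u)))))))

  analyse : (∀ c → Solv (M [ c ])) ⊎ (∃ λ j → ∃ λ Ys → HeadRun M j Ys) →
    ∃ λ j → ∃ λ Ys → HeadRun M j Ys × (∀ c (u : Fin j → Term 0) → map (subst (c • u)) Ys ≅* (map (_[ c ]) Rs ++ tabulate u))
  analyse (inj₁ f) = ⊥-elim (¬Solv-apps ¬Solv-Ω (map (_[ Ω ]) Rs) (Solv-≅ (e Ω) (f Ω)))
  analyse (inj₂ (j , Ys , run)) = j , Ys , run , λ c u →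
    ≡.subst₂ _≅*_ (map-fix-[] c u Ys) (split c u)
      (generic* ((length Rs + length (tabulate u)) ⊔ length Ys) (map (fix u) Ys) (Rs ++ map wk0 (tabulate u)) (args {j} {Ys} run u) c)

-- Confluence of βΩ-reduction

infix 4 _⇛_ _⇛*_
data _⇛_ {k} : Term k → Term k → Set where
  var : ∀ i → var i ⇛ var i
  ƛ   : ∀ {U U'} → U ⇛ U' → ƛ U ⇛ ƛ U'
  _·_ : ∀ {M M' N N'} → M ⇛ M' → N ⇛ N' → M · N ⇛ M' · N'
  β   : ∀ {U U' N N'} → U ⇛ U' → N ⇛ N' → ƛ U · N ⇛ U' [ N' ]
  Ωp  : ∀ {M} → Unsolvable* M → M ⇛ wk0 Ω

⇛-refl : ∀ {k} (M : Term k) → M ⇛ M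
⇛-refl (var i) = var i
⇛-refl (ƛ M)   = ƛ (⇛-refl M)
⇛-refl (M · N) = ⇛-refl M · ⇛-refl N

⇛⇒≅ : ∀ {k} (σ : Fin k → Term 0) {M N} → M ⇛ N → subst σ M ≅ subst σ N
⇛⇒≅ σ (var i) = ≅-refl
⇛⇒≅ σ (ƛ {U} {U'} p) = ƛ-ext-subst σ {U} {U'} (λ V → ⇛⇒≅ (V • σ) p)
⇛⇒≅ σ (p · q) = ·-cong (⇛⇒≅ σ p) (⇛⇒≅ σ q)
⇛⇒≅ σ (β {U} {U'} {N} {N'} p q) = ≅-trans (·-cong (ƛ-ext-subst σ {U} {U'} (λ V → ⇛⇒≅ (V • σ) p)) (⇛⇒≅ σ q))
  (→h⇒≅ (→h-subst σ (hβ U' N')))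
⇛⇒≅ σ (Ωp u) = ¬Solv⇒≅ (u σ) (Unsolvable*-Ω σ)

Unsolvable*-⇛ : ∀ {k} {M N : Term k} → M ⇛ N → Unsolvable* M → Unsolvable* N
Unsolvable*-⇛ p u σ o = u σ (Solv-≅ (≅-sym (⇛⇒≅ σ p)) o)

Unsolvable*-rename : ∀ {k l} (ρ : Fin k → Fin l) {M} → Unsolvable* M → Unsolvable* (rename ρ M)
Unsolvable*-rename ρ {M} u σ o = u (σ ∘ ρ) (≡.subst Solv (subst-rename σ ρ M) o)

Unsolvable*-subst : ∀ {k l} (τ : Fin k → Term l) {M} → Unsolvable* M → Unsolvable* (subst τ M)
Unsolvable*-subst τ {M} u σ o = u (subst σ ∘ τ) (≡.subst Solv (subst-subst σ τ M) o)

⇛-rename : ∀ {k l} (ρ : Fin k → Fin l) {M N} → M ⇛ N → rename ρ M ⇛ rename ρ N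
⇛-rename ρ (var i) = var (ρ i)
⇛-rename ρ (ƛ p)   = ƛ (⇛-rename (ext ρ) p)
⇛-rename ρ (p · q) = ⇛-rename ρ p · ⇛-rename ρ q
⇛-rename ρ (β {U} {U'} {N} {N'} p q) = ≡.subst (rename ρ (ƛ U · N) ⇛_) (≡.sym (rename-[] ρ U' N')) (β (⇛-rename (ext ρ) p) (⇛-rename ρ q))
⇛-rename ρ {M} (Ωp u) = ≡.subst (rename ρ M ⇛_) (≡.sym (rename-wk0 ρ Ω)) (Ωp (Unsolvable*-rename ρ {M} u))

⇛-exts : ∀ {k l} {σ τ : Fin k → Term l} → (∀ i → σ i ⇛ τ i) → ∀ i → exts σ i ⇛ exts τ i
⇛-exts e zero    = var zero
⇛-exts e (suc i) = ⇛-rename suc (e i)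

⇛-subst : ∀ {k l} {σ τ : Fin k → Term l} → (∀ i → σ i ⇛ τ i) → ∀ {M N} → M ⇛ N → subst σ M ⇛ subst τ N
⇛-subst e (var i) = e i
⇛-subst e (ƛ p)   = ƛ (⇛-subst (⇛-exts e) p)
⇛-subst e (p · q) = ⇛-subst e p · ⇛-subst e q
⇛-subst {σ = σ} {τ} e (β {U} {U'} {N} {N'} p q) = ≡.subst (subst σ (ƛ U · N) ⇛_) (≡.sym (subst-[] τ U' N')) (β (⇛-subst (⇛-exts e) p) (⇛-subst e q))
⇛-subst {σ = σ} {τ} e {M} (Ωp u) = ≡.subst (subst σ M ⇛_) (≡.sym (subst-wk0 τ Ω)) (Ωp (Unsolvable*-subst σ {M} u))

⇛-[] : ∀ {k} {U U' : Term (suc k)} {N N'} → U ⇛ U' → N ⇛ N' → U [ N ] ⇛ U' [ N' ]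
⇛-[] p q = ⇛-subst (λ { zero → q ; (suc i) → var i }) p

Join : ∀ {k} → Term k → Term k → Set
Join N P = ∃ λ Q → N ⇛ Q × P ⇛ Q

Join-Ω : ∀ {k} {M N P : Term k} → Unsolvable* M → M ⇛ N → M ⇛ P → Join N P
Join-Ω {M = M} {N} {P} u p q = _ , Ωp (Unsolvable*-⇛ {M = M} {N} p u) , Ωp (Unsolvable*-⇛ {M = M} {P} q u)

Unsolvable*-· : ∀ {k} {M : Term k} N → Unsolvable* M → Unsolvable* (M · N)
Unsolvable*-· N u σ o = u σ (Solv-apps _ (_ ∷ []) o)

-- An unsolvable source has only unsolvable reducts, because `⇛` preserves ≅, and these meet in Ω;
-- this covers every overlap of the Ω-rule with another rule. The rest is the usual argument for
-- parallel β.
diamond : ∀ {k} {M N P : Term k} → M ⇛ N → M ⇛ P → Join N P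
diamond {M = M} {N} {P} (Ωp u) q = Join-Ω {M = M} {N} {P} u (Ωp u) q
diamond {M = M} {N} {P} p@(var _) (Ωp u) = Join-Ω {M = M} {N} {P} u p (Ωp u)
diamond {M = M} {N} {P} p@(ƛ _) (Ωp u) = Join-Ω {M = M} {N} {P} u p (Ωp u)
diamond {M = M} {N} {P} p@(_ · _) (Ωp u) = Join-Ω {M = M} {N} {P} u p (Ωp u)
diamond {M = M} {N} {P} p@(β _ _) (Ωp u) = Join-Ω {M = M} {N} {P} u p (Ωp u)
diamond (var i) (var .i) = _ , var i , var i
diamond (ƛ p) (ƛ q) with diamond p q
... | _ , p' , q' = _ , ƛ p' , ƛ q'
diamond (p · q) (p' · q') with diamond p p' | diamond q q'
... | _ , a , b | _ , c , d = _ , a · c , b · d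
diamond (ƛ p · q) (β p' q') with diamond p p' | diamond q q'
... | _ , a , b | _ , c , d = _ , β a c , ⇛-[] b d
diamond {M = M} {N} {P} p@(Ωp {M = L} u · q) r@(β {N = K} p' q') = Join-Ω {M = M} {N} {P} (Unsolvable*-· {M = L} K u) p r
diamond (β p q) (ƛ p' · q') with diamond p p' | diamond q q'
... | _ , a , b | _ , c , d = _ , ⇛-[] a c , β b d
diamond {M = M} {N} {P} p@(β {N = K} _ _) r@(Ωp {M = L} u · q') = Join-Ω {M = M} {N} {P} (Unsolvable*-· {M = L} K u) p r
diamond (β p q) (β p' q') with diamond p p' | diamond q q'
... | _ , a , b | _ , c , d = _ , ⇛-[] a c , ⇛-[] b d

data _⇛*_ {k} : Term k → Term k → Set where
  []  : ∀ {M} → M ⇛* M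
  _∷_ : ∀ {M N P} → M ⇛ N → N ⇛* P → M ⇛* P

strip : ∀ {k} {M N P : Term k} → M ⇛ N → M ⇛* P → ∃ λ Q → N ⇛* Q × P ⇛ Q
strip p []       = _ , [] , p
strip p (q ∷ qs) with diamond p q
... | _ , p' , q' with strip q' qs
... | _ , ps , q'' = _ , p' ∷ ps , q''

confluence : ∀ {k} {M N P : Term k} → M ⇛* N → M ⇛* P → ∃ λ Q → N ⇛* Q × P ⇛* Q
confluence []       qs = _ , qs , []
confluence (p ∷ ps) qs with strip p qs
... | _ , qs' , p' with confluence ps qs'
... | _ , a , b = _ , a , p' ∷ b

→βΩ⇒⇛ : ∀ {k} {M N : Term k} → M →βΩ N → M ⇛ N
→βΩ⇒⇛ (β U N)    = β (⇛-refl U) (⇛-refl N)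
→βΩ⇒⇛ (Ωr M u _) = Ωp (UnsolvableO⇒* u)
→βΩ⇒⇛ (appL N s) = →βΩ⇒⇛ s · ⇛-refl N
→βΩ⇒⇛ (appR M s) = ⇛-refl M · →βΩ⇒⇛ s
→βΩ⇒⇛ (lam s)    = ƛ (→βΩ⇒⇛ s)

↠βΩ⇒⇛* : ∀ {k} {M N : Term k} → M ↠βΩ N → M ⇛* N
↠βΩ⇒⇛* done    = []
↠βΩ⇒⇛* (s ∷ r) = →βΩ⇒⇛ s ∷ ↠βΩ⇒⇛* r

→h⇒⇛ : ∀ {k} {M N : Term k} → M →h N → M ⇛ N
→h⇒⇛ (hβ U N)   = β (⇛-refl U) (⇛-refl N)
→h⇒⇛ (happ N s) = →h⇒⇛ s · ⇛-refl N

⟶⇒⇛* : ∀ {k t} {M N : Term k} → M ⟶[ t ] N → M ⇛* N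
⟶⇒⇛* []      = []
⟶⇒⇛* (s ∷ r) = →h⇒⇛ s ∷ ⟶⇒⇛* r

-- `Ωr` excludes Ω itself, so translating `Ωp` back into steps requires deciding whether the
-- contracted term is already Ω.
_≟_ : ∀ {k} (M N : Term k) → Dec (M ≡ N)
var i ≟ var j with i Fin.≟ j
... | yes refl = yes refl
... | no ne    = no λ { refl → ne refl }
var i ≟ ƛ N = no λ ()
var i ≟ (N · N') = no λ ()
ƛ M ≟ var i = no λ ()
ƛ M ≟ ƛ N with M ≟ N
... | yes refl = yes refl
... | no ne    = no λ { refl → ne refl }
ƛ M ≟ (N · N') = no λ ()
(M · M') ≟ var i = no λ ()
(M · M') ≟ ƛ N = no λ ()
(M · M') ≟ (N · N') with M ≟ N | M' ≟ N'
... | yes refl | yes refl = yes refl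
... | no ne    | _        = no λ { refl → ne refl }
... | yes _    | no ne    = no λ { refl → ne refl }

map-↠βΩ : ∀ {k l} (f : Term k → Term l) → (∀ {M N} → M →βΩ N → f M →βΩ f N) → ∀ {M N} → M ↠βΩ N → f M ↠βΩ f N
map-↠βΩ f g done    = done
map-↠βΩ f g (s ∷ r) = g s ∷ map-↠βΩ f g r

↠βΩ-trans : ∀ {k} {M N P : Term k} → M ↠βΩ N → N ↠βΩ P → M ↠βΩ P
↠βΩ-trans done    r' = r'
↠βΩ-trans (s ∷ r) r' = s ∷ ↠βΩ-trans r r'

⇛⇒↠βΩ : ∀ {k} {M N : Term k} → M ⇛ N → M ↠βΩ N
⇛⇒↠βΩ (var i) = done
⇛⇒↠βΩ (ƛ p)   = map-↠βΩ ƛ lam (⇛⇒↠βΩ p)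
⇛⇒↠βΩ (_·_ {M' = M'} {N} p q) = ↠βΩ-trans (map-↠βΩ (_· N) (appL N) (⇛⇒↠βΩ p)) (map-↠βΩ (M' ·_) (appR M') (⇛⇒↠βΩ q))
⇛⇒↠βΩ (β {U} {U'} {N} {N'} p q) = ↠βΩ-trans (map-↠βΩ (λ L → ƛ L · N) (λ s → appL N (lam s)) (⇛⇒↠βΩ p))
  (↠βΩ-trans (map-↠βΩ (ƛ U' ·_) (appR (ƛ U')) (⇛⇒↠βΩ q)) (β U' N' ∷ done))
⇛⇒↠βΩ {M = M} (Ωp u) with M ≟ wk0 Ω
... | yes refl = done
... | no ne    = Ωr M (*⇒UnsolvableO u) ne ∷ done

NF-↠βΩ : ∀ {k} {M N : Term k} → βΩ-NF M → M ↠βΩ N → N ≡ M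
NF-↠βΩ nf done    = refl
NF-↠βΩ nf (s ∷ r) with refl ← nf _ s = NF-↠βΩ nf r

NF-⇛* : ∀ {k} {M N : Term k} → βΩ-NF M → M ⇛* N → N ≡ M
NF-⇛* nf []       = refl
NF-⇛* nf (p ∷ ps) with refl ← NF-↠βΩ nf (⇛⇒↠βΩ p) = NF-⇛* nf ps

⇛*-NF : ∀ {k} {M N P : Term k} → M ⇛* N → M ⇛* P → βΩ-NF P → N ⇛* P
⇛*-NF ps qs nf with confluence ps qs
... | Q , a , b with refl ← NF-⇛* nf b = a

size : ∀ {k} → Term k → ℕ
size (var i) = 0
size (ƛ M)   = size M
size (M · N) = suc (size M + size N)

size-rename : ∀ {k l} (ρ : Fin k → Fin l) M → size (rename ρ M) ≡ size M
size-rename ρ (var i) = refl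
size-rename ρ (ƛ M)   = size-rename (ext ρ) M
size-rename ρ (M · N) = cong suc (cong₂ _+_ (size-rename ρ M) (size-rename ρ N))

size-iterF : ∀ m → size (iterF m) ≡ m
size-iterF zero    = refl
size-iterF (suc m) = cong suc (size-iterF m)

Occurs-size : ∀ {c k} {M : Term k} → Occurs c M → size c ≤ size M
Occurs-size {c} here = ≤-reflexive (≡.sym (size-rename noVar c))
Occurs-size (inL {M = M} o) = ≤-trans (Occurs-size o) (≤-trans (m≤m+n (size M) _) (n≤1+n _))
Occurs-size (inR {M = M} {N} o) = ≤-trans (Occurs-size o) (≤-trans (m≤n+m (size N) (size M)) (n≤1+n _))
Occurs-size (inƛ o) = Occurs-size o

-- Closed head reduction

HeadClosed-det : ∀ {M N P : Term 0} → HeadClosed M N → M →h P → N ≡ P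
HeadClosed-det (hβ U N) (hβ _ _) = rename-[] noVar U N
HeadClosed-det (happ V h) (happ _ s) = cong (_· V) (HeadClosed-det h s)

HeadClosed⇒→β : ∀ {k} {M N : Term k} → HeadClosed M N → M →β N
HeadClosed⇒→β (hβ U N)   = ≡.subst (wk0 (ƛ U · N) →β_) (≡.sym (rename-[] noVar U N)) (β _ _)
HeadClosed⇒→β (happ V h) = appL V (HeadClosed⇒→β h)
HeadClosed⇒→β (hlam h)   = lam (HeadClosed⇒→β h)

HeadClosed*⇒=β : ∀ {k} {M N : Term k} → HeadClosed* M N → M =β N
HeadClosed*⇒=β done     = refl
HeadClosed*⇒=β (h ∷ hs) = trans (step (HeadClosed⇒→β h)) (HeadClosed*⇒=β hs)

HeadClosed*-ƛ : ∀ {k} {U V : Term (suc k)} → HeadClosed* (ƛ U) (ƛ V) → HeadClosed* U V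
HeadClosed*-ƛ done            = done
HeadClosed*-ƛ (hlam h ∷ hs) = h ∷ HeadClosed*-ƛ hs

rename-· : ∀ {k l} (ρ : Fin k → Fin l) X {M N} → M · N ≡ rename ρ X → ∃ λ X₁ → ∃ λ X₂ → M ≡ rename ρ X₁ × N ≡ rename ρ X₂
rename-· ρ (X₁ · X₂) refl = X₁ , X₂ , refl , refl

rename-ƛ : ∀ {k l} (ρ : Fin k → Fin l) X {M} → ƛ M ≡ rename ρ X → ∃ λ X₁ → M ≡ rename (ext ρ) X₁
rename-ƛ ρ (ƛ X) refl = X , refl

-- An open argument can never be consumed by a closed redex, so a variable
-- that does not occur in the result did not occur at the start.
HeadClosed-image : ∀ {j k} {M M' : Term k} → HeadClosed M M' → (ρ : Fin j → Fin k) → ∀ X → M' ≡ rename ρ X → ∃ λ Y → M ≡ rename ρ Y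
HeadClosed-image (hβ U N) ρ X e = wk0 (ƛ U · N) , ≡.sym (rename-wk0 ρ (ƛ U · N))
HeadClosed-image (happ V h) ρ X e with rename-· ρ X e
... | X₁ , X₂ , e₁ , e₂ with HeadClosed-image h ρ X₁ e₁
... | Y , e' = Y · X₂ , cong₂ _·_ e' e₂
HeadClosed-image (hlam h) ρ X e with rename-ƛ ρ X e
... | X₁ , e₁ with HeadClosed-image h (ext ρ) X₁ e₁
... | Y , e' = ƛ Y , cong ƛ e'

HeadClosed*-image : ∀ {j k} {M M' : Term k} → HeadClosed* M M' → (ρ : Fin j → Fin k) → ∀ X → M' ≡ rename ρ X → ∃ λ Y → M ≡ rename ρ Y
HeadClosed*-image done     ρ X e = X , e
HeadClosed*-image (h ∷ hs) ρ X e with HeadClosed*-image hs ρ X e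
... | Y , e' = HeadClosed-image h ρ Y e'

-- If σ sends i to a variable v and the result avoids v, then i does not occur in M, and its value
-- is immaterial.
subst-unused : ∀ {j k l n} {ρ : Fin j → Fin l} {σ : Fin k → Term l} {τ τ' : Fin k → Term n} →
  (∀ i → τ i ≡ τ' i ⊎ (∃ λ v → σ i ≡ var v × (∀ u → ¬ (ρ u ≡ v)))) →
  ∀ M X → subst σ M ≡ rename ρ X → subst τ M ≡ subst τ' M
subst-unused {ρ = ρ} c (var i) X e with c i
... | inj₁ eq = eq
... | inj₂ (v , eq , no-im) = ⊥-elim (lemma X (≡.trans (≡.sym eq) e))
  where
  lemma : ∀ X → ¬ (var v ≡ rename ρ X)
  lemma (var u) refl = no-im u refl
subst-unused {ρ = ρ} {σ} {τ} {τ'} c (ƛ M) X e with rename-ƛ ρ X e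
... | X₁ , e₁ = cong ƛ (subst-unused {ρ = ext ρ} c' M X₁ e₁)
  where
  c' : ∀ i → exts τ i ≡ exts τ' i ⊎ (∃ λ v → exts σ i ≡ var v × (∀ u → ¬ (ext ρ u ≡ v)))
  c' zero = inj₁ refl
  c' (suc i) with c i
  ... | inj₁ eq = inj₁ (cong (rename suc) eq)
  ... | inj₂ (v , eq , no-im) = inj₂ (suc v , cong (rename suc) eq , λ { zero () ; (suc u) e → no-im u (Fin.suc-injective e) })
subst-unused {ρ = ρ} c (M · N) X e with rename-· ρ X e
... | X₁ , X₂ , e₁ , e₂ = cong₂ _·_ (subst-unused c M X₁ e₁) (subst-unused c N X₂ e₂)

-- By determinism the closed head steps of `M [ c ]` are those of M, as long as neither the hole nor
-- an abstraction has come to the head.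
follow : ∀ {X} c (M : Term 1) → X ≡ M [ c ] → HeadClosed* X K* →
  (∃ λ As → M ↠h apps (var zero) As) ⊎ (∃ λ E → M ↠h ƛ E × HeadClosed* (ƛ E [ c ]) K*)
follow c M e hs with headView M
follow c M e hs          | is-var zero As = inj₁ (As , ε)
follow c M refl hs       | is-lam E = inj₂ (E , ε , hs)
follow c M e done        | is-step s with () ← ≡.subst (_→h _) (≡.sym e) (→h-subst (single c) s)
follow c M refl (h ∷ hs) | is-step s with HeadClosed-det h (→h-subst (single c) s)
... | e' with follow c _ e' hs
... | inj₁ (As , r)      = inj₁ (As , s ◅ r)
... | inj₂ (E , r , hs') = inj₂ (E , s ◅ r , hs')

-- Otherwise D x becomes some λy. E. Closed head steps lead from λy. E[c] to K*, so y does not occur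
-- in E. Then D x ⌜m⌝ has the reduct E[⌜0⌝] for every m, and by confluence all the normal forms
-- coincide. The single one would contain every numeral, even one larger than itself.
D-head : ∀ D c → HeadClosed* (D · c) K* →
  (∀ m → NFBeginsWithContaining {1} (wk0 D · var zero · wk0 ⌜ m ⌝) zero ⌜ m ⌝) →
  ∃ λ As → wk0 D · var zero ↠h apps (var zero) As
D-head D c hs nfs with follow c (wk0 D · var zero) (cong (_· c) (≡.sym (subst-wk0-closed (single c) D))) hs
... | inj₁ r = r
... | inj₂ (E , (_ , r) , hs') = ⊥-elim (1+n≰n (≤-trans (≤-reflexive (≡.sym (size-iterF m)))
      (≡.subst (λ N → m ≤' size N) (same m) (Occurs-size (occ m)))))
  where
  _≤'_ : ℕ → ℕ → Set
  m ≤' n = size (iterF m) ≤ n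
  N : ℕ → Term 1
  N m = proj₁ (nfs m)
  m = suc (size (N 0))
  occ : ∀ m → Occurs ⌜ m ⌝ (N m)
  occ m = proj₂ (proj₂ (proj₂ (proj₂ (proj₂ (nfs m)))))
  image : ∃ λ Y → subst (exts (single c)) E ≡ wk0 Y
  image = HeadClosed*-image (HeadClosed*-ƛ hs') noVar I refl
  E-const : ∀ m → E [ wk0 ⌜ m ⌝ ] ≡ E [ wk0 ⌜ 0 ⌝ ]
  E-const m = subst-unused {ρ = noVar} {σ = exts (single c)}
    (λ { zero → inj₂ (zero , refl , λ ()) ; (suc i) → inj₁ refl }) E (proj₁ image) (proj₂ image)
  run : ∀ m → wk0 D · var zero · wk0 ⌜ m ⌝ ⇛* E [ wk0 ⌜ 0 ⌝ ]
  run m = ≡.subst (_ ⇛*_) (E-const m) (⟶⇒⇛* (proj₂ (↠h-apps (wk0 ⌜ m ⌝ ∷ []) (_ , r) ◅◅ (hβ _ _ ◅ ε))))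
  nf : ∀ m → E [ wk0 ⌜ 0 ⌝ ] ⇛* N m
  nf m = ⇛*-NF (run m) (↠βΩ⇒⇛* (proj₁ (proj₂ (proj₂ (nfs m))))) (proj₁ (proj₂ (proj₂ (proj₂ (nfs m)))))
  same : ∀ m → N m ≡ N 0
  same m = NF-⇛* (proj₁ (proj₂ (proj₂ (proj₂ (nfs 0))))) (⇛*-NF (nf 0) (nf m) (proj₁ (proj₂ (proj₂ (proj₂ (nfs m))))))

=β-app : ∀ {k} {M M' N N' : Term k} → M =β M' → N =β N' → M · N =β M' · N'
=β-app {M' = M'} {N = N} e f = trans (left e) (right f)
  where
  left : ∀ {M M'} → M =β M' → M · N =β M' · N
  left (step s)    = step (appL N s)
  left refl        = refl
  left (sym e)     = sym (left e)
  left (trans e f) = trans (left e) (left f)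
  right : ∀ {N N'} → N =β N' → M' · N =β M' · N'
  right (step s)    = step (appR M' s)
  right refl        = refl
  right (sym e)     = sym (right e)
  right (trans e f) = trans (right e) (right f)

-- Exact head runs of terms convertible to K* or to a numeral

Conv-↠h : ∀ {M N} → M ↠h N → Conv N → Conv M
Conv-↠h r = proj₂ (Convergent.↠h⇒≈ r [])

Conv-konst : ∀ n (Ns : List (Term 0)) → length Ns < n → Conv (apps (konst n Ω) Ns)
Conv-konst (suc n) [] _ = 0 , _ , []
Conv-konst (suc n) (N ∷ Ns) (s≤s lt) = Conv-↠h (↠h-apps Ns (konst-step n N)) (Conv-konst n Ns lt)
  where
  konst-step : ∀ n N → konst (suc n) Ω · N ↠h konst n Ω
  konst-step n N = konst-run n Ω (N ∷ [])

¬Conv-konst : ∀ n (Ns : List (Term 0)) → n ≤ length Ns → ¬ Conv (apps (konst n Ω) Ns)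
¬Conv-konst zero    Ns       _        = ¬Conv-Ω Ns
¬Conv-konst (suc n) (N ∷ Ns) (s≤s le) c = ¬Conv-konst n Ns le (proj₁ (Convergent.↠h⇒≈ (↠h-apps Ns (konst-run n Ω (N ∷ []))) []) c)

-- Run M x y with x and y free. Stopping with x at the head is refuted by x := Ω, at an abstraction
-- by y := Ω, and at y with arguments by y := λz. Ω. The run thus ends at y itself, not just at an
-- equivalent term.
K*-exact : ∀ {M} → M =β K* → ∀ P Q → M · P · Q ↠h Q
K*-exact {M} e P Q = analyse (inert σ MM (proj₂ (proj₂ conv)))
  where
  MM : Term 2
  MM = wk0 M · var zero · var (suc zero)
  env : Term 0 → Term 0 → Fin 2 → Term 0
  env A B = A • B • λ ()
  inst : ∀ A B → subst (env A B) MM ≡ M · A · B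
  inst A B = cong (λ L → L · A · B) (subst-wk0-closed (env A B) M)
  σ = env I I
  K*≈ : ∀ A B → M · A · B Convergent.≈ B
  K*≈ A B = Convergent.≈-trans (Convergent.·-cong (Convergent.·-cong (Convergent.=β⇒≈ e) Convergent.≈-refl) Convergent.≈-refl) (Convergent.↠h⇒≈ (happ B (hβ _ A) ◅ hβ _ B ◅ ε))
  conv : Conv (subst σ MM)
  conv = ≡.subst Conv (≡.sym (inst I I)) (proj₂ (K*≈ I I []) (0 , _ , []))
  at : ∀ {N} → MM ↠h N → ∀ A B → M · A · B ↠h subst (env A B) N
  at {N} r A B = ≡.subst (_↠h subst (env A B) N) (inst A B) (↠h-subst (env A B) r)
  analyse : (∃ λ N → MM ↠h N × ((∃ λ i → ∃ λ Ns → N ≡ apps (var i) Ns) ⊎ (∃ λ V → N ≡ ƛ V × subst σ (ƛ V) ≡ ƛ (proj₁ (proj₂ conv))))) →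
            M · P · Q ↠h Q
  analyse (_ , r , inj₁ (zero , Ns , refl)) = ⊥-elim (¬Conv-Ω (map (subst (env Ω I)) Ns)
    (≡.subst Conv (subst-apps (env Ω I) (var zero) Ns) (proj₁ (Convergent.↠h⇒≈ (at r Ω I) []) (proj₂ (K*≈ Ω I []) (0 , _ , [])))))
  analyse (_ , r , inj₁ (suc zero , [] , refl)) = at r P Q
  analyse (_ , r , inj₁ (suc zero , N ∷ Ns , refl)) = ⊥-elim (¬Conv-konst 1 (map (subst τ) (N ∷ Ns)) (s≤s z≤n)
    (≡.subst Conv (subst-apps τ (var (suc zero)) (N ∷ Ns)) (proj₁ (Convergent.↠h⇒≈ (at r I (konst 1 Ω)) []) (proj₂ (K*≈ I (konst 1 Ω) []) (0 , _ , [])))))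
    where τ = env I (konst 1 Ω)
  analyse (_ , r , inj₂ (V , refl , _)) = ⊥-elim (¬Conv-Ω [] (proj₁ (K*≈ I Ω []) (Conv-↠h (at r I Ω) (0 , _ , []))))

fΩ : Term 0
fΩ = ƛ (var zero · wk0 Ω)

iter : ℕ → Term 0 → Term 0
iter zero    Y = Y
iter (suc m) Y = fΩ · iter m Y

pad-snoc : ∀ m → pad m ++ Ω ∷ [] ≡ pad (suc m)
pad-snoc zero    = refl
pad-snoc (suc m) = cong (Ω ∷_) (pad-snoc m)

iter-run : ∀ m Y → iter m Y ↠h apps Y (pad m)
iter-run zero    Y = ε
iter-run (suc m) Y = hβ _ (iter m Y) ◅ ≡.subst (iter m Y · Ω ↠h_)
  (≡.trans (≡.sym (apps-++ Y (pad m) (Ω ∷ []))) (cong (apps Y) (pad-snoc m))) (↠h-apps (Ω ∷ []) (iter-run m Y))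

iterF-subst : ∀ (σ : Fin 2 → Term 0) Y → σ zero ≡ Y → σ (suc zero) ≡ fΩ → ∀ m → subst σ (iterF m) ≡ iter m Y
iterF-subst σ Y p q zero    = p
iterF-subst σ Y p q (suc m) = cong₂ _·_ q (iterF-subst σ Y p q m)

numeral-run : ∀ m Y → ⌜ m ⌝ · fΩ · Y ↠h apps Y (pad m)
numeral-run m Y = happ Y (hβ _ fΩ) ◅ hβ _ Y ◅
  ≡.subst (_↠h apps Y (pad m)) (≡.sym (≡.trans (exts-[] (single fΩ) (iterF m) Y) (iterF-subst (Y • single fΩ) Y refl refl m))) (iter-run m Y)

-- The same method with Y free. The terms Xs need not be Ω syntactically; only their number is
-- needed, and `konst l Ω` for suitable l bounds it from both sides.
numeral-exact : ∀ {N m} → N =β ⌜ m ⌝ → ∀ Y → ∃ λ Xs → length Xs ≡ m × N · fΩ · Y ↠h apps Y Xs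
numeral-exact {N} {m} e Y = analyse (inert (single (konst (suc m) Ω)) MM (proj₂ (proj₂ conv)))
  where
  MM : Term 1
  MM = wk0 N · wk0 fΩ · var zero
  inst : ∀ Z → MM [ Z ] ≡ N · fΩ · Z
  inst Z = cong (λ L → L · fΩ · Z) (subst-wk0-closed (single Z) N)
  N≈ : ∀ Z → N · fΩ · Z Convergent.≈ apps Z (pad m)
  N≈ Z = Convergent.≈-trans (Convergent.·-cong (Convergent.·-cong (Convergent.=β⇒≈ e) Convergent.≈-refl) Convergent.≈-refl) (Convergent.↠h⇒≈ (numeral-run m Z))
  conv : Conv (MM [ konst (suc m) Ω ])
  conv = ≡.subst Conv (≡.sym (inst _)) (proj₂ (N≈ _ []) (Conv-konst (suc m) (pad m) (s≤s (≡.subst (_≤ m) (≡.sym (length-replicate m)) ≤-refl))))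
  at : ∀ {M} → MM ↠h M → ∀ Z → N · fΩ · Z ↠h M [ Z ]
  at {M} r Z = ≡.subst (_↠h (M [ Z ])) (inst Z) (↠h-subst (single Z) r)
  analyse : (∃ λ M → MM ↠h M × ((∃ λ i → ∃ λ Ns → M ≡ apps (var i) Ns) ⊎ (∃ λ V → M ≡ ƛ V × subst (single (konst (suc m) Ω)) (ƛ V) ≡ ƛ (proj₁ (proj₂ conv))))) →
            ∃ λ Xs → length Xs ≡ m × N · fΩ · Y ↠h apps Y Xs
  analyse (_ , r , inj₂ (V , refl , _)) = ⊥-elim (¬Conv-Ω (pad m) (proj₁ (N≈ Ω []) (Conv-↠h (at r Ω) (0 , _ , []))))
  analyse (_ , r , inj₁ (zero , Ns , refl)) = map (_[ Y ]) Ns , ≡.trans (length-map _ Ns) (≤-antisym le ge) , run Y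
    where
    run : ∀ Z → N · fΩ · Z ↠h apps Z (map (_[ Z ]) Ns)
    run Z = ≡.subst (_ ↠h_) (subst-apps (single Z) (var zero) Ns) (at r Z)
    test : ∀ l → (Conv (apps (konst l Ω) (map (_[ konst l Ω ]) Ns)) → Conv (apps (konst l Ω) (pad m))) ×
                 (Conv (apps (konst l Ω) (pad m)) → Conv (apps (konst l Ω) (map (_[ konst l Ω ]) Ns)))
    test l = (λ c → proj₁ (N≈ _ []) (Conv-↠h (run _) c)) , (λ c → proj₁ (Convergent.↠h⇒≈ (run _) []) (proj₂ (N≈ _ []) c))
    le : length Ns ≤ m
    le with length Ns ≤? m
    ... | yes p = p
    ... | no ¬p = ⊥-elim (¬Conv-konst (suc m) (map (_[ konst (suc m) Ω ]) Ns) (≡.subst (suc m ≤_) (≡.sym (length-map _ Ns)) (≰⇒> ¬p))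
      (proj₂ (test (suc m)) (Conv-konst (suc m) (pad m) (s≤s (≡.subst (_≤ m) (≡.sym (length-replicate m)) ≤-refl)))))
    ge : m ≤ length Ns
    ge with m ≤? length Ns
    ... | yes p = p
    ... | no ¬p = ⊥-elim (¬Conv-konst l (pad m) (≡.subst (l ≤_) (≡.sym (length-replicate m)) (≰⇒> ¬p))
      (proj₁ (test l) (Conv-konst l (map (_[ konst l Ω ]) Ns) (s≤s (≡.subst (_≤ length Ns) (≡.sym (length-map _ Ns)) ≤-refl)))))
      where l = suc (length Ns)

-- Head reductions of pairs, Θ, F and G

rename-closed : ∀ {k} {ρ : Fin 0 → Fin k} X → rename ρ X ≡ wk0 X
rename-closed X = rename-cong (λ ()) X

≡wk0-rename : ∀ {k l X} {ρ : Fin k → Fin l} {M} → M ≡ wk0 X → rename ρ M ≡ wk0 X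
≡wk0-rename {X = X} {ρ} refl = rename-wk0 ρ X

≡wk0-subst : ∀ {k l X} {σ : Fin k → Term l} {M} → M ≡ wk0 X → subst σ M ≡ wk0 X
≡wk0-subst {X = X} {σ} refl = subst-wk0 σ X

≡wk0-close : ∀ {k X} {σ : Fin k → Term 0} {M} → M ≡ wk0 X → subst σ M ≡ X
≡wk0-close {X = X} {σ} refl = subst-wk0-closed σ X

infixl 7 _⊙_
_⊙_ : ∀ {k} {M M' N N' : Term k} → M ≡ M' → N ≡ N' → M · N ≡ M' · N'
p ⊙ q = cong₂ _·_ p q

hβ= : ∀ {k} {U : Term (suc k)} {N M} → U [ N ] ≡ M → ƛ U · N →h M
hβ= refl = hβ _ _

prod : Term 0 → Term 0 → Term 0
prod A B = ƛ (var zero · wk0 A · wk0 B)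

prod-run : ∀ A B Z → prod A B · Z →h Z · A · B
prod-run A B Z = ≡.subst (prod A B · Z →h_) (refl ⊙ ≡wk0-close refl ⊙ ≡wk0-close refl) (hβ _ Z)

Θ-run : ∀ X → Θ · X ↠h X · (Θ · X)
Θ-run X = happ X (hβ _ _) ◅ hβ _ X ◅ ε

K : Term 0
K = ƛ (ƛ (var (suc zero)))

K-run : ∀ A B → K · A →h ƛ (rename suc A) × ƛ (rename suc A) · B →h A
K-run A B = hβ _ A , ≡.subst (ƛ (rename suc A) · B →h_) ([]-rename-suc A B) (hβ _ B)

module Terms (star sc D : Term 0) where

  Gt : Term 0 → Term 0
  Gt V = ƛ (ƛ (ƛ (ƛ
        (var zero
          · (var (suc zero) · var (suc (suc zero)))
          · (var (suc (suc zero))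
               · ƛ (var zero · wk0 Ω)
               · wk0 V
               · (var (suc (suc (suc zero)))
                    · (wk0 sc · var (suc (suc zero)))
                    · var (suc zero)))))))

  Ht : Term 0 → Term 0 → Term 0
  Ht w S = ƛ (wk0 w · (wk0 star · wk0 S · var zero))

  Ht-run : ∀ w S N → Ht w S · N →h w · (star · S · N)
  Ht-run w S N = ≡.subst (Ht w S · N →h_) (≡wk0-close refl ⊙ (≡wk0-close refl ⊙ ≡wk0-close refl ⊙ refl)) (hβ _ N)

  Ft : ℕ → Term 0
  Ft = F star sc D

  Bt : ℕ → Term 0
  Bt = B star sc D

  F-run : ∀ e w → ∃ λ U₁ → Ft e · w →h ƛ U₁ × (∀ S → ∃ λ U₂ → ƛ U₁ · S →h ƛ U₂ ×
    (∀ V → ƛ U₂ · V →h D · S · ⌜ e ⌝ · Tθ · Tθ · Gt V · ⌜ 0 ⌝ · Ht w S))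
  F-run e w = _ , hβ _ w , λ S → _ , hβ _ S , λ V → hβ=
    (c3 D ⊙ S3 S ⊙ c3 ⌜ e ⌝ ⊙ refl ⊙ refl ⊙
      cong (λ A → ƛ (ƛ (ƛ (ƛ A)))) (refl ⊙ refl ⊙ (refl ⊙ refl ⊙ ≡wk0-rename (≡wk0-rename (≡wk0-rename (rename-closed V))) ⊙ (refl ⊙ (c3' sc ⊙ refl) ⊙ refl)))
      ⊙ refl ⊙ cong ƛ (≡wk0-subst (≡wk0-subst (≡wk0-rename (≡wk0-rename (rename-closed w)))) ⊙ (c3' star ⊙ ≡wk0-subst (≡wk0-rename (rename-closed S)) ⊙ refl)))
    where
    c3 : ∀ {k l n} {σ : Fin n → Term 0} {τ : Fin l → Term n} {υ : Fin k → Term l} X → subst σ (subst τ (subst υ (wk0 X))) ≡ X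
    c3 X = ≡wk0-close (≡wk0-subst (≡wk0-subst refl))
    c3' : ∀ {k l n m} {σ : Fin n → Term m} {τ : Fin l → Term n} {υ : Fin k → Term l} X → subst σ (subst τ (subst υ (wk0 X))) ≡ wk0 X
    c3' X = ≡wk0-subst (≡wk0-subst (≡wk0-subst refl))
    S3 : ∀ {σ : Fin 1 → Term 0} S → subst σ (rename suc S) ≡ S
    S3 S = ≡wk0-close (rename-closed S)

  G-run : ∀ V A X → ∃ λ U → Gt V · A · X ↠h ƛ U × (∀ q → ƛ U · q →h prod (q · X) (X · fΩ · V · (A · (sc · X) · q)))
  G-run V A X = _ , happ X (hβ _ A) ◅ hβ _ X ◅ ε , λ q → hβ=
    (cong ƛ (refl ⊙ (rename-closed q ⊙ X2 X) ⊙ (X2 X ⊙ refl ⊙ ≡wk0-subst (≡wk0-subst (≡wk0-subst refl)) ⊙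
      (≡wk0-subst (≡wk0-subst (≡wk0-rename (≡wk0-rename (rename-closed A)))) ⊙ (≡wk0-subst (≡wk0-subst (≡wk0-subst refl)) ⊙ X2 X) ⊙ rename-closed q))))
    where
    X2 : ∀ {l} {σ : Fin 2 → Term l} X → subst σ (rename suc (rename suc X)) ≡ wk0 X
    X2 X = ≡wk0-subst (≡wk0-rename (rename-closed X))

-- Head runs all of whose terms, except the last, satisfy P.
data Run (P : Term 0 → Set) : ℕ → Term 0 → Term 0 → Set where
  []   : ∀ {M} → Run P 0 M M
  step : ∀ {M N Z t} → P M → M →h N → Run P t N Z → Run P (suc t) M Z

RunP : (Term 0 → Set) → Term 0 → Term 0 → Set
RunP P M N = ∃ λ t → Run P t M N

module _ {P : Term 0 → Set} where

  infixr 5 _◂_ _◂◂_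
  _◂_ : ∀ {M N Z} → P M × M →h N → RunP P N Z → RunP P M Z
  (p , s) ◂ (t , r) = suc t , step p s r

  _◂◂_ : ∀ {M N Z} → RunP P M N → RunP P N Z → RunP P M Z
  (_ , [])         ◂◂ r' = r'
  (_ , step p s r) ◂◂ r' = (p , s) ◂ ((_ , r) ◂◂ r')

  run-under : ∀ {Y Y'} y R → (∀ Y → P (apps (Y · y) R)) → Y ↠h Y' → RunP P (apps (Y · y) R) (apps (Y' · y) R)
  run-under y R ok (_ , [])    = 0 , []
  run-under y R ok (_ , s ∷ r) = (ok _ , →h-apps R (happ y s)) ◂ run-under y R ok (_ , r)

  Run⇒⟶ : ∀ {t M N} → Run P t M N → M ⟶[ t ] N
  Run⇒⟶ []           = []
  Run⇒⟶ (step p s r) = s ∷ Run⇒⟶ r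

  RunP⇒↠h : ∀ {M N} → RunP P M N → M ↠h N
  RunP⇒↠h (t , r) = t , Run⇒⟶ r

▹*-++ : ∀ {k} (A : Term k) Ns Ps → (A ▹* Ns) ▹* Ps ≡ A ▹* (Ns ++ Ps)
▹*-++ A []       Ps = refl
▹*-++ A (N ∷ Ns) Ps = ▹*-++ (A ▹ N) Ns Ps

-- The block of arguments and the run that it drives

module Blocks (star sc D : Term 0) (a : ℕ) where
  open Terms star sc D public

  -- In `Qt N q` with N = ⌜m⌝ and m ≤ a, V receives m arguments and the tail. Two more places keep
  -- `Qt N q · Ω · Ω` solvable even for m = a.
  V : Term 0
  V = perm (a + 3)

  -- When m + suc j = a, the m arguments from the numeral, the tail, j + 2 pads and a last Ω fill V
  -- exactly. V passes I and all of them to `sel m j`, which returns the tail.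
  sel : ℕ → ℕ → Term 0
  sel m j = konst (suc m) (ƛ (konst (length (pad (j + 2)) + 1) (var zero)))

  -- m is the index of the current pair and j the number of tails still to be taken: K* selects the
  -- tail, the padding and `sel` free it from V, and the final K selects component a.
  ext* : ℕ → ℕ → List (Term 0)
  ext* m zero    = K ∷ []
  ext* m (suc j) = K* ∷ pad (j + 2) ++ Ω ∷ sel m j ∷ ext* (suc m) j

  block : List (Term 0)
  block = V ∷ ext* 0 a

  Pt Qt : Term 0 → Term 0 → Term 0
  Pt N q = Θ · Gt V · N · q
  Qt N q = N · fΩ · V · Pt (sc · N) q

  P-run : ∀ N → ∃ λ U → Θ · Gt V · N ↠h ƛ U × (∀ q → ƛ U · q →h prod (q · N) (Qt N q))
  P-run N with G-run V (Θ · Gt V) N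
  ... | U , r , f = U , ↠h-apps (N ∷ []) (Θ-run (Gt V)) ◅◅ r , f

  -- One computation for two purposes. With P trivial it is a plain head run; with P the property of
  -- not being a state it shows that a block of the run of B_1 s avoids states. The hypotheses
  -- `ok...` list the kinds of intermediate terms, `At x R` standing for: x was consumed last and R
  -- remains.
  module Extract (isSucc : IsSucc sc) (P : Term 0 → Set) (At : Term 0 → List (Term 0) → Set) (q : Term 0)
    (pop  : ∀ {x y R} → At x (y ∷ R) → At y R)
    (okλ  : ∀ {x R} U → At x R → P (apps (ƛ U) R))
    (okqV : ∀ {R} Y → At V R → P (apps (Y · q) R))
    (okqs : ∀ {R m j} Y → At (sel m j) R → P (apps (Y · q) R))
    (okΩ  : ∀ {R m j} Y → At (sel m j) R → P (apps (Y · Ω) R))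
    (okp  : ∀ {R m N} Y → N =β ⌜ m ⌝ → At K* R → P (apps (Y · Pt N q) R))
    (okQ  : ∀ {x R m N} Y → x ≡ K* ⊎ x ≡ K → N =β ⌜ m ⌝ → m ≤ a → At x R → P (apps (Y · Qt N q) R))
    where

    sc-numeral : ∀ {N m} → N =β ⌜ m ⌝ → sc · N =β ⌜ suc m ⌝
    sc-numeral {m = m} e = trans (=β-app refl e) (isSucc m)

    collect : ∀ n n' A x R → At x (pad n ++ R) → RunP P (apps (tup (n + n') A) (pad n ++ R)) (apps (tup n' (A ▹* pad n)) R)
    collect zero    n' A x R at = 0 , []
    collect (suc n) n' A x R at = (okλ _ at , →h-apps (pad n ++ R) (tup-step (n + n') A Ω)) ◂ collect n n' (A ▹ Ω) Ω R (pop at)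

    At-pad : ∀ n {x y R} → At x (pad n ++ y ∷ R) → At y R
    At-pad zero    at = pop at
    At-pad (suc n) at = At-pad n (pop at)

    pair : ∀ N {R} → (∀ Y → P (apps (Y · q) R)) → RunP P (apps (Pt N q) R) (apps (prod (q · N) (Qt N q)) R)
    pair N {R} ok with P-run N
    ... | U , r , f = run-under q R ok r ◂◂ ((ok _ , →h-apps R (f q)) ◂ (0 , []))

    At-tail : ∀ n {x R} → At x (pad n ++ R) → ∃ λ y → At y R
    At-tail zero    at = _ , at
    At-tail (suc n) at = At-tail n (pop at)

    choose : ∀ {x R} A Q → (∀ Y → P (apps (Y · Q) R)) → At x (K* ∷ R) → RunP P (apps (prod A Q) (K* ∷ R)) (apps Q R)
    choose {R = R} A Q ok at = (okλ _ at , →h-apps R (prod-run A Q K*)) ◂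
      (ok (K* · A) , →h-apps R (happ Q (hβ (ƛ (var zero)) A))) ◂ (ok I , →h-apps R (hβ (var zero) Q)) ◂ (0 , [])

    absorb : ∀ {R} Y n A p → (∀ Y → P (apps (Y · p) R)) → Y ↠h tup (suc n) A → RunP P (apps (Y · p) R) (apps (tup n (A ▹ p)) R)
    absorb {R} Y n A p ok r = run-under p R ok r ◂◂ ((ok (tup (suc n) A) , →h-apps R (tup-step n A p)) ◂ (0 , []))

    sel-run : ∀ Xs p m j → length Xs ≡ m → (((permK ▹* Xs) ▹ p) ▹* pad (j + 2)) · sel m j ↠h konst 1 p
    sel-run Xs p m j len = ≡.subst (λ A → A · sel m j ↠h konst 1 p) (≡.sym (▹*-++ permK Xs (p ∷ pad d)))
        (▹*-run permK (Xs ++ p ∷ pad d) (sel m j) ◅◅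
        (↠h-apps (Xs ++ p ∷ pad d) (hβ (var zero · ƛ (var zero)) (sel m j) ◅ ε) ◅◅
        ≡.subst (_↠h konst 1 p) (≡.sym (apps-++ (sel m j · I) Xs (p ∷ pad d)))
          (↠h-apps (p ∷ pad d) (konst-full (ƛ (konst (length (pad d) + 1) (var zero))) (suc m) (I ∷ Xs) (cong suc len)) ◅◅ take-run 1 p (pad d))))
      where d = j + 2

    -- The last Ω is kept apart from the pads: it stays outside while A · Z runs, so one test of
    -- this Ω against Z covers all terms in between.
    select-run : ∀ {x R} A p Z → At x (Ω ∷ Z ∷ R) → (∀ Y → P (apps (Y · Ω) R)) → A · Z ↠h konst 1 p →
                 RunP P (apps (tup 1 A) (Ω ∷ Z ∷ R)) (apps p R)
    select-run {R = R} A p Z at ok r = (okλ _ at , →h-apps (Z ∷ R) (tup-step 0 A Ω)) ◂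
      (okλ _ (pop at) , →h-apps R (▹-run A Ω Z)) ◂
      (run-under Ω R ok r ◂◂ ((ok (konst 1 p) , →h-apps R (proj₂ (K-run p Ω))) ◂ (0 , [])))

    arity : ∀ {m j l} → l ≡ m → m + suc j ≡ a → l + suc ((j + 2) + 1) ≡ a + 3
    arity {m} {j} refl eq = ≡.trans (cong (λ n → m + suc n) (+-assoc j 2 1)) (≡.trans (≡.sym (+-assoc m (suc j) 3)) (cong (_+ 3) eq))

    project : ∀ m j N x R → m + suc j ≡ a → N =β ⌜ m ⌝ → At x (K* ∷ pad (j + 2) ++ Ω ∷ sel m j ∷ R) →
      RunP P (apps (prod (q · N) (Qt N q)) (K* ∷ pad (j + 2) ++ Ω ∷ sel m j ∷ R)) (apps (Pt (sc · N) q) R)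
    project m j N x R eq e at =
      choose (q · N) (Qt N q) (λ Y → okQ Y (inj₁ refl) e (≡.subst (m ≤_) eq (m≤m+n m (suc j))) at₁) at ◂◂
      (absorb {pad (j + 2) ++ Ω ∷ sel m j ∷ R} (N · fΩ · V) (j + 2 + 1) (permK ▹* Xs) (Pt (sc · N) q) (λ Y → okp Y (sc-numeral e) at₁)
        (r ◅◅ ≡.subst (λ n → apps (tup n permK) Xs ↠h tup (suc (j + 2 + 1)) (permK ▹* Xs)) (arity len eq) (tup-run (suc (j + 2 + 1)) permK Xs)) ◂◂
      (collect (j + 2) 1 ((permK ▹* Xs) ▹ Pt (sc · N) q) K* (Ω ∷ sel m j ∷ R) at₁ ◂◂
      select-run (((permK ▹* Xs) ▹ Pt (sc · N) q) ▹* pad (j + 2)) (Pt (sc · N) q) (sel m j)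
        (proj₂ (At-tail (j + 2) at₁)) (λ Y → okΩ {m = m} {j} Y (pop (At-pad (j + 2) at₁))) (sel-run Xs (Pt (sc · N) q) m j len)))
      where
      exact = numeral-exact e V
      Xs = proj₁ exact
      len = proj₁ (proj₂ exact)
      r = proj₂ (proj₂ exact)
      at₁ : At K* (pad (j + 2) ++ Ω ∷ sel m j ∷ R)
      at₁ = pop at

    extract : ∀ j m N x τ → m + j ≡ a → N =β ⌜ m ⌝ → At x (ext* m j ++ τ) →
      ∃ λ N' → N' =β ⌜ a ⌝ × RunP P (apps (prod (q · N) (Qt N q)) (ext* m j ++ τ)) (apps (q · N') τ)
    extract zero m N x τ eq e at = N , ≡.subst (λ n → N =β ⌜ n ⌝) m≡a e ,
      (okλ _ at , →h-apps τ (prod-run _ _ K)) ◂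
      (ok _ , →h-apps τ (happ _ (proj₁ (K-run (q · N) (Qt N q))))) ◂
      (ok _ , →h-apps τ (proj₂ (K-run (q · N) (Qt N q)))) ◂ (0 , [])
      where
      m≡a : m ≡ a
      m≡a = ≡.trans (≡.sym (+-identityʳ m)) eq
      ok : ∀ Y → P (apps (Y · Qt N q) τ)
      ok Y = okQ Y (inj₂ refl) e (≡.subst (m ≤_) m≡a ≤-refl) (pop at)
    extract (suc j) m N x τ eq e at = N' , e' ,
      ≡.subst (λ R → RunP P (apps (prod (q · N) (Qt N q)) R) (apps (q · N') τ)) (cong (K* ∷_) (≡.sym (++-assoc (pad (j + 2)) _ τ)))
        (project m j N x (ext* (suc m) j ++ τ) eq e at' ◂◂ (pair (sc · N) {ext* (suc m) j ++ τ} (λ Y → okqs {m = m} {j} Y at₄) ◂◂ r))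
      where
      at' : At x (K* ∷ pad (j + 2) ++ Ω ∷ sel m j ∷ ext* (suc m) j ++ τ)
      at' = ≡.subst (At x) (cong (K* ∷_) (++-assoc (pad (j + 2)) _ τ)) at
      at₄ : At (sel m j) (ext* (suc m) j ++ τ)
      at₄ = pop (At-pad (j + 2) (pop at'))
      rec = extract j (suc m) (sc · N) (sel m j) τ (≡.trans (≡.sym (+-suc m j)) eq) (sc-numeral e) at₄
      N' = proj₁ rec
      e' = proj₁ (proj₂ rec)
      r = proj₂ (proj₂ rec)

    body-run : ∀ e S τ → D · S =β K* → At V (ext* 0 a ++ τ) →
      ∃ λ N' → N' =β ⌜ a ⌝ × RunP P (apps (D · S · ⌜ e ⌝ · Tθ · Tθ · Gt V · ⌜ 0 ⌝ · q) (ext* 0 a ++ τ)) (apps (q · N') τ)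
    body-run e S τ dS at = proj₁ rec , proj₁ (proj₂ rec) ,
      (run-under q R ok (↠h-apps (Tθ ∷ Gt V ∷ ⌜ 0 ⌝ ∷ []) (K*-exact dS ⌜ e ⌝ Tθ)) ◂◂ (pair ⌜ 0 ⌝ {R} ok ◂◂ proj₂ (proj₂ rec)))
      where
      R = ext* 0 a ++ τ
      rec = extract a 0 ⌜ 0 ⌝ V τ refl refl at
      ok : ∀ Y → P (apps (Y · q) R)
      ok Y = okqV Y at

-- Tests that tell the arguments of the run from those of the stream

≅*-length : ∀ {Ps Qs} → Ps ≅* Qs → length Ps ≡ length Qs
≅*-length []       = refl
≅*-length (_ ∷ es) = cong suc (≅*-length es)

≅*-drop : ∀ As Bs {Ps Qs} → length As ≡ length Bs → (As ++ Ps) ≅* (Bs ++ Qs) → Ps ≅* Qs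
≅*-drop []       []       _ es       = es
≅*-drop (A ∷ As) (B ∷ Bs) l (_ ∷ es) = ≅*-drop As Bs (suc-injective l) es

≅*-suffix : ∀ As Bs Ps Qs → length Ps ≡ length Qs → (As ++ Ps) ≅* (Bs ++ Qs) → Ps ≅* Qs
≅*-suffix As Bs Ps Qs l es = ≅*-drop As Bs
  (+-cancelʳ-≡ (length Ps) (length As) (length Bs)
    (≡.trans (≡.sym (length-++ As)) (≡.trans (≅*-length es) (≡.trans (length-++ Bs) (cong (length Bs +_) (≡.sym l))))))
  es

≅*-head : ∀ {P Q Ps Qs} → (P ∷ Ps) ≅* (Q ∷ Qs) → P ≅ Q
≅*-head (e ∷ _) = e

Solv-arg : ∀ {M} → Solv M → ∃ λ v → Solv (M · v)
Solv-arg (v ∷ Ns , t , r) = v , Ns , t , r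
Solv-arg ([] , t , r)     = I , Solv-↠I (↠h-apps (I ∷ []) (t , r) ◅◅ (hβ _ I ◅ ε))

¬Solv-↠h : ∀ {M N} → M ↠h N → ¬ Solv N → ¬ Solv M
¬Solv-↠h r u o = u (Solv-≅ (↠h⇒≅ r) o)

Solv-run : ∀ {M N} → M ↠h N → Solv N → Solv M
Solv-run r o = Solv-≅ (≅-sym (↠h⇒≅ r)) o

-- Both tests are invariant under ≅. `Strict` accepts `q e`, `Pt N c`, Ω and K but rejects V,
-- `sel m j` and K*. `Twofold` accepts `Qt N c` for N up to ⌜a⌝ but rejects K and all numerals, of
-- which K* is the zeroth.
Strict Twofold : Term 0 → Set
Strict M  = ¬ Solv (M · Ω)
Twofold M = Solv (M · Ω · Ω)

Strict-Ω : Strict Ω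
Strict-Ω = ¬Solv-apps ¬Solv-Ω (Ω ∷ [])

Strict-K : Strict K
Strict-K o with Solv-arg o
... | v , o' = ¬Solv-↠h (happ v (hβ _ Ω) ◅ hβ _ v ◅ ε) ¬Solv-Ω o'

¬Strict-K* : ¬ Strict K*
¬Strict-K* s = s (Solv-run (hβ _ Ω ◅ ε) Solv-I)

¬Twofold-K : ¬ Twofold K
¬Twofold-K = ¬Solv-↠h (happ Ω (hβ _ Ω) ◅ hβ _ Ω ◅ ε) ¬Solv-Ω

¬Twofold-numeral : ∀ n → ¬ Twofold ⌜ n ⌝
¬Twofold-numeral zero    = ¬Solv-↠h (happ Ω (hβ _ Ω) ◅ hβ _ Ω ◅ ε) ¬Solv-Ω
¬Twofold-numeral (suc n) = ¬Solv-↠h (happ Ω (hβ _ Ω) ◅ hβ _ Ω ◅ ε) (¬Solv-apps ¬Solv-Ω (_ ∷ []))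

Twofold-≅ : ∀ {M N} → M ≅ N → Twofold M → Twofold N
Twofold-≅ e = proj₁ (e (Ω ∷ Ω ∷ []))

Strict-≅ : ∀ {M N} → M ≅ N → Strict M → Strict N
Strict-≅ e s o = s (proj₂ (e (Ω ∷ [])) o)

K≇numeral : ∀ n → ¬ (K ≅ ⌜ n ⌝)
K≇numeral n e = ¬iter n (Solv-≅ (↠h⇒≅ run) (proj₁ (e (I ∷ Ω ∷ [])) (Solv-run (happ Ω (hβ _ I) ◅ hβ _ Ω ◅ ε) Solv-I)))
  where
  iterI : ℕ → Term 0
  iterI zero    = Ω
  iterI (suc n) = I · iterI n
  ¬iter : ∀ n → ¬ Solv (iterI n)
  ¬iter zero    = ¬Solv-Ω
  ¬iter (suc n) = ¬Solv-↠h (hβ _ _ ◅ ε) (¬iter n)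
  iterF-I : ∀ (σ : Fin 2 → Term 0) → σ zero ≡ Ω → σ (suc zero) ≡ I → ∀ n → subst σ (iterF n) ≡ iterI n
  iterF-I σ p q zero    = p
  iterF-I σ p q (suc n) = cong₂ _·_ q (iterF-I σ p q n)
  run : ⌜ n ⌝ · I · Ω ↠h iterI n
  run = ≡.subst (⌜ n ⌝ · I · Ω ↠h_) (≡.trans (exts-[] (single I) (iterF n) Ω) (iterF-I (Ω • single I) refl refl n))
    (happ Ω (hβ _ I) ◅ hβ _ Ω ◅ ε)

1≇0 : ¬ (⌜ 1 ⌝ ≅ ⌜ 0 ⌝)
1≇0 e = ¬Solv-apps ¬Solv-Ω (I ∷ []) (Solv-≅ (↠h⇒≅ (happ I (hβ _ Ω) ◅ hβ _ I ◅ ε))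
  (proj₂ (e (Ω ∷ I ∷ [])) (Solv-run (happ I (hβ _ Ω) ◅ hβ _ I ◅ ε) Solv-I)))

Strict-prod : ∀ A B → Strict (prod A B)
Strict-prod A B = ¬Solv-↠h (prod-run A B Ω ◅ ε) (¬Solv-apps ¬Solv-Ω (A ∷ B ∷ []))

-- The periodic stream of arguments

module Stream (b : Term 0) (bs : List (Term 0)) where

  period : List (Term 0)
  period = b ∷ bs

  rot : List (Term 0) → List (Term 0)
  rot (x ∷ y ∷ l) = y ∷ l
  rot _           = period

  rest : ℕ → List (Term 0)
  rest zero    = period
  rest (suc p) = rot (rest p)

  w : ℕ → Term 0
  w p with rest p
  -- Never reached: a remainder of the period is not empty.
  ... | []    = b
  ... | x ∷ _ = x

  w-rest : ∀ p {x l} → rest p ≡ x ∷ l → w p ≡ x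
  w-rest p e with rest p
  w-rest p refl | _ = refl

  str : ℕ → ℕ → List (Term 0)
  str p zero    = []
  str p (suc k) = w p ∷ str (suc p) k

  Start : ℕ → Set
  Start p = rest p ≡ period

  length-str : ∀ p k → length (str p k) ≡ k
  length-str p zero    = refl
  length-str p (suc k) = cong suc (length-str (suc p) k)

  str-++ : ∀ p k k' → str p (k + k') ≡ str p k ++ str (p + k) k'
  str-++ p zero    k' = cong (λ n → str n k') (≡.sym (+-identityʳ p))
  str-++ p (suc k) k' = cong (w p ∷_) (≡.trans (str-++ (suc p) k k') (cong (λ n → str (suc p) k ++ str n k') (≡.sym (+-suc p k))))

  str-rest : ∀ l p x → rest p ≡ x ∷ l → str p (suc (length l)) ≡ x ∷ l × Start (p + suc (length l))
  str-rest []      p x e = cong (_∷ []) (w-rest p e) , ≡.trans (cong rest (+-comm p 1)) (cong rot e)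
  str-rest (y ∷ l) p x e with str-rest l (suc p) y (cong rot e)
  ... | e₁ , e₂ = cong₂ _∷_ (w-rest p e) e₁ , ≡.trans (cong rest (+-suc p (suc (length l)))) e₂

  str-block : ∀ {p} → Start p → str p (length period) ≡ period × Start (p + length period)
  str-block {p} s = str-rest bs p b s

  rest-suffix : ∀ p → ∃ λ pre → ∃ λ x → ∃ λ l → rest p ≡ x ∷ l × pre ++ x ∷ l ≡ period
  rest-suffix zero    = [] , b , bs , refl , refl
  rest-suffix (suc p) with rest-suffix p
  ... | pre , x , []    , e , e' = [] , b , bs , cong rot e , refl
  ... | pre , x , y ∷ l , e , e' = pre ++ x ∷ [] , y , l , cong rot e , ≡.trans (++-assoc pre (x ∷ []) (y ∷ l)) e'

  before-start : ∀ {z pre'} → period ≡ pre' ++ z ∷ [] → ∀ p → Start (suc p) → w p ≡ z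
  before-start {z} {pre'} last p s with rest-suffix p
  ... | pre , x , []    , e , e' = ≡.trans (w-rest p e) (∷ʳ-injectiveʳ pre pre' (≡.trans e' last))
  -- Here the next remainder y ∷ l is a proper suffix of the period, hence too short to be the whole
  -- of it.
  ... | pre , x , y ∷ l , e , e' = ⊥-elim (1+n≰n (≤-trans (m≤n+m (suc (length period)) (length pre)) (≤-reflexive len)))
    where
    len : length pre + suc (length period) ≡ length period
    len = ≡.trans (cong (λ l → length pre + suc (length l)) (≡.trans (≡.sym s) (cong rot e)))
            (≡.trans (≡.sym (length-++ pre)) (cong length e'))

split-tabulate : ∀ {A : Set} j (l : List A) → j ≤ length l → ∃ λ (u : Fin j → A) → ∃ λ tl → l ≡ tabulate u ++ tl
split-tabulate zero    l       _ = (λ ()) , l , refl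
split-tabulate (suc j) (x ∷ l) (s≤s le) with split-tabulate j l le
... | u , tl , e = (λ { zero → x ; (suc i) → u i }) , tl , cong (x ∷_) e

split-≅* : ∀ As {B Bs} Ps → Ps ≅* (As ++ B ∷ Bs) → ∃ λ P₁ → ∃ λ x → ∃ λ P₂ → Ps ≡ P₁ ++ x ∷ P₂ × P₁ ≅* As × x ≅ B × P₂ ≅* Bs
split-≅* []       (P ∷ Ps) (e ∷ es) = [] , P , Ps , refl , [] , e , es
split-≅* (A ∷ As) (P ∷ Ps) (e ∷ es) with split-≅* As Ps es
... | P₁ , x , P₂ , eq , e₁ , e₂ , e₃ = P ∷ P₁ , x , P₂ , cong (P ∷_) eq , e ∷ e₁ , e₂ , e₃

↠h-suc : ∀ {k} {M N : Term k} {i} → headVar M ≡ nothing → headVar N ≡ just i → M ↠h N → ∃ λ t → M ⟶[ suc t ] N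
↠h-suc p q (zero  , [])    with () ← ≡.trans (≡.sym p) q
↠h-suc p q (suc t , r) = t , r

headVar-rename : ∀ {k l} (ρ : Fin k → Fin l) M → headVar M ≡ nothing → headVar (rename ρ M) ≡ nothing
headVar-rename ρ (ƛ M)   e = refl
headVar-rename ρ (M · N) e = headVar-rename ρ M e

-- A head other than a variable forces at least one step; this strict progress is what `Good-reduce`
-- lives on.
HeadRun-suc : ∀ M {j} Ys → headVar M ≡ nothing → HeadRun M j Ys → ∀ c u →
  ∃ λ t → apps (M [ c ]) (tabulate u) ⟶[ suc t ] apps c (map (subst (c • u)) Ys)
HeadRun-suc M {j} Ys e r c u with ↠h-suc (≡.trans (headVar-apps (spread M) (vars j)) (headVar-rename (λ _ → zero) M e)) (headVar-apps (var zero) Ys) r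
... | t , r' = t , ≡.subst₂ (_⟶[ suc t ]_) (spread-apps c u M) (subst-apps (c • u) (var zero) Ys) (⟶-subst (c • u) r')

⟶-◅◅ : ∀ {t} {M N P : Term 0} → M ⟶[ suc t ] N → N ↠h P → ∃ λ t' → M ⟶[ suc t' ] P
⟶-◅◅ (s ∷ r) r' with (_ , r) ◅◅ r'
... | t , r'' = t , s ∷ r''

SPar-apps : ∀ {R} M Ns {Z} → SPar R (apps M Ns) Z → ∃ λ M' → ∃ λ Ns' → Z ≡ apps M' Ns' × SPar R M M' × Pars R Ns Ns'
SPar-apps M []       p = _ , [] , refl , p , []
SPar-apps M (N ∷ Ns) p with SPar-apps (M · N) Ns p
... | _ , Ns' , refl , (p' · r) , ps = _ , _ ∷ Ns' , refl , p' , r ∷ ps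

Par-map : ∀ {R R' : Term 0 → Term 0 → Set} → (∀ {P Q} → R P Q → R' P Q) → ∀ {k} {M N : Term k} → Par R M N → Par R' M N
Par-map f (root r) = root (f r)
Par-map f (var i)  = var i
Par-map f (ƛ p)    = ƛ (Par-map f p)
Par-map f (p · r)  = Par-map f p · Par-map f r

apps-injective : ∀ {k} {M M' : Term k} Ns Ns' → length Ns ≡ length Ns' → apps M Ns ≡ apps M' Ns' → M ≡ M' × Ns ≡ Ns'
apps-injective []       []         l e = e , refl
apps-injective (N ∷ Ns) (N' ∷ Ns') l e with apps-injective Ns Ns' (suc-injective l) e
... | refl , refl = refl , refl

·-injectiveʳ : ∀ {k} {M M' N N' : Term k} → M · N ≡ M' · N' → N ≡ N'
·-injectiveʳ refl = refl

Run-visits : ∀ {P t t' X Y Z} → Run P t' X Y → X ⟶[ t ] Z → t < t' → P Z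
Run-visits (step p s r) []       _        = p
Run-visits (step p s r) (s' ∷ r') (s≤s lt) with refl ← →h-det s s' = Run-visits r r' lt

-- States, good terms, and the separation of B_0 s from B_1 s

module Separation (star sc D : Term 0) (a s : ℕ) (isSucc : IsSucc sc)
  (As : List (Term 1)) (D-run : wk0 D · var zero ↠h apps (var zero) As)
  (D=K* : D · ⌜ s ⌝ =β K*) (star-a : star · ⌜ s ⌝ · ⌜ a ⌝ =β ⌜ s ⌝)
  (Cs : List (Term 1)) (star-head : ∀ z → star · ⌜ s ⌝ · z ≅ apps z (map (_[ z ]) Cs)) where

  sN : Term 0
  sN = ⌜ s ⌝

  open Blocks star sc D a public

  q : ℕ → Term 0
  q e = Ht (Bt e) sN

  D≅ : ∀ x → D · x ≅ apps x (map (_[ x ]) As)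
  D≅ x = ≅-trans (≅-reflexive (cong (_· x) (≡.sym ([]-wk0 x D))))
    (≅-trans (↠h⇒≅ (↠h-subst (single x) D-run)) (≅-reflexive (apps-[] x (var zero) As)))

  Ht-cong : ∀ w {S S'} → S ≅ S' → Ht w S ≅ Ht w S'
  Ht-cong w e = Par⇒≅ (ƛ (Par-refl _ · (Par-refl _ · root e · var zero)))

  B-unfold : ∀ e S v → Bt e · S · v ≅ D · S · ⌜ e ⌝ · Tθ · Tθ · Gt v · ⌜ 0 ⌝ · Ht (Bt e) S
  B-unfold e S v with F-run e (Bt e)
  ... | U₁ , s₁ , f with f S
  ... | U₂ , s₂ , g = ↠h⇒≅ (↠h-apps (S ∷ v ∷ []) (Θ-run (Ft e)) ◅◅ (happ v (happ S s₁) ◅ happ v s₂ ◅ g v ◅ ε))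

  body-≅ : ∀ S e c → D · S =β K* → apps (D · S · ⌜ e ⌝ · Tθ · Tθ · Gt V · ⌜ 0 ⌝ · c) (ext* 0 a) ≅ c · ⌜ a ⌝
  body-≅ S e c dS = ≅-trans (≅-reflexive (cong (apps _) (≡.sym (++-identityʳ (ext* 0 a)))))
    (≅-trans (↠h⇒≅ (RunP⇒↠h (proj₂ (proj₂ run)))) (·-cong ≅-refl (=β⇒≅ (proj₁ (proj₂ run)))))
    where
    open Extract isSucc (λ _ → ⊤) (λ _ _ → ⊤) c (λ _ → tt) (λ _ _ → tt) (λ _ _ → tt) (λ _ _ → tt) (λ _ _ → tt) (λ _ _ _ → tt) (λ _ _ _ _ _ → tt)
    run = body-run e S [] dS tt

  q-a : ∀ e → q e · ⌜ a ⌝ ≅ Bt e · sN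
  q-a e = ≅-trans (→h⇒≅ (Ht-run (Bt e) sN ⌜ a ⌝)) (·-cong ≅-refl (=β⇒≅ star-a))

  B-block : ∀ e → apps (Bt e · sN) block ≅ q e · ⌜ a ⌝
  B-block e = ≅-trans (apps-cong (B-unfold e sN V) (≅*-refl (ext* 0 a))) (body-≅ sN e (q e) D=K*)

  X : Term 1
  X = wk0 star · wk0 sN · var zero

  X-[] : ∀ z → X [ z ] ≡ star · sN · z
  X-[] z = ≡wk0-close refl ⊙ ≡wk0-close refl ⊙ refl

  -- The arguments of z in the head form of D (s * z) before the label: those that s * z gives to z,
  -- then those that D x gives to x, taken at x := s * z.
  Pre : List (Term 1)
  Pre = Cs ++ map (λ A → subst (λ _ → X) A) As

  six : ℕ → Term 0 → Term 1 → List (Term 1)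
  six e v c = wk0 ⌜ e ⌝ ∷ wk0 Tθ ∷ wk0 Tθ ∷ wk0 (Gt v) ∷ wk0 ⌜ 0 ⌝ ∷ c ∷ []

  six0 : ℕ → Term 0 → Term 0 → List (Term 0)
  six0 e v c = ⌜ e ⌝ ∷ Tθ ∷ Tθ ∷ Gt v ∷ ⌜ 0 ⌝ ∷ c ∷ []

  six-[] : ∀ e v c z → map (_[ z ]) (six e v c) ≡ six0 e v (c [ z ])
  six-[] e v c z = cong₂ _∷_ ([]-wk0 z ⌜ e ⌝) (cong (Tθ ∷_) (cong (Tθ ∷_) (cong₂ _∷_ ([]-wk0 z (Gt v)) refl)))

  Ho : ℕ → Term 1
  Ho e = ƛ (wk0 (Bt e) · (wk0 star · (wk0 star · wk0 sN · var (suc zero)) · var zero))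

  Ho-[] : ∀ e z → Ho e [ z ] ≡ Ht (Bt e) (star · sN · z)
  Ho-[] e z = cong ƛ (≡wk0-subst refl ⊙ (≡wk0-subst refl ⊙ (≡wk0-subst refl ⊙ ≡wk0-subst refl ⊙ rename-closed z) ⊙ refl))

  Pre-[] : ∀ z → map (_[ z ]) Pre ≡ map (_[ z ]) Cs ++ map (_[ star · sN · z ]) As
  Pre-[] z = ≡.trans (map-++ _ Cs _) (cong (map (_[ z ]) Cs ++_)
    (≡.trans (≡.sym (map-∘ As)) (map-cong (λ A → ≡.trans (subst-subst (single z) (λ _ → X) A) (subst-cong (λ { zero → X-[] z }) A)) As)))

  spine≅ : ∀ e v z c → D · (star · sN · z) · ⌜ e ⌝ · Tθ · Tθ · Gt v · ⌜ 0 ⌝ · c ≅ apps z (map (_[ z ]) Pre ++ six0 e v c)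
  spine≅ e v z c = ≅-trans (apps-cong (≅-trans (D≅ x) (≅-trans (apps-cong (star-head z) (≅*-refl (map (_[ x ]) As)))
      (≅-reflexive (≡.trans (≡.sym (apps-++ z (map (_[ z ]) Cs) (map (_[ x ]) As))) (cong (apps z) (≡.sym (Pre-[] z))))))) (≅*-refl (six0 e v c)))
    (≅-reflexive (≡.sym (apps-++ z (map (_[ z ]) Pre) (six0 e v c))))
    where x = star · sN · z

  Rs : ℕ → Term 0 → List (Term 1)
  Rs e v = Pre ++ six e v (Ho e)

  Rs-[] : ∀ e v z → map (_[ z ]) (Rs e v) ≡ map (_[ z ]) Pre ++ six0 e v (Ht (Bt e) (star · sN · z))
  Rs-[] e v z = ≡.trans (map-++ _ Pre _) (cong (map (_[ z ]) Pre ++_) (≡.trans (six-[] e v (Ho e) z) (cong (six0 e v) (Ho-[] e z))))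

  q-head : ∀ e v z → q e · z · v ≅ apps z (map (_[ z ]) (Rs e v))
  q-head e v z = ≅-trans (·-cong (→h⇒≅ (Ht-run (Bt e) sN z)) ≅-refl) (≅-trans (B-unfold e (star · sN · z) v)
    (≅-trans (spine≅ e v z _) (≅-reflexive (cong (apps z) (≡.sym (Rs-[] e v z))))))

  B-head : ∀ e v z → Bt e · z · v ≅ apps z (map (_[ z ]) As ++ six0 e v (Ht (Bt e) z))
  B-head e v z = ≅-trans (B-unfold e z v) (≅-trans (apps-cong (D≅ z) (≅*-refl (six0 e v _)))
    (≅-reflexive (≡.sym (apps-++ z (map (_[ z ]) As) (six0 e v _)))))

  Strict-q : ∀ e → Strict (q e)
  Strict-q e o with Solv-arg o
  ... | v , o' = ¬Solv-apps ¬Solv-Ω (map (_[ Ω ]) (Rs e v)) (Solv-≅ (q-head e v Ω) o')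

  Strict-P : ∀ N c → Strict (Pt N c)
  Strict-P N c = Strict-≅ (≅-sym (↠h⇒≅ (↠h-apps (c ∷ []) (proj₁ (proj₂ (P-run N))) ◅◅ (proj₂ (proj₂ (P-run N)) c ◅ ε)))) (Strict-prod _ _)

  ¬Strict-V : ¬ Strict V
  ¬Strict-V s = s (perm-Solv (a + 3) (Ω ∷ []) (≤-trans (s≤s z≤n) (m≤n+m 3 a)))

  ¬Strict-sel : ∀ m j → ¬ Strict (sel m j)
  ¬Strict-sel m j s = s (Solv-apps (sel m j · Ω) (pad m ++ I ∷ pad (j + 2) ++ Ω ∷ [])
    (≡.subst Solv (≡.sym (apps-++ (sel m j · Ω) (pad m) _))
      (Solv-run (↠h-apps (I ∷ pad (j + 2) ++ Ω ∷ []) (konst-full _ (suc m) (Ω ∷ pad m) (cong suc (length-replicate m)))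
        ◅◅ ≡.subst (_↠h konst 1 I · Ω) (≡.sym (apps-++ _ (I ∷ pad (j + 2)) (Ω ∷ []))) (↠h-apps (Ω ∷ []) (take-run 1 I (pad (j + 2)))))
        (Solv-run (hβ _ Ω ◅ ε) Solv-I))))

  Twofold-Q : ∀ {N m} c → N =β ⌜ m ⌝ → m ≤ a → Twofold (Qt N c)
  Twofold-Q {N} {m} c e le = twofold (numeral-exact e V)
    where
    p = Pt (sc · N) c
    twofold : (∃ λ Xs → length Xs ≡ m × N · fΩ · V ↠h apps V Xs) → Twofold (Qt N c)
    twofold (Xs , len , r) = Solv-run (↠h-apps (p ∷ Ω ∷ Ω ∷ []) r) (≡.subst Solv (apps-++ V Xs (p ∷ Ω ∷ Ω ∷ []))
      (perm-Solv (a + 3) (Xs ++ p ∷ Ω ∷ Ω ∷ []) (≡.subst (_≤ a + 3) (≡.sym (≡.trans (length-++ Xs) (cong (_+ 3) len))) (+-monoˡ-≤ 3 le))))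

  -- At a permutator z of sufficient arity, `q e · z · I` determines its arguments up to ≅, the
  -- label e among them, and 1 is not ≅ 0.
  q1≇q0 : ¬ (q 1 ≅ q 0)
  q1≇q0 e = label Pre' Pre' (perm-inj r _ _ (len 1) (len 0)
      (≅-trans (≅-reflexive (cong (apps z) (≡.sym (Rs-[] 1 I z)))) (≅-trans (≅-sym (q-head 1 I z)) (≅-trans (·-cong (·-cong e ≅-refl) ≅-refl)
        (≅-trans (q-head 0 I z) (≅-reflexive (cong (apps z) (Rs-[] 0 I z))))))))
    where
    r = length Pre + 6
    z = perm r
    Pre' = map (_[ z ]) Pre
    len : ∀ e → length (Pre' ++ six0 e I (Ht (Bt e) (star · sN · z))) ≤ r
    len e = ≡.subst (_≤ r) (≡.sym (≡.trans (length-++ Pre') (cong (_+ 6) (length-map _ Pre)))) ≤-refl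
    label : ∀ Ps Qs {c c'} → ¬ ((Ps ++ six0 1 I c) ≅* (Qs ++ six0 0 I c'))
    label Ps Qs es = 1≇0 (≅*-head (≅*-suffix Ps Qs _ _ refl es))

  -- The arguments before the label come from D z on one side and from D (s * z) on the other.
  -- Aligning the lists at their ends puts label against label whatever these prefixes are.
  B1≇q0 : ¬ (Bt 1 ≅ q 0)
  B1≇q0 e = 1≇0 (≅*-head (≅*-suffix (map (_[ z ]) As) Pre' _ _ refl (perm-inj r _ _ len₁ len₀
      (≅-trans (≅-sym (B-head 1 I z)) (≅-trans (·-cong (·-cong e ≅-refl) ≅-refl)
        (≅-trans (q-head 0 I z) (≅-reflexive (cong (apps z) (Rs-[] 0 I z)))))))))
    where
    r = (length As + 6) ⊔ (length Pre + 6)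
    z = perm r
    Pre' = map (_[ z ]) Pre
    len₁ : length (map (_[ z ]) As ++ six0 1 I (Ht (Bt 1) z)) ≤ r
    len₁ = ≡.subst (_≤ r) (≡.sym (≡.trans (length-++ (map (_[ z ]) As)) (cong (_+ 6) (length-map _ As)))) (m≤m⊔n _ _)
    len₀ : length (Pre' ++ six0 0 I (Ht (Bt 0) (star · sN · z))) ≤ r
    len₀ = ≡.subst (_≤ r) (≡.sym (≡.trans (length-++ Pre') (cong (_+ 6) (length-map _ Pre)))) (m≤n⊔m (length As + 6) _)

  Solv-B : ∀ e → Solv (Bt e · sN)
  Solv-B e = Solv-apps (Bt e · sN) (V ∷ konst 2 I ∷ []) (Solv-≅ (≅-sym (≅-trans (·-cong (B-unfold e sN V) ≅-refl)
     (≅-trans (↠h⇒≅ (↠h-apps (Tθ ∷ Gt V ∷ ⌜ 0 ⌝ ∷ q e ∷ konst 2 I ∷ []) (K*-exact D=K* ⌜ e ⌝ Tθ)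
       ◅◅ (↠h-apps (q e ∷ konst 2 I ∷ []) (proj₁ (proj₂ (P-run ⌜ 0 ⌝))) ◅◅ (happ _ (proj₂ (proj₂ (P-run ⌜ 0 ⌝)) (q e)) ◅ prod-run _ _ (konst 2 I) ◅ ε))))
       (↠h⇒≅ (konst-full I 2 (_ ∷ _ ∷ []) refl))))) Solv-I)

  open Stream V (ext* 0 a) public

  -- h carries the label 0; n is the position reached in the stream of
  -- arguments, the last k of which have not yet been consumed.
  record State (n : ℕ) (Z : Term 0) : Set where
    constructor state
    field
      p k  : ℕ
      h m  : Term 0
      Bs   : List (Term 0)
      start : Start p
      end   : p + k ≡ n
      shape : Z ≡ apps (h · m) Bs
      h≅    : h ≅ q 0
      m≅    : m ≅ ⌜ a ⌝
      Bs≅   : Bs ≅* str p k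

  Good : ℕ → Term 0 → Set
  Good p X = ∃ λ k → ∃ λ Z → apps X (str p k) ↠h Z × State (p + k) Z

  State-extend : ∀ {n Z} → State n Z → ∀ k → State (n + k) (apps Z (str n k))
  State-extend {n} (state p k₀ h m Bs st refl refl e₁ e₂ e₃) k =
    state p (k₀ + k) h m (Bs ++ str n k) st (≡.sym (+-assoc p k₀ k)) (≡.sym (apps-++ (h · m) Bs (str n k))) e₁ e₂
      (≡.subst ((Bs ++ str n k) ≅*_) (≡.sym (str-++ p k₀ k)) (≅*-++ e₃ (≅*-refl (str n k))))

  Good-expand : ∀ {p M N} → M →h N → Good p N → Good p M
  Good-expand {p} s (k , Z , r , st) = k , Z , →h-apps (str p k) s ◅ r , st

  -- With its converse `Good-push`, this reduces goodness of X to that of X applied to a closed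
  -- term, which is the form in which the ω-rule can be used. The index p exists for this shift.
  Good-pop : ∀ {p X} → Good p X → Good (suc p) (X · w p)
  Good-pop {p} {X} (zero , Z , r , st) = 0 , Z · w p , ↠h-apps (w p ∷ []) r ,
    ≡.subst (λ n → State n (Z · w p)) (≡.trans (+-comm p 1) (≡.sym (+-identityʳ (suc p))))
      (≡.subst (λ n → State (n + 1) (Z · w n)) (+-identityʳ p) (State-extend st 1))
  Good-pop {p} {X} (suc k , Z , r , st) = k , Z , r , ≡.subst (λ n → State n Z) (+-suc p k) st

  Good-push : ∀ {p X} → Good (suc p) (X · w p) → Good p X
  Good-push {p} (k , Z , r , st) = suc k , Z , r , ≡.subst (λ n → State n Z) (≡.sym (+-suc p k)) st

  Good-append : ∀ {p X} k → Good (p + k) (apps X (str p k)) → Good p X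
  Good-append {p} {X} k (k' , Z , r , st) = k + k' , Z ,
    ≡.subst (_↠h Z) (≡.trans (≡.sym (apps-++ X (str p k) (str (p + k) k'))) (cong (apps X) (≡.sym (str-++ p k k')))) r ,
    ≡.subst (λ n → State n Z) (+-assoc p k k') st

  q-body : ∀ c z → z ≅ ⌜ a ⌝ → ∀ τ → apps z ((map (_[ z ]) Pre ++ six0 0 V c) ++ ext* 0 a ++ τ) ≅ apps c (⌜ a ⌝ ∷ τ)
  q-body c z e τ = ≅-trans (≅-reflexive (≡.trans (apps-++ z (map (_[ z ]) Pre ++ six0 0 V c) _) (apps-++ _ (ext* 0 a) τ)))
    (apps-cong (≅-trans (apps-cong (≅-trans (≅-sym (spine≅ 0 V z c)) (apps-cong (·-cong ≅-refl star≅) (≅*-refl (six0 0 V c)))) (≅*-refl (ext* 0 a)))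
      (body-≅ sN 0 c D=K*)) (≅*-refl τ))
    where
    star≅ : star · sN · z ≅ sN
    star≅ = ≅-trans (·-cong ≅-refl e) (=β⇒≅ star-a)

  -- From one labelled state to the next one: h z v reaches an application of
  -- z, and then m ... c ... reaches an application of c, for generic z and c.
  module Next (h m v : Term 0) (h≅ : h ≅ q 0) (v≅ : v ≅ V) where

    M₁ : Term 1
    M₁ = wk0 h · var zero · wk0 v

    M₁-[] : ∀ z → M₁ [ z ] ≡ h · z · v
    M₁-[] z = ≡wk0-close refl ⊙ refl ⊙ ≡wk0-close refl

    first = head-inversion M₁ (Rs 0 V) λ z → ≅-trans (≅-reflexive (M₁-[] z))
      (≅-trans (·-cong (·-cong h≅ ≅-refl) v≅) (q-head 0 V z))

    j₁ : ℕ
    j₁ = proj₁ first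

    Ys₁ = proj₁ (proj₂ first)

    run₁ : ∀ (u : Fin j₁ → Term 0) → ∃ λ t → apps (h · m · v) (tabulate u) ⟶[ suc t ] apps m (map (subst (m • u)) Ys₁)
    run₁ u = ≡.subst (λ A → ∃ λ t → apps A (tabulate u) ⟶[ suc t ] apps m (map (subst (m • u)) Ys₁)) (M₁-[] m)
      (HeadRun-suc M₁ Ys₁ (headVar-wk0 h) (proj₁ (proj₂ (proj₂ first))) m u)

    args₁ : ∀ (u : Fin j₁ → Term 0) → map (subst (m • u)) Ys₁ ≅* ((map (_[ m ]) Pre ++ six0 0 V (Ht (Bt 0) (star · sN · m))) ++ tabulate u)
    args₁ u = ≡.subst (λ l → map (subst (m • u)) Ys₁ ≅* (l ++ tabulate u)) (Rs-[] 0 V m) (proj₂ (proj₂ (proj₂ first)) m u)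

  module Next₂ (m : Term 0) (m≅ : m ≅ ⌜ a ⌝) (τ Q₁ Q₂ : List (Term 0)) (x : Term 0)
    (Q₁≅ : Q₁ ≅* (map (_[ m ]) Pre ++ ⌜ 0 ⌝ ∷ Tθ ∷ Tθ ∷ Gt V ∷ ⌜ 0 ⌝ ∷ [])) (Q₂≅ : Q₂ ≅* (ext* 0 a ++ τ)) where

    M₂ : Term 1
    M₂ = apps (wk0 m) (map wk0 Q₁ ++ var zero ∷ map wk0 Q₂)

    M₂-[] : ∀ c → M₂ [ c ] ≡ apps m (Q₁ ++ c ∷ Q₂)
    M₂-[] c = ≡.trans (apps-wk0-head c m (map wk0 Q₁ ++ var zero ∷ map wk0 Q₂)) (cong (apps m) (≡.trans (map-++ (_[ c ]) (map wk0 Q₁) (var zero ∷ map wk0 Q₂))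
      (cong₂ _++_ (map-[]-wk0 c Q₁) (cong (c ∷_) (map-[]-wk0 c Q₂)))))

    regroup : ∀ c → (map (_[ m ]) Pre ++ ⌜ 0 ⌝ ∷ Tθ ∷ Tθ ∷ Gt V ∷ ⌜ 0 ⌝ ∷ []) ++ c ∷ ext* 0 a ++ τ ≡ (map (_[ m ]) Pre ++ six0 0 V c) ++ ext* 0 a ++ τ
    regroup c = ≡.trans (++-assoc (map (_[ m ]) Pre) _ _) (≡.sym (++-assoc (map (_[ m ]) Pre) (six0 0 V c) _))

    second = head-inversion M₂ (map wk0 (⌜ a ⌝ ∷ τ)) λ c → ≅-trans (≅-reflexive (M₂-[] c))
      (≅-trans (apps-cong ≅-refl (≅*-++ Q₁≅ (≅-refl ∷ Q₂≅))) (≅-trans (≅-reflexive (cong (apps m) (regroup c)))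
        (≅-trans (q-body c m m≅ τ) (≅-reflexive (cong (apps c) (≡.sym (map-[]-wk0 c (⌜ a ⌝ ∷ τ))))))))

    j₂ : ℕ
    j₂ = proj₁ second

    Ys₂ = proj₁ (proj₂ second)

    run₂ : ∀ (u : Fin j₂ → Term 0) → apps (apps m (Q₁ ++ x ∷ Q₂)) (tabulate u) ↠h apps x (map (subst (x • u)) Ys₂)
    run₂ u = ≡.subst (λ A → apps A (tabulate u) ↠h apps x (map (subst (x • u)) Ys₂)) (M₂-[] x)
      (HeadRun-inst M₂ Ys₂ (proj₁ (proj₂ (proj₂ second))) x u)

    args₂ : ∀ (u : Fin j₂ → Term 0) → map (subst (x • u)) Ys₂ ≅* (⌜ a ⌝ ∷ τ ++ tabulate u)
    args₂ u = ≡.subst (λ l → map (subst (x • u)) Ys₂ ≅* (l ++ tabulate u)) (map-[]-wk0 x (⌜ a ⌝ ∷ τ)) (proj₂ (proj₂ (proj₂ second)) x u)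

  str-tabulate : ∀ n j → ∃ λ (u : Fin j → Term 0) → str n j ≡ tabulate u
  str-tabulate n zero    = (λ ()) , refl
  str-tabulate n (suc j) with str-tabulate (suc n) j
  ... | u , e = (λ { zero → w n ; (suc i) → u i }) , cong (w n ∷_) e

  str-suc : ∀ p κ → Start p → str (suc p) (length (ext* 0 a) + κ) ≡ ext* 0 a ++ str (suc p + length (ext* 0 a)) κ
  str-suc p κ s = ≡.trans (str-++ (suc p) (length (ext* 0 a)) κ) (cong (_++ str (suc p + length (ext* 0 a)) κ) (∷-injectiveʳ (proj₁ (str-block {p} s))))

  Next-state : ℕ → Term 0 → Set
  Next-state n Z = ∃ λ k → ∃ λ t → ∃ λ Z' → apps Z (str n k) ⟶[ suc t ] Z' × State (n + k) Z'

  five : List (Term 0)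
  five = ⌜ 0 ⌝ ∷ Tθ ∷ Tθ ∷ Gt V ∷ ⌜ 0 ⌝ ∷ []

  finish : ∀ {n Z} m k τ p' κ Qs → m ≅ ⌜ a ⌝ → Start p' → p' + κ ≡ n + k → τ ≡ str p' κ →
    (∃ λ t → apps Z (str n k) ⟶[ suc t ] apps m Qs) →
    Qs ≅* ((map (_[ m ]) Pre ++ five) ++ Ht (Bt 0) (star · sN · m) ∷ ext* 0 a ++ τ) → Next-state n Z
  finish {n} {Z} m k τ p' κ Qs m≅ start' end refl (t , r) Qs≅ = go (split-≅* (map (_[ m ]) Pre ++ five) Qs Qs≅)
    where
    go : (∃ λ Q₁ → ∃ λ x → ∃ λ Q₂ → Qs ≡ Q₁ ++ x ∷ Q₂ × Q₁ ≅* (map (_[ m ]) Pre ++ five) × x ≅ Ht (Bt 0) (star · sN · m) × Q₂ ≅* (ext* 0 a ++ τ)) → Next-state n Z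
    go (Q₁ , x , Q₂ , refl , e₁ , e₂ , e₃) = done' (map (subst (x • u)) Ys₂) refl (args₂ u)
      where
      open Next₂ m m≅ τ Q₁ Q₂ x e₁ e₃
      u = proj₁ (str-tabulate (n + k) j₂)
      u≡ : str (n + k) j₂ ≡ tabulate u
      u≡ = proj₂ (str-tabulate (n + k) j₂)
      run : ∃ λ t' → apps Z (str n (k + j₂)) ⟶[ suc t' ] apps x (map (subst (x • u)) Ys₂)
      run = ⟶-◅◅ (≡.subst (_⟶[ suc t ] apps (apps m (Q₁ ++ x ∷ Q₂)) (tabulate u))
          (≡.sym (≡.trans (cong (apps Z) (≡.trans (str-++ n k j₂) (cong (str n k ++_) u≡))) (apps-++ Z (str n k) (tabulate u))))
          (⟶-apps (tabulate u) r)) (run₂ u)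
      x≅ : x ≅ q 0
      x≅ = ≅-trans e₂ (Ht-cong (Bt 0) (≅-trans (·-cong ≅-refl m≅) (=β⇒≅ star-a)))
      done' : ∀ Ys → Ys ≡ map (subst (x • u)) Ys₂ → Ys ≅* (⌜ a ⌝ ∷ τ ++ tabulate u) → Next-state n Z
      done' (m₂ ∷ Bs) eq (f ∷ fs) = k + j₂ , proj₁ run , apps (x · m₂) Bs ,
        ≡.subst (λ l → apps Z (str n (k + j₂)) ⟶[ suc (proj₁ run) ] apps x l) (≡.sym eq) (proj₂ run) ,
        state p' (κ + j₂) x m₂ Bs start' (≡.trans (≡.sym (+-assoc p' κ j₂)) (≡.trans (cong (_+ j₂) end) (+-assoc n k j₂))) refl x≅ f
          (≡.subst (Bs ≅*_) (≡.trans (cong (λ l → str p' κ ++ l) (≡.trans (≡.sym u≡) (cong (λ i → str i j₂) (≡.sym end)))) (≡.sym (str-++ p' κ j₂))) fs)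

  next-cons : ∀ {n} p k₁ h m v Bs → Start p → p + suc k₁ ≡ n → h ≅ q 0 → m ≅ ⌜ a ⌝ → v ≅ V → Bs ≅* str (suc p) k₁ →
    Next-state n (apps (h · m) (v ∷ Bs))
  next-cons {n} p k₁ h m v Bs start end h≅ m≅ v≅ Bs≅ = go (split-tabulate j₁ L j₁≤)
    where
    open Next h m v h≅ v≅
    ℓ = length (ext* 0 a)
    -- The first inversion asks for j₁ arguments and the second for the whole of `ext* 0 a`; Bs may
    -- be too short for either, so that much more of the stream is supplied.
    k = j₁ + ℓ
    κ = k₁ + j₁
    L = Bs ++ str n k
    τ = str (suc p + ℓ) κ
    lenL : length L ≡ k₁ + k
    lenL = ≡.trans (length-++ Bs) (cong₂ _+_ (≡.trans (≅*-length Bs≅) (length-str (suc p) k₁)) (length-str n k))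
    j₁≤ : j₁ ≤ length L
    j₁≤ = ≡.subst (j₁ ≤_) (≡.sym lenL) (≤-trans (m≤m+n j₁ ℓ) (m≤n+m k k₁))
    arith₁ : ∀ k₁ j ℓ → ℓ + (k₁ + j) ≡ k₁ + (j + ℓ)
    arith₁ = solve-∀
    arith₂ : ∀ p ℓ k₁ j → suc p + ℓ + (k₁ + j) ≡ p + suc k₁ + (j + ℓ)
    arith₂ = solve-∀
    L≅ : L ≅* (ext* 0 a ++ τ)
    L≅ = ≡.subst (L ≅*_) (≡.trans (≡.sym (≡.trans (str-++ (suc p) k₁ k) (cong (λ i → str (suc p) k₁ ++ str i k) (≡.trans (≡.sym (+-suc p k₁)) end))))
           (≡.trans (cong (str (suc p)) (≡.sym (arith₁ k₁ j₁ ℓ))) (str-suc p κ start)))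
      (≅*-++ Bs≅ (≅*-refl (str n k)))
    start' : Start (suc p + ℓ)
    start' = ≡.subst Start (+-suc p ℓ) (proj₂ (str-block {p} start))
    H = Ht (Bt 0) (star · sN · m)
    go : (∃ λ (u : Fin j₁ → Term 0) → ∃ λ tl → L ≡ tabulate u ++ tl) → Next-state n (apps (h · m) (v ∷ Bs))
    go (u , tl , eq) = finish m k τ (suc p + ℓ) κ (Ys ++ tl) m≅ start' (≡.trans (arith₂ p ℓ k₁ j₁) (cong (_+ k) end)) refl (t , run) args
      where
      Ys = map (subst (m • u)) Ys₁
      t = proj₁ (run₁ u)
      run : apps (apps (h · m · v) Bs) (str n k) ⟶[ suc t ] apps m (Ys ++ tl)
      run = ≡.subst₂ (_⟶[ suc t ]_)
        (≡.trans (≡.sym (apps-++ (h · m · v) (tabulate u) tl)) (≡.trans (cong (apps (h · m · v)) (≡.sym eq)) (apps-++ (h · m · v) Bs (str n k))))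
        (≡.sym (apps-++ m Ys tl)) (⟶-apps tl (proj₂ (run₁ u)))
      args : (Ys ++ tl) ≅* ((map (_[ m ]) Pre ++ five) ++ H ∷ ext* 0 a ++ τ)
      args = ≅*-trans (≅*-++ (args₁ u) (≅*-refl tl))
        (≡.subst₂ _≅*_ (≡.sym (≡.trans (++-assoc (map (_[ m ]) Pre ++ six0 0 V H) (tabulate u) tl) (cong ((map (_[ m ]) Pre ++ six0 0 V H) ++_) (≡.sym eq))))
          (≡.trans (++-assoc (map (_[ m ]) Pre) (six0 0 V H) (ext* 0 a ++ τ)) (≡.sym (++-assoc (map (_[ m ]) Pre) five (H ∷ ext* 0 a ++ τ))))
          (≅*-++ (≅*-refl (map (_[ m ]) Pre ++ six0 0 V H)) L≅))

  Next-shift : ∀ {n Z} → Next-state (suc n) (Z · w n) → Next-state n Z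
  Next-shift {n} (k , t , Z' , r , st) = suc k , t , Z' , r , ≡.subst (λ i → State i Z') (≡.sym (+-suc n k)) st

  w-start : ∀ p → Start p → w p ≡ V
  w-start p s = w-rest p s

  next : ∀ {n Z} → State n Z → Next-state n Z
  next (state p (suc k) h m (v ∷ Bs) start end refl h≅ m≅ (v≅ ∷ Bs≅)) =
    next-cons p k h m v Bs start end h≅ m≅ (≅-trans v≅ (≅-reflexive (w-start p start))) Bs≅
  next {n} (state p zero h m [] start end refl h≅ m≅ []) = Next-shift {Z = h · m}
    (next-cons p 0 h m (w n) [] start (≡.trans (+-suc p 0) (cong suc end)) h≅ m≅ (≅-reflexive (≡.trans (cong w (≡.sym (≡.trans (≡.sym (+-identityʳ p)) end))) (w-start p start))) [])

  -- If the run to the state has a first step, determinism removes it. If M with its k stream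
  -- elements is already a state, N has left it, and the following state, at least one step further,
  -- takes its place.
  Good-reduce : ∀ {p M N} → M →h N → Good p M → Good p N
  Good-reduce {p} s (k , Z , (suc t , r) , st) = k , Z , (t , step-drop (→h-apps (str p k) s) r) , st
  Good-reduce {p} {M} {N} s (k , Z , (zero , []) , st) = go (next st)
    where
    go : Next-state (p + k) (apps M (str p k)) → Good p N
    go (k' , t , Z' , r , st') = k + k' , Z' ,
      (t , step-drop (→h-apps (str p (k + k')) s) (≡.subst (_⟶[ suc t ] Z')
        (≡.trans (≡.sym (apps-++ M (str p k) (str (p + k) k'))) (cong (apps M) (≡.sym (str-++ p k k')))) r)) ,
      ≡.subst (λ n → State n Z') (+-assoc p k k') st'

  q0-blocks : ∀ j p → Start p → apps (q 0 · ⌜ a ⌝) (str p (j * length period)) ≅ q 0 · ⌜ a ⌝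
  q0-blocks zero    p s = ≅-refl
  q0-blocks (suc j) p s = ≅-trans (≅-reflexive (≡.trans (cong (apps (q 0 · ⌜ a ⌝)) (≡.trans (str-++ p ℓ (j * ℓ)) (cong (_++ str (p + ℓ) (j * ℓ)) (proj₁ (str-block {p} s)))))
      (apps-++ (q 0 · ⌜ a ⌝) period (str (p + ℓ) (j * ℓ)))))
    (≅-trans (apps-cong (≅-trans (apps-cong (q-a 0) (≅*-refl period)) (B-block 0)) (≅*-refl (str (p + ℓ) (j * ℓ))))
      (q0-blocks j (p + ℓ) (proj₂ (str-block {p} s))))
    where ℓ = length period

  State⇒Solv : ∀ {n Z} → State n Z → Solv Z
  State⇒Solv (state p k h m Bs start end refl h≅ m≅ Bs≅) = Solv-≅ (≅-sym (apps-cong (·-cong h≅ m≅) Bs≅))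
    -- k blocks have k + k * ℓ' elements: the k present arguments are completed to k whole blocks,
    -- and each block leads `q 0 · ⌜ a ⌝` back to itself up to ≅.
    (Solv-apps (apps (q 0 · ⌜ a ⌝) (str p k)) (str (p + k) (k * ℓ'))
      (≡.subst Solv (≡.trans (cong (apps (q 0 · ⌜ a ⌝)) (≡.trans (cong (str p) (*-suc k ℓ')) (str-++ p k (k * ℓ')))) (apps-++ _ (str p k) _))
        (Solv-≅ (≅-sym (≅-trans (q0-blocks k p start) (q-a 0))) (Solv-B 0))))
    where ℓ' = length (ext* 0 a)

  Good⇒Solv : ∀ {p X} → Good p X → Solv X
  Good⇒Solv {p} {X} (k , Z , r , st) = Solv-apps X (str p k) (Solv-run r (State⇒Solv st))

  -- Invariance of goodness under =ω

  infix 4 _≋_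
  -- The component `≋⇒≅` is carried along because replacements inside h, m or Bs must keep a state a
  -- state, and these parts are constrained by ≅.
  record _≋_ (P Q : Term 0) : Set where
    constructor _,_
    field
      ≋⇒≅    : P ≅ Q
      ≋⇒Good : ∀ p Ns → (Good p (apps P Ns) → Good p (apps Q Ns)) × (Good p (apps Q Ns) → Good p (apps P Ns))
  open _≋_

  State-SPar : ∀ {n Z Z'} → State n Z → SPar _≋_ Z Z' → Good n Z'
  State-SPar {n} (state p k h m Bs start end refl h≅ m≅ Bs≅) sp with SPar-apps (h · m) Bs sp
  ... | _ , Bs' , refl , (ph · pm) , ps = 0 , _ , ε ,
    state p k _ _ Bs' start (≡.trans end (≡.sym (+-identityʳ n))) refl
      (≅-trans (≅-sym (Par⇒≅ (Par-map ≋⇒≅ (SPar⇒Par ph)))) h≅)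
      (≅-trans (≅-sym (Par⇒≅ (Par-map ≋⇒≅ pm))) m≅)
      (≅*-trans (≅*-sym (Pars⇒≅* ps)) Bs≅)
    where
    Pars⇒≅* : ∀ {Ms Ns} → Pars _≋_ Ms Ns → Ms ≅* Ns
    Pars⇒≅* []       = []
    Pars⇒≅* (p ∷ ps) = Par⇒≅ (Par-map ≋⇒≅ p) ∷ Pars⇒≅* ps

  Good-Par : ∀ {p X Y} → Par _≋_ X Y → Good p X → Good p Y
  Good-Par {p} {X} {Y} par (k , Z , (t , r) , st) = Good-append k
    (ContextLemma.simulate _≋_ (Good (p + k)) (State (p + k)) Good-expand
      (λ e Ns → proj₁ (≋⇒Good e (p + k) Ns)) State-SPar r st (Par-apps par (Pars-refl (str p k))))

  ≋-refl : ∀ {M} → M ≋ M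
  ≋-refl = ≅-refl , λ p Ns → id , id

  ≋-sym : ∀ {M N} → M ≋ N → N ≋ M
  ≋-sym (e , f) = ≅-sym e , λ p Ns → proj₂ (f p Ns) , proj₁ (f p Ns)

  ≋-trans : ∀ {M N P} → M ≋ N → N ≋ P → M ≋ P
  ≋-trans (e , f) (e' , f') = ≅-trans e e' , λ p Ns → proj₁ (f' p Ns) ∘ proj₁ (f p Ns) , proj₂ (f p Ns) ∘ proj₂ (f' p Ns)

  ≋-→h : ∀ {M N} → M →h N → M ≋ N
  ≋-→h s = →h⇒≅ s , λ p Ns → Good-reduce (→h-apps Ns s) , Good-expand (→h-apps Ns s)

  ≋-unsolvable : ∀ {M N} → ¬ Solv M → ¬ Solv N → M ≋ N
  ≋-unsolvable {M} {N} u u' = ¬Solv⇒≅ u u' , λ p Ns →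
    (λ g → ⊥-elim (u (Solv-apps M Ns (Good⇒Solv g)))) , (λ g → ⊥-elim (u' (Solv-apps N Ns (Good⇒Solv g))))

  ≋-ext : ∀ {P Q} → (∀ V → P · V ≋ Q · V) → P ≋ Q
  ≋-ext {P} {Q} f = ≅-ext (λ V → ≋⇒≅ (f V)) , good
    where
    good : ∀ p Ns → (Good p (apps P Ns) → Good p (apps Q Ns)) × (Good p (apps Q Ns) → Good p (apps P Ns))
    good p (N ∷ Ns) = ≋⇒Good (f N) p Ns
    good p []       = (λ g → Good-push (proj₁ (≋⇒Good (f (w p)) (suc p) []) (Good-pop g))) ,
                      (λ g → Good-push (proj₂ (≋⇒Good (f (w p)) (suc p) []) (Good-pop g)))

  ≋-[] : ∀ (X : Term 1) {M N} → M ≋ N → X [ M ] ≋ X [ N ]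
  ≋-[] X e = Par⇒≅ (Par-map ≋⇒≅ (par e)) , λ p Ns →
      Good-Par (Par-apps (par e) (Pars-refl Ns)) , Good-Par (Par-apps (par (≋-sym e)) (Pars-refl Ns))
    where
    par : ∀ {M N} → M ≋ N → Par _≋_ (X [ M ]) (X [ N ])
    par e = Par-[] (Par-refl X) (Par-closed e)

  =ω⇒≋ : ∀ {M N} → M =ω N → M ≋ N
  =ω⇒≋ (ω-refl M)       = ≋-refl
  =ω⇒≋ (ω-β U N)        = ≋-→h (hβ U N)
  =ω⇒≋ (ω-βsym U N)     = ≋-sym (≋-→h (hβ U N))
  =ω⇒≋ (ω-unsol M u)    = ≋-unsolvable (Unsolvable⇒¬Solv u) ¬Solv-Ω
  =ω⇒≋ (ω-unsolsym M u) = ≋-unsolvable ¬Solv-Ω (Unsolvable⇒¬Solv u)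
  =ω⇒≋ (ω-leibniz X Y M N d e) = ≋-trans (≋-[] X (≋-sym (=ω⇒≋ e))) (≋-trans (=ω⇒≋ d) (≋-[] Y (=ω⇒≋ e)))
  =ω⇒≋ (ω-rule P Q f)   = ≋-ext (λ V → =ω⇒≋ (f V))

  -- The run of B_1 s meets no state

  ext*-last : ∀ m j → ∃ λ pre → ext* m j ≡ pre ++ K ∷ []
  ext*-last m zero    = [] , refl
  ext*-last m (suc j) with ext*-last (suc m) j
  ... | pre , e = K* ∷ pad (j + 2) ++ Ω ∷ sel m j ∷ pre ,
    cong (K* ∷_) (≡.trans (cong (λ l → pad (j + 2) ++ Ω ∷ sel m j ∷ l) e) (≡.sym (++-assoc (pad (j + 2)) (Ω ∷ sel m j ∷ pre) (K ∷ []))))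

  w-before : ∀ p → Start (suc p) → w p ≡ K
  w-before = before-start {K} {V ∷ proj₁ (ext*-last 0 a)} (cong (V ∷_) (proj₂ (ext*-last 0 a)))

  DS=K* : ∀ {S} → S =β sN → D · S =β K*
  DS=K* e = trans (=β-app refl e) D=K*

  Located : ℕ → Term 0 → Set
  Located P Z = (∃ λ p → ∃ λ Y → ∃ λ y → P ≡ suc p × Z ≡ Y · y × y ≅ w p) ⊎
                (∃ λ h → ∃ λ m → Start P × Z ≡ h · m × h ≅ q 0 × m ≅ ⌜ a ⌝)

  -- Where the arguments of a state begin, relative to a literal suffix of the stream.
  locate : ∀ {n} P κ Z → P + κ ≡ n → State n (apps Z (str P κ)) → Located P Z
  locate P κ Z refl (state p k h m Bs start end shape h≅ m≅ Bs≅) with <-cmp κ k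
  ... | tri≈ _ refl _ with apps-injective (str P κ) Bs (≡.trans (length-str P κ) (≡.sym (≡.trans (≅*-length Bs≅) (length-str p κ)))) shape
  ...   | e , _ = inj₂ (h , m , ≡.subst Start (+-cancelʳ-≡ κ p P end) start , e , h≅ , m≅)
  locate P κ Z refl (state p k h m Bs start end shape h≅ m≅ Bs≅) | tri< lt _ _ = go (split-≅* (str p i) Bs (≡.subst (Bs ≅*_) str≡ Bs≅))
    where
    i = k ∸ suc κ
    k≡ : k ≡ i + suc κ
    k≡ = ≡.sym (m∸n+n≡m lt)
    str≡ : str p k ≡ str p i ++ w (p + i) ∷ str (suc (p + i)) κ
    str≡ = ≡.trans (cong (str p) k≡) (str-++ p i (suc κ))
    P≡ : P ≡ suc (p + i)
    P≡ = +-cancelʳ-≡ κ P (suc (p + i)) (≡.trans (≡.sym end) (≡.trans (cong (p +_) k≡) (≡.trans (≡.sym (+-assoc p i (suc κ))) (+-suc (p + i) κ))))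
    go : (∃ λ Q₁ → ∃ λ z → ∃ λ Q₂ → Bs ≡ Q₁ ++ z ∷ Q₂ × Q₁ ≅* str p i × z ≅ w (p + i) × Q₂ ≅* str (suc (p + i)) κ) → Located P Z
    go (Q₁ , z , Q₂ , refl , _ , z≅ , Q₂≅) = inj₁ (p + i , _ , z , P≡ ,
      proj₁ (apps-injective (str P κ) Q₂ (≡.trans (length-str P κ) (≡.sym (≡.trans (≅*-length Q₂≅) (length-str _ κ))))
        (≡.trans shape (apps-++ (h · m) Q₁ (z ∷ Q₂)))) , z≅)
  -- Here m itself belongs to the literal stream and just precedes a block, so it is K, which is not
  -- ≅ to a numeral.
  locate P κ Z refl (state p k h m Bs start end shape h≅ m≅ Bs≅) | tri> _ _ gt = ⊥-elim (K≇numeral a (≅-trans (≅-reflexive (≡.sym m≡K)) m≅))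
    where
    i = κ ∸ suc k
    κ≡ : κ ≡ i + suc k
    κ≡ = ≡.sym (m∸n+n≡m gt)
    p≡ : p ≡ suc (P + i)
    p≡ = +-cancelʳ-≡ k p (suc (P + i)) (≡.trans end (≡.trans (cong (P +_) κ≡) (≡.trans (≡.sym (+-assoc P i (suc k))) (+-suc (P + i) k))))
    m≡K : m ≡ K
    m≡K = ≡.trans (·-injectiveʳ (proj₁ (apps-injective Bs (str (suc (P + i)) k)
        (≡.trans (≅*-length Bs≅) (≡.trans (length-str p k) (≡.sym (length-str _ k))))
        (≡.trans (≡.sym shape) (≡.trans (cong (apps Z) (≡.trans (cong (str P) κ≡) (str-++ P i (suc k)))) (apps-++ Z (str P i) _))))))
      (w-before (P + i) (≡.subst Start p≡ start))

  module Avoid (n : ℕ) where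

    P : Term 0 → Set
    P Z = ¬ State n Z

    At : Term 0 → List (Term 0) → Set
    At x R = ∃ λ p → ∃ λ κ → w p ≡ x × R ≡ str (suc p) κ × suc p + κ ≡ n

    At₀ : List (Term 0) → Set
    At₀ R = ∃ λ p → ∃ λ κ → Start p × R ≡ str p κ × p + κ ≡ n

    pop : ∀ {x y R} → At x (y ∷ R) → At y R
    pop (p , suc κ , _ , e , e') = suc p , κ , ≡.sym (∷-injectiveˡ e) , ∷-injectiveʳ e , ≡.trans (≡.sym (+-suc (suc p) κ)) e'

    pop₀ : ∀ {y R} → At₀ (y ∷ R) → At y R
    pop₀ (p , suc κ , _ , e , e') = p , κ , ≡.sym (∷-injectiveˡ e) , ∷-injectiveʳ e , ≡.trans (≡.sym (+-suc p κ)) e'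

    okλ : ∀ {x R} U → At x R → P (apps (ƛ U) R)
    okλ U (p , κ , _ , refl , e) st with locate (suc p) κ (ƛ U) e st
    ... | inj₁ (_ , _ , _ , _ , () , _)
    ... | inj₂ (_ , _ , _ , () , _)

    okλ₀ : ∀ {R} U → At₀ R → P (apps (ƛ U) R)
    okλ₀ U (p , κ , _ , refl , e) st with locate p κ (ƛ U) e st
    ... | inj₁ (_ , _ , _ , _ , () , _)
    ... | inj₂ (_ , _ , _ , () , _)

    -- A state would make y ≅ x, or else a block has just ended and x is K. Since y and K are strict
    -- and x is not, both fail.
    ok-strict : ∀ {x R y} Y → ¬ Strict x → Strict y → At x R → P (apps (Y · y) R)
    ok-strict Y nx sy (p , κ , refl , refl , e) st with locate (suc p) κ (Y · _) e st
    ... | inj₁ (.p , _ , _ , refl , refl , y≅) = nx (Strict-≅ y≅ sy)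
    ... | inj₂ (_ , _ , start , _) = nx (≡.subst Strict (≡.sym (w-before p start)) Strict-K)

    ok-twofold : ∀ {x R y} Y → ¬ Twofold x → Twofold y → At x R → P (apps (Y · y) R)
    ok-twofold Y nx ty (p , κ , refl , refl , e) st with locate (suc p) κ (Y · _) e st
    ... | inj₁ (.p , _ , _ , refl , refl , y≅) = nx (Twofold-≅ y≅ ty)
    ... | inj₂ (_ , _ , _ , refl , _ , m≅) = ¬Twofold-numeral a (Twofold-≅ m≅ ty)

    -- At a block boundary the argument is a numeral up to ≅, possibly that of a, and cannot exclude
    -- a state; the head Y has to.
    ok-start : ∀ {R y c} Y → ¬ (Y ≅ q 0) → y ≅ ⌜ c ⌝ → At₀ R → P (apps (Y · y) R)
    ok-start Y nY y≅ (p , κ , start , refl , e) st with locate p κ (Y · _) e st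
    ... | inj₁ (p' , _ , _ , refl , refl , y≅') = K≇numeral _ (≅-trans (≅-reflexive (≡.sym (w-before p' start))) (≅-trans (≅-sym y≅') y≅))
    ... | inj₂ (_ , _ , _ , refl , h≅ , _) = nY h≅

    At₀-block : ∀ {τ} → At₀ (period ++ τ) → At₀ τ
    At₀-block {τ} (p , κ , start , e , e') = p + ℓ , κ ∸ ℓ , proj₂ (str-block {p} start) ,
        ++-cancel (period) (≡.trans e (≡.trans (cong (str p) κ≡) (≡.trans (str-++ p ℓ (κ ∸ ℓ)) (cong (_++ str (p + ℓ) (κ ∸ ℓ)) (proj₁ (str-block {p} start)))))) ,
        ≡.trans (+-assoc p ℓ (κ ∸ ℓ)) (≡.trans (cong (p +_) (≡.sym κ≡)) e')
      where
      ℓ = length period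
      ++-cancel : ∀ (xs : List (Term 0)) {ys zs} → xs ++ ys ≡ xs ++ zs → ys ≡ zs
      ++-cancel []       e = e
      ++-cancel (x ∷ xs) e = ++-cancel xs (∷-injectiveʳ e)
      ℓ≤κ : ℓ ≤ κ
      ℓ≤κ = ≡.subst (ℓ ≤_) (≡.trans (≡.sym (length-++ period)) (≡.trans (cong length e) (length-str p κ))) (m≤m+n ℓ (length τ))
      κ≡ : κ ≡ ℓ + (κ ∸ ℓ)
      κ≡ = ≡.sym (m+[n∸m]≡n ℓ≤κ)

    -- Head reduction leaves `star · S · N'` unevaluated, so the sequence argument is controlled
    -- only up to conversion with ⌜s⌝, which is enough to repeat.
    level : ∀ S τ → S =β sN → At₀ (period ++ τ) →
      ∃ λ S' → S' =β sN × (∃ λ t → Run P (suc t) (apps (Bt 1 · S) (period ++ τ)) (apps (Bt 1 · S') τ))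
    level S τ e at = go (F-run 1 (Bt 1))
      where
      qS = Ht (Bt 1) S
      qS≅ : qS ≅ q 1
      qS≅ = Ht-cong (Bt 1) (=β⇒≅ e)
      strict : Strict qS
      strict = Strict-≅ (≅-sym qS≅) (Strict-q 1)
      S≅ : S ≅ ⌜ s ⌝
      S≅ = =β⇒≅ e
      ok-Q : ∀ {x R m N} Y → x ≡ K* ⊎ x ≡ K → N =β ⌜ m ⌝ → m ≤ a → At x R → P (apps (Y · Qt N qS) R)
      ok-Q Y (inj₁ refl) f le = ok-twofold Y (¬Twofold-numeral 0) (Twofold-Q qS f le)
      ok-Q Y (inj₂ refl) f le = ok-twofold Y ¬Twofold-K (Twofold-Q qS f le)
      open Extract isSucc P At qS pop okλ
        (λ Y → ok-strict Y ¬Strict-V strict)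
        (λ {R} {m} {j} Y → ok-strict Y (¬Strict-sel m j) strict)
        (λ {R} {m} {j} Y → ok-strict Y (¬Strict-sel m j) Strict-Ω)
        (λ {R} {m} {N} Y _ → ok-strict Y ¬Strict-K* (Strict-P N qS))
        ok-Q
        using (body-run)
      body = body-run 1 S τ (DS=K* e) (pop₀ at)
      N' = proj₁ body
      B≇ : ∀ {Y} → Bt 1 ↠h Y → ¬ (Y ≅ q 0)
      B≇ r e' = B1≇q0 (≅-trans (↠h⇒≅ r) e')
      under : ∀ {Y Y'} → Bt 1 ↠h Y → Y ↠h Y' → RunP P (apps (Y · S) (period ++ τ)) (apps (Y' · S) (period ++ τ))
      under b (_ , [])    = 0 , []
      under b (_ , s ∷ r) = (ok-start _ (B≇ b) S≅ at , →h-apps (period ++ τ) (happ S s)) ◂ under (b ◅◅ (s ◅ ε)) (_ , r)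
      go : (∃ λ U₁ → Ft 1 · Bt 1 →h ƛ U₁ × (∀ S → ∃ λ U₂ → ƛ U₁ · S →h ƛ U₂ ×
        (∀ V → ƛ U₂ · V →h D · S · ⌜ 1 ⌝ · Tθ · Tθ · Gt V · ⌜ 0 ⌝ · Ht (Bt 1) S))) →
        ∃ λ S' → S' =β sN × (∃ λ t → Run P (suc t) (apps (Bt 1 · S) (period ++ τ)) (apps (Bt 1 · S') τ))
      go (U₁ , s₁ , f) = star · S · N' , trans (=β-app (=β-app refl e) (proj₁ (proj₂ body))) star-a , _ , last-step
        where
        B-run : Bt 1 ↠h ƛ U₁
        B-run = Θ-run (Ft 1) ◅◅ (s₁ ◅ ε)
        U₂ = proj₁ (f S)
        main : RunP P (apps (Bt 1 · S) (period ++ τ)) (apps (qS · N') τ)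
        main = under ε B-run ◂◂
          ((ok-start (ƛ U₁) (B≇ B-run) S≅ at , →h-apps (period ++ τ) (proj₁ (proj₂ (f S)))) ◂
          (okλ₀ U₂ at , →h-apps (ext* 0 a ++ τ) (proj₂ (proj₂ (f S)) V)) ◂ proj₂ (proj₂ body))
        snoc : ∀ {t X Y Z} → Run P t X Y → P Y → Y →h Z → Run P (suc t) X Z
        snoc []           p s = step p s []
        snoc (step p' s' r) p s = step p' s' (snoc r p s)
        last-step = snoc (proj₂ main) (ok-start qS (λ e' → q1≇q0 (≅-trans (≅-sym qS≅) e')) (=β⇒≅ (proj₁ (proj₂ body))) (At₀-block at))
          (→h-apps τ (Ht-run (Bt 1) S N'))

    Run-++ : ∀ {t t' X Y Z} → Run P t X Y → Run P t' Y Z → Run P (t + t') X Z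
    Run-++ []           r' = r'
    Run-++ (step p s r) r' = step p s (Run-++ r r')

    levels : ∀ j p S → S =β sN → Start p → p + j * length period ≡ n →
      ∃ λ t → ∃ λ Y → j ≤ t × Run P t (apps (Bt 1 · S) (str p (j * length period))) Y
    levels zero    p S e start end = 0 , _ , z≤n , []
    levels (suc j) p S e start end = go (level S τ e (p , ℓ + j * ℓ , start , ≡.sym str≡ , end))
      where
      ℓ = length period
      τ = str (p + ℓ) (j * ℓ)
      str≡ : str p (ℓ + j * ℓ) ≡ period ++ τ
      str≡ = ≡.trans (str-++ p ℓ (j * ℓ)) (cong (_++ τ) (proj₁ (str-block {p} start)))
      go : (∃ λ S' → S' =β sN × (∃ λ t → Run P (suc t) (apps (Bt 1 · S) (period ++ τ)) (apps (Bt 1 · S') τ))) →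
        ∃ λ t → ∃ λ Y → suc j ≤ t × Run P t (apps (Bt 1 · S) (str p (suc j * ℓ))) Y
      go (S' , e' , t , r) with levels j (p + ℓ) S' e' (proj₂ (str-block {p} start)) (≡.trans (+-assoc p ℓ (j * ℓ)) end)
      ... | t' , Y , le , r' = suc t + t' , Y , s≤s (≤-trans le (m≤n+m t' t)) ,
        Run-++ (≡.subst (λ l → Run P (suc t) (apps (Bt 1 · S) l) (apps (Bt 1 · S') τ)) (≡.sym str≡) r) r'

  ¬Good-B1 : ¬ Good 0 (Bt 1 · sN)
  ¬Good-B1 (k , Z , (t , r) , st) = go (levels j 0 sN refl refl refl)
    where
    ℓ' = length (ext* 0 a)
    -- The supposed state appears after t steps on k elements. With j blocks there are at least k
    -- elements and at least j > t steps, so it would lie strictly inside a run that avoids states.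
    j = k + suc t
    k' = suc t + j * ℓ'
    n≡ : j * suc ℓ' ≡ k + k'
    n≡ = ≡.trans (*-suc j ℓ') (+-assoc k (suc t) (j * ℓ'))
    n = j * suc ℓ'
    open Avoid n
    st' : State n (apps Z (str k k'))
    st' = ≡.subst (λ i → State i (apps Z (str k k'))) (≡.sym n≡) (State-extend st k')
    r' : apps (Bt 1 · sN) (str 0 n) ⟶[ t ] apps Z (str k k')
    r' = ≡.subst (_⟶[ t ] apps Z (str k k'))
      (≡.trans (≡.sym (apps-++ (Bt 1 · sN) (str 0 k) (str k k'))) (cong (apps (Bt 1 · sN)) (≡.sym (≡.trans (cong (str 0) n≡) (str-++ 0 k k')))))
      (⟶-apps (str k k') r)
    go : (∃ λ t' → ∃ λ Y → j ≤ t' × Run P t' (apps (Bt 1 · sN) (str 0 n)) Y) → ⊥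
    go (t' , Y , le , run) = Run-visits run r' (≤-trans (m≤n+m (suc t) k) le) st'

  Good-B0 : Good 0 (Bt 0 · sN)
  Good-B0 = go (F-run 0 (Bt 0))
    where
    ℓ = length period
    open Extract isSucc (λ _ → ⊤) (λ _ _ → ⊤) (q 0) (λ _ → tt) (λ _ _ → tt) (λ _ _ → tt) (λ _ _ → tt) (λ _ _ → tt) (λ _ _ _ → tt) (λ _ _ _ _ _ → tt)
      using (body-run)
    body = body-run 0 sN [] D=K* tt
    N' = proj₁ body
    go : (∃ λ U₁ → Ft 0 · Bt 0 →h ƛ U₁ × (∀ S → ∃ λ U₂ → ƛ U₁ · S →h ƛ U₂ ×
        (∀ V → ƛ U₂ · V →h D · S · ⌜ 0 ⌝ · Tθ · Tθ · Gt V · ⌜ 0 ⌝ · Ht (Bt 0) S))) → Good 0 (Bt 0 · sN)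
    go (U₁ , s₁ , f) = ℓ , q 0 · N' , ≡.subst (λ l → apps (Bt 0 · sN) l ↠h q 0 · N') (≡.sym (≡.trans (proj₁ (str-block {0} refl)) (≡.sym (++-identityʳ period)))) run ,
      state ℓ 0 (q 0) N' [] (proj₂ (str-block {0} refl)) (+-identityʳ ℓ) refl ≅-refl (=β⇒≅ (proj₁ (proj₂ body))) []
      where
      R = ext* 0 a ++ []
      run : apps (Bt 0 · sN) (period ++ []) ↠h q 0 · N'
      run = ↠h-apps (sN ∷ V ∷ R) (Θ-run (Ft 0) ◅◅ (s₁ ◅ ε)) ◅◅
        (→h-apps (V ∷ R) (proj₁ (proj₂ (f sN))) ◅ →h-apps R (proj₂ (proj₂ (f sN)) V) ◅ RunP⇒↠h (proj₂ (proj₂ body)))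

  separation : ¬ (Bt 0 · sN =ω Bt 1 · sN)
  separation e = ¬Good-B1 (proj₁ (_≋_.≋⇒Good (=ω⇒≋ e) 0 []) Good-B0)

-- From an infinite chain above s to the separation

Unsecured-⪯ : ∀ code R n {σ τ} → σ ⪯ τ → Unsecured code R n τ → Unsecured code R n σ
Unsecured-⪯ code R n {σ} (ρ , refl) u σ' (b , υ , refl) = u σ' (b , υ ++ ρ , ≡.sym (++-assoc σ' (b ∷ υ) ρ))

theorem8p6 : (code : List ℕ → ℕ) → Injective _≡_ _≡_ code →
    (R : ℕ → ℕ → Bool) → (n : ℕ) →
    (star sc D : Term 0) → IsConcat code star → IsSucc sc → IsD code R n D →
    (σ : List ℕ) →
    B star sc D 0 · ⌜ code σ ⌝ =ω B star sc D 1 · ⌜ code σ ⌝ →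
    WellFoundedSubtree code R n σ
theorem8p6 code _ R n star sc D (concat , concat-nf) isSucc (D-nf , _ , _ , D-closed) σ eq (g , chain) =
  separation eq
  where
  unsecured : Unsecured code R n σ
  unsecured = Unsecured-⪯ code R n (proj₂ (proj₁ (chain 0))) (proj₁ (proj₁ (chain 0)))
  closed : HeadClosed* (D · ⌜ code σ ⌝) K*
  closed = D-closed σ unsecured
  head = D-head D ⌜ code σ ⌝ closed D-nf
  nf = concat-nf σ
  star-head : ∀ z → star · ⌜ code σ ⌝ · z ≅ apps z (map (_[ z ]) (proj₁ (proj₂ nf)))
  star-head z = ≅-trans (≅-reflexive (≡.sym (≡wk0-close refl ⊙ ≡wk0-close refl ⊙ refl)))
    (≅-trans (↠βΩ⇒≅ (single z) (proj₁ (proj₂ (proj₂ nf))))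
      (≅-reflexive (≡.trans (cong (_[ z ]) (proj₂ (proj₂ (proj₂ (proj₂ nf))))) (apps-[] z (var zero) (proj₁ (proj₂ nf))))))
  star-a : star · ⌜ code σ ⌝ · ⌜ code [] ⌝ =β ⌜ code σ ⌝
  star-a = ≡.subst (λ l → star · ⌜ code σ ⌝ · ⌜ code [] ⌝ =β ⌜ code l ⌝) (++-identityʳ σ) (concat σ [])
  open Separation star sc D (code []) (code σ) isSucc (proj₁ head) (proj₂ head) (HeadClosed*⇒=β closed)
    star-a (proj₁ (proj₂ nf)) star-head using (separation)
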